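{- For every pair of positive integers $r,t$, the class of graphs that do not contain an induced subgraph isomorphic to a subdivision of $K_{r,t}$ is polynomially $\chi$-bounded; that is, there is a polynomial $f$ such that $\chi(G)\le f(\omega(G))$ for every graph $G$ with no induced subdivision of $K_{r,t}$.
   Context: A subdivision of a graph $H$ is any graph obtained from $H$ by replacing edges by (possibly) longer paths. $\chi(G)$ is the chromatic number and $\omega(G)$ the clique number of $G$. -}

module Defs where

open import Data.Nat using (ℕ; zero; suc; _+_; _*_)
open import Data.Fin using (Fin; toℕ)
open import Data.Bool using (Bool; true; false)
open import Data.List using (List; []; _∷_)
open import Data.Product using (Σ; ∃; _×_; _,_)
open import Data.Sum using (_⊎_)
open import Relation.Nullary using (¬_)
open import Relation.Binary.PropositionalEquality using (_≡_; _≢_)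
open import Function.Definitions using (Injective)

record Graph (n : ℕ) : Set where
  field
    adj   : Fin n → Fin n → Bool
    sym   : ∀ u v → adj u v ≡ adj v u
    irrefl : ∀ v → adj v v ≡ false
open Graph public

Edge : ∀ {n} → Graph n → Fin n → Fin n → Set
Edge G u v = adj G u v ≡ true

-- Proper colouring with k colours; χ(G) ≤ k iff G is k-colourable.
Colorable : ∀ {n} → Graph n → ℕ → Set
Colorable {n} G k = Σ (Fin n → Fin k) λ c → ∀ u v → Edge G u v → c u ≢ c v

HasClique : ∀ {n} → Graph n → ℕ → Set
HasClique {n} G w = Σ (Fin w → Fin n) λ f →
  Injective _≡_ _≡_ f × (∀ a b → a ≢ b → Edge G (f a) (f b))

CliqueNumber : ∀ {n} → Graph n → ℕ → Set
CliqueNumber G w = HasClique G w × ¬ HasClique G (suc w)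

-- Subdivision of K_{r,t}: the edge {i,j} (i in the left side, j in the
-- right side) is replaced by a path with ℓ i j internal vertices.
module Subdivision (r t : ℕ) (ℓ : Fin r → Fin t → ℕ) where

  data SV : Set where
    left  : Fin r → SV
    right : Fin t → SV
    mid   : (i : Fin r) (j : Fin t) → Fin (ℓ i j) → SV

  data Step : SV → SV → Set where
    direct : ∀ i j → ℓ i j ≡ 0 → Step (left i) (right j)
    first  : ∀ i j (k : Fin (ℓ i j)) → toℕ k ≡ 0 → Step (left i) (mid i j k)
    inner  : ∀ i j (k k′ : Fin (ℓ i j)) → suc (toℕ k) ≡ toℕ k′ →
             Step (mid i j k) (mid i j k′)
    last   : ∀ i j (k : Fin (ℓ i j)) → suc (toℕ k) ≡ ℓ i j →
             Step (mid i j k) (right j)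

  SAdj : SV → SV → Set
  SAdj u v = Step u v ⊎ Step v u

ContainsInducedSubdivK : ∀ {n} → ℕ → ℕ → Graph n → Set
ContainsInducedSubdivK {n} r t G =
  Σ (Fin r → Fin t → ℕ) λ ℓ →
  let open Subdivision r t ℓ in
  Σ (SV → Fin n) λ φ →
    Injective _≡_ _≡_ φ ×
    (∀ u v → SAdj u v → Edge G (φ u) (φ v)) ×
    (∀ u v → Edge G (φ u) (φ v) → SAdj u v)

evalPoly : List ℕ → ℕ → ℕ
evalPoly []       x = 0
evalPoly (a ∷ as) x = a + x * evalPoly as x

{-# OPTIONS --safe #-}
-- Fix r, t and the clique number w. Every set of polynomially many (in w) vertices contains an independent set of
-- size t, so excluding an induced K_{r,t} gives a Kővári–Sós–Turán bound with polynomial dependence on w. It is shown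
-- that the graph is ρ-degenerate for a polynomial ρ in w. Otherwise take a minimal induced subgraph of average degree at
-- least ρ, and let B be its vertices of very large degree and L the others.
--
-- If L spans many edges, it has an induced subgraph with all degrees between d and D, where D / d is small compared to d.
-- Sample ends X at a rate slightly below 1 / D and inner vertices Z at a rate slightly above 1 / D. By local sparsity most
-- induced paths x y y′ x′ with x, x′ ∈ X and y, y′ ∈ Z are not disturbed by other sampled vertices, and they form an
-- induced subdivision of a graph F on X of large average degree. If L spans few edges, most edges join B to an
-- independent set A ⊆ L much larger than B. By the Kővári–Sós–Turán bound, after pruning B every vertex of B shares
-- neighbours in A with many vertices of B, and a random subset of B carries an induced subdivision of a dense graph F
-- whose subdivision vertices lie in A.
--
-- Contracting connected sets as in Mader's theorem, F contains r * t disjoint connected sets that all dominate a set of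
-- r + t further vertices; shortcutting the paths through them in G gives the induced subdivision of K_{r,t}.
module Submission where

open import Defs
open import Data.Nat using (ℕ; zero; suc; s≤s⁻¹; _+_; _*_; _∸_; _^_; _≤_; _<_; z≤n; s≤s; _≤?_; _<?_; >-nonZero)
open import Data.Nat.Properties
open import Data.Nat.Tactic.RingSolver using (solve-∀)
open import Data.Fin using (Fin; zero; suc; toℕ; combine)
import Data.Fin as F
import Data.Fin.Properties as FP
open import Data.Bool using (Bool; true; false; _∧_; _∨_; not; if_then_else_)
import Data.Bool as B
open import Data.List using (List; []; _∷_; length; lookup)
open import Data.List.Relation.Unary.All using (All; []; _∷_)
import Data.List.Relation.Unary.All as All
open import Data.Vec using (Vec; []; _∷_)
import Data.Vec.Relation.Unary.All as VAll
open import Data.Vec.Relation.Unary.All using ([]; _∷_)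
open import Data.Vec.Relation.Unary.AllPairs using (AllPairs; []; _∷_)
open import Data.Product using (Σ; ∃; _×_; _,_; proj₁; proj₂)
open import Data.Sum using (_⊎_; inj₁; inj₂)
open import Data.Empty using (⊥; ⊥-elim)
open import Function using (_∘_)
open import Function.Definitions using (Injective)
open import Relation.Nullary using (¬_; Dec; yes; no)
open import Relation.Nullary.Decidable using (⌊_⌋; _×-dec_; _⊎-dec_; _→-dec_; ¬?)
open import Relation.Binary.PropositionalEquality using (_≡_; _≢_; refl; trans; cong; cong₂; subst; subst₂; module ≡-Reasoning) renaming (sym to ≡-sym)
import Data.Sum as Sum
open import Data.Bool.Properties using (∧-comm)
open import Algebra.Properties.CommutativeSemigroup *-commutativeSemigroup using (x∙yz≈y∙xz)
import Algebra.Properties.CommutativeMonoid.Sum +-0-commutativeMonoid as ΣM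
import Algebra.Properties.Semiring.Sum +-*-semiring as ΣS

-- Finite sums, indicators and subsets

-- The bound is polynomial because `w` enters only through `N`, a polynomial in `w` that dominates
-- the Ramsey and Kővári-Sós-Turán constants; every later parameter is a polynomial in `N` with
-- exponents and coefficients depending on `r` and `t` alone, and so is the density that the
-- contraction argument asks for. The obstacle is inducedness: a sampled subdivision must have no
-- further adjacency. Two inner vertices per path leave room for two rates. Ends must be so rare
-- that a vertex hardly ever sees a foreign one, while inner vertices must be frequent enough for
-- every end to keep many paths, and then an inner vertex does have many sampled inner neighbours.
-- Such a neighbour does harm only if it sees a sampled end too, and this is rare unless a short
-- cycle is closed; local sparsity, that is few edges between any two neighbourhoods, bounds the
-- short cycles. All this works for any ratio `D / d` fixed in advance. So the cutoff between `B`
-- and `L` is chosen first, as a power of `N` relative to the average degree, and `d` afterwards, as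
-- a polynomial in that ratio.

opaque
  sum : ∀ {n} → (Fin n → ℕ) → ℕ
  sum = ΣM.sum

∑-syntax : ∀ {n} → (Fin n → ℕ) → ℕ
∑-syntax = sum

infixl 5 ∑-syntax
syntax ∑-syntax (λ i → e) = ∑[ i ] e

⟦_⟧ : Bool → ℕ
⟦ true ⟧ = 1
⟦ false ⟧ = 0

⟦⟧≤1 : ∀ b → ⟦ b ⟧ ≤ 1
⟦⟧≤1 true = ≤-refl
⟦⟧≤1 false = z≤n

⟦∧⟧ : ∀ a b → ⟦ a ∧ b ⟧ ≡ ⟦ a ⟧ * ⟦ b ⟧
⟦∧⟧ true b = ≡-sym (+-identityʳ ⟦ b ⟧)
⟦∧⟧ false b = refl

⟦⟧-le : ∀ b {m} → (b ≡ true → 1 ≤ m) → ⟦ b ⟧ ≤ m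
⟦⟧-le true h = h refl
⟦⟧-le false h = z≤n

⟦⟧*-le : ∀ b {x y} → (b ≡ true → x ≤ y) → ⟦ b ⟧ * x ≤ ⟦ b ⟧ * y
⟦⟧*-le true h = *-monoʳ-≤ 1 (h refl)
⟦⟧*-le false h = z≤n

true-or-false : ∀ b → b ≡ true ⊎ b ≡ false
true-or-false true = inj₁ refl
true-or-false false = inj₂ refl

true≢false : ∀ {b} → b ≡ true → b ≡ false → ⊥
true≢false refl ()

∧-intro : ∀ {a b} → a ≡ true → b ≡ true → a ∧ b ≡ true
∧-intro refl refl = refl

∧-elimˡ : ∀ {a b} → a ∧ b ≡ true → a ≡ true
∧-elimˡ {true} _ = refl

∧-elimʳ : ∀ {a b} → a ∧ b ≡ true → b ≡ true
∧-elimʳ {true} p = p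

not-intro : ∀ {a} → a ≡ false → not a ≡ true
not-intro refl = refl

not-elim : ∀ {a} → not a ≡ true → a ≡ false
not-elim {false} _ = refl

¬true⇒false : ∀ {a} → ¬ a ≡ true → a ≡ false
¬true⇒false {true} h = ⊥-elim (h refl)
¬true⇒false {false} h = refl

⌊⌋-intro : ∀ {P : Set} (d : Dec P) → P → ⌊ d ⌋ ≡ true
⌊⌋-intro (yes _) _ = refl
⌊⌋-intro (no ¬p) p = ⊥-elim (¬p p)

⌊⌋-elim : ∀ {P : Set} (d : Dec P) → ⌊ d ⌋ ≡ true → P
⌊⌋-elim (yes p) _ = p

⌊⌋-false : ∀ {P : Set} (d : Dec P) → ¬ P → ⌊ d ⌋ ≡ false
⌊⌋-false d ¬p = ¬true⇒false λ e → ¬p (⌊⌋-elim d e)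

eq : ∀ {n} → Fin n → Fin n → Bool
eq u v = ⌊ u FP.≟ v ⌋

eq-refl : ∀ {n} (v : Fin n) → eq v v ≡ true
eq-refl v = ⌊⌋-intro (v FP.≟ v) refl

eq⇒≡ : ∀ {n} {u v : Fin n} → eq u v ≡ true → u ≡ v
eq⇒≡ {u = u} {v} = ⌊⌋-elim (u FP.≟ v)

eq-false : ∀ {n} {u v : Fin n} → u ≢ v → eq u v ≡ false
eq-false {u = u} {v} = ⌊⌋-false (u FP.≟ v)

eq-false⇒≢ : ∀ {n} {u v : Fin n} → eq u v ≡ false → u ≢ v
eq-false⇒≢ {u = u} e refl = true≢false (eq-refl u) e

eq-suc : ∀ {n} (u v : Fin n) → eq (F.suc u) (F.suc v) ≡ eq u v
eq-suc u v with u FP.≟ v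
... | yes p = refl
... | no ¬p = refl

opaque
  unfolding sum
  sum-cong-≗ : ∀ {n} {f g : Fin n → ℕ} → (∀ i → f i ≡ g i) → sum f ≡ sum g
  sum-cong-≗ = ΣM.sum-cong-≗

  ∑-distrib-+ : ∀ {n} (f g : Fin n → ℕ) → sum (λ i → f i + g i) ≡ sum f + sum g
  ∑-distrib-+ = ΣM.∑-distrib-+

  ∑-mono : ∀ {n} {f g : Fin n → ℕ} → (∀ i → f i ≤ g i) → sum f ≤ sum g
  ∑-mono {zero} h = z≤n
  ∑-mono {suc n} h = +-mono-≤ (h F.zero) (∑-mono (h ∘ F.suc))

  ∑-zero : ∀ {n} {f : Fin n → ℕ} → (∀ i → f i ≡ 0) → sum f ≡ 0
  ∑-zero {zero} h = refl
  ∑-zero {suc n} h = cong₂ _+_ (h F.zero) (∑-zero (h ∘ F.suc))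

  ∑-*ˡ : ∀ {n} c (f : Fin n → ℕ) → c * sum f ≡ ∑[ i ] c * f i
  ∑-*ˡ c f = ΣS.*-distribˡ-sum c f

∑-*ʳ : ∀ {n} c (f : Fin n → ℕ) → sum f * c ≡ ∑[ i ] f i * c
∑-*ʳ c f = trans (*-comm (sum f) c) (trans (∑-*ˡ c f) (sum-cong-≗ λ i → *-comm c (f i)))

opaque
  unfolding sum
  ∑-swap : ∀ {m n} (f : Fin m → Fin n → ℕ) → (∑[ i ] ∑[ j ] f i j) ≡ (∑[ j ] ∑[ i ] f i j)
  ∑-swap f = ΣM.∑-comm f

∑-<⇒∃ : ∀ {n} (f g : Fin n → ℕ) → sum f < sum g → ∃ λ i → f i < g i
∑-<⇒∃ f g h with FP.any? (λ i → f i <? g i)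
... | yes p = p
... | no ¬p = ⊥-elim (<⇒≱ h (∑-mono λ i → ≮⇒≥ λ q → ¬p (i , q)))

opaque
  unfolding sum
  term≤∑ : ∀ {n} (f : Fin n → ℕ) i → f i ≤ sum f
  term≤∑ f F.zero = m≤m+n (f F.zero) _
  term≤∑ f (F.suc i) = ≤-trans (term≤∑ (f ∘ F.suc) i) (m≤n+m _ (f F.zero))

∑-pos⇒∃ : ∀ {n} (f : Fin n → ℕ) → 1 ≤ sum f → ∃ λ i → 1 ≤ f i
∑-pos⇒∃ {n} f h = ∑-<⇒∃ (λ _ → 0) f (subst (_< sum f) (≡-sym (∑-zero {n} λ _ → refl)) h)

⟦⟧-pos : ∀ {b} x → 1 ≤ ⟦ b ⟧ * x → b ≡ true × 1 ≤ x
⟦⟧-pos {true} x h = refl , subst (1 ≤_) (+-identityʳ x) h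

opaque
  unfolding sum
  ∑-const-≤ : ∀ {n} {f : Fin n → ℕ} c → (∀ i → f i ≤ c) → sum f ≤ n * c
  ∑-const-≤ {zero} c h = z≤n
  ∑-const-≤ {suc n} c h = +-mono-≤ (h F.zero) (∑-const-≤ c (h ∘ F.suc))

  ∑-const-≥ : ∀ {n} {f : Fin n → ℕ} c → (∀ i → c ≤ f i) → n * c ≤ sum f
  ∑-const-≥ {zero} c h = z≤n
  ∑-const-≥ {suc n} c h = +-mono-≤ (h F.zero) (∑-const-≥ c (h ∘ F.suc))

  ∑-eq : ∀ {n} (v : Fin n) (f : Fin n → ℕ) → (∑[ u ] ⟦ eq v u ⟧ * f u) ≡ f v
  ∑-eq {suc n} F.zero f = trans (cong₂ _+_ (+-identityʳ (f F.zero)) (∑-zero {n} λ _ → refl)) (+-identityʳ (f F.zero))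
  ∑-eq (F.suc v) f = trans (sum-cong-≗ λ u → cong (λ b → ⟦ b ⟧ * f (F.suc u)) (eq-suc v u)) (∑-eq v (f ∘ F.suc))

Sub : ℕ → Set
Sub n = Fin n → Bool

full : ∀ {n} → Sub n
full _ = true

infixl 8 _∖_
_∖_ : ∀ {n} → Sub n → Fin n → Sub n
(S ∖ v) u = S u ∧ not (eq v u)

infix 9 ∣_∣
∣_∣ : ∀ {n} → Sub n → ℕ
∣ S ∣ = ∑[ v ] ⟦ S v ⟧

∖-⊆ : ∀ {n} (S : Sub n) {u v} → (S ∖ v) u ≡ true → S u ≡ true
∖-⊆ S = ∧-elimˡ

∖-≢ : ∀ {n} (S : Sub n) {u v} → (S ∖ v) u ≡ true → v ≢ u
∖-≢ S {u} {v} p = eq-false⇒≢ (not-elim (∧-elimʳ {S u} p))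

∖-intro : ∀ {n} (S : Sub n) {u v} → S u ≡ true → v ≢ u → (S ∖ v) u ≡ true
∖-intro S p q = ∧-intro p (not-intro (eq-false q))

⟦∖⟧ : ∀ {n} (S : Sub n) {v} → S v ≡ true → ∀ u → ⟦ S u ⟧ ≡ ⟦ eq v u ⟧ + ⟦ (S ∖ v) u ⟧
⟦∖⟧ S {v} p u with v FP.≟ u
... | yes refl rewrite p = refl
... | no _ with S u
... | true = refl
... | false = refl

∑-split : ∀ {n} (S : Sub n) (f : Fin n → ℕ) {v} → S v ≡ true →
  (∑[ u ] ⟦ S u ⟧ * f u) ≡ f v + (∑[ u ] ⟦ (S ∖ v) u ⟧ * f u)
∑-split S f {v} p = begin
  (∑[ u ] ⟦ S u ⟧ * f u)
    ≡⟨ sum-cong-≗ (λ u → trans (cong (_* f u) (⟦∖⟧ S p u)) (*-distribʳ-+ (f u) ⟦ eq v u ⟧ _)) ⟩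
  (∑[ u ] ⟦ eq v u ⟧ * f u + ⟦ (S ∖ v) u ⟧ * f u)
    ≡⟨ ∑-distrib-+ (λ u → ⟦ eq v u ⟧ * f u) _ ⟩
  (∑[ u ] ⟦ eq v u ⟧ * f u) + (∑[ u ] ⟦ (S ∖ v) u ⟧ * f u)
    ≡⟨ cong (λ z → z + (∑[ u ] ⟦ (S ∖ v) u ⟧ * f u)) (∑-eq v f) ⟩
  f v + (∑[ u ] ⟦ (S ∖ v) u ⟧ * f u) ∎
  where open ≡-Reasoning

∑-card : ∀ {n} (S : Sub n) → (∑[ u ] ⟦ S u ⟧ * 1) ≡ ∣ S ∣
∑-card S = sum-cong-≗ λ u → *-identityʳ ⟦ S u ⟧

card-∖ : ∀ {n} (S : Sub n) {v} → S v ≡ true → ∣ S ∣ ≡ suc ∣ S ∖ v ∣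
card-∖ S {v} p = trans (≡-sym (∑-card S)) (trans (∑-split S (λ _ → 1) p) (cong suc (∑-card (S ∖ v))))

card-mono : ∀ {n} {S T : Sub n} → (∀ {v} → S v ≡ true → T v ≡ true) → ∣ S ∣ ≤ ∣ T ∣
card-mono {S = S} h = ∑-mono λ v → ⟦⟧-le (S v) λ p → subst (λ b → 1 ≤ ⟦ b ⟧) (≡-sym (h p)) ≤-refl

card-≤n : ∀ {n} (S : Sub n) → ∣ S ∣ ≤ n
card-≤n {n} S = subst (∣ S ∣ ≤_) (*-identityʳ n) (∑-const-≤ 1 (⟦⟧≤1 ∘ S))

opaque
  unfolding sum
  card-full : ∀ {n} → ∣ full {n} ∣ ≡ n
  card-full {zero} = refl
  card-full {suc n} = cong suc card-full

card-pos⇒∃ : ∀ {n} (S : Sub n) → 1 ≤ ∣ S ∣ → ∃ λ v → S v ≡ true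
card-pos⇒∃ S h with v , p ← ∑-pos⇒∃ _ h =
  v , proj₁ (⟦⟧-pos 1 (subst (1 ≤_) (≡-sym (*-identityʳ ⟦ S v ⟧)) p))

∃⇒card-pos : ∀ {n} (S : Sub n) {v} → S v ≡ true → 1 ≤ ∣ S ∣
∃⇒card-pos S p = subst (1 ≤_) (≡-sym (card-∖ S p)) (s≤s z≤n)

∑-sub-≤ : ∀ {n} (S : Sub n) {f : Fin n → ℕ} c → (∀ v → S v ≡ true → f v ≤ c) → (∑[ v ] ⟦ S v ⟧ * f v) ≤ ∣ S ∣ * c
∑-sub-≤ S {f} c h = subst ((∑[ v ] ⟦ S v ⟧ * f v) ≤_) (≡-sym (∑-*ʳ c _)) (∑-mono λ v → ⟦⟧*-le (S v) (h v))

∑-sub-≥ : ∀ {n} (S : Sub n) {f : Fin n → ℕ} c → (∀ v → S v ≡ true → c ≤ f v) → ∣ S ∣ * c ≤ (∑[ v ] ⟦ S v ⟧ * f v)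
∑-sub-≥ S {f} c h = subst (_≤ (∑[ v ] ⟦ S v ⟧ * f v)) (≡-sym (∑-*ʳ c _)) (∑-mono λ v → ⟦⟧*-le (S v) (h v))

∑-*-≤ : ∀ {n} (w : Fin n → ℕ) {f : Fin n → ℕ} {m} c → sum w ≤ m → (∀ v → f v ≤ c) → (∑[ v ] w v * f v) ≤ m * c
∑-*-≤ w {f} {m} c hw hf = begin
  (∑[ v ] w v * f v) ≤⟨ ∑-mono (λ v → *-monoʳ-≤ (w v) (hf v)) ⟩
  (∑[ v ] w v * c)   ≡⟨ ∑-*ʳ c w ⟨
  sum w * c          ≤⟨ *-monoˡ-≤ c hw ⟩
  m * c              ∎
  where open ≤-Reasoning

cons : ∀ {A : Set} {k} → A → (Fin k → A) → Fin (suc k) → A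
cons a f F.zero = a
cons a f (F.suc i) = f i

pick : ∀ {n} k (S : Sub n) → k ≤ ∣ S ∣ →
  Σ (Fin k → Fin n) λ f → Injective _≡_ _≡_ f × (∀ i → S (f i) ≡ true)
pick zero S h = (λ ()) , (λ {}) , λ ()
pick {n} (suc k) S h
  with v , p ← card-pos⇒∃ S (≤-trans (s≤s z≤n) h)
  with f , inj , inS ← pick k (S ∖ v) (s≤s⁻¹ (subst (suc k ≤_) (card-∖ S p) h))
  = cons v f , inj′ , λ { F.zero → p ; (F.suc i) → ∖-⊆ S (inS i) }
  where
  inj′ : Injective _≡_ _≡_ (cons v f)
  inj′ {F.zero} {F.zero} e = refl
  inj′ {F.zero} {F.suc j} e = ⊥-elim (∖-≢ S (inS j) e)
  inj′ {F.suc i} {F.zero} e = ⊥-elim (∖-≢ S (inS i) (≡-sym e))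
  inj′ {F.suc i} {F.suc j} e = cong F.suc (inj e)

opaque
  unfolding sum
  enum : ∀ {n} (S : Sub n) → Fin ∣ S ∣ → Fin n
  enum {suc n} S i with S F.zero
  enum {suc n} S F.zero | true = F.zero
  enum {suc n} S (F.suc i) | true = F.suc (enum (S ∘ F.suc) i)
  enum {suc n} S i | false = F.suc (enum (S ∘ F.suc) i)

  enum-∈ : ∀ {n} (S : Sub n) i → S (enum S i) ≡ true
  enum-∈ {suc n} S i with S F.zero in e
  enum-∈ {suc n} S F.zero | true = e
  enum-∈ {suc n} S (F.suc i) | true = enum-∈ (S ∘ F.suc) i
  enum-∈ {suc n} S i | false = enum-∈ (S ∘ F.suc) i

  enum-injective : ∀ {n} (S : Sub n) → Injective _≡_ _≡_ (enum S)
  enum-injective {suc n} S {i} {j} eq with S F.zero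
  enum-injective {suc n} S {F.zero} {F.zero} eq | true = refl
  enum-injective {suc n} S {F.suc i} {F.suc j} eq | true =
    cong F.suc (enum-injective (S ∘ F.suc) (FP.suc-injective eq))
  enum-injective {suc n} S {i} {j} eq | false = enum-injective (S ∘ F.suc) (FP.suc-injective eq)

  ∑-enum : ∀ {n} (S : Sub n) (f : Fin n → ℕ) → (∑[ i ] f (enum S i)) ≡ (∑[ v ] ⟦ S v ⟧ * f v)
  ∑-enum {zero} S f = refl
  ∑-enum {suc n} S f with S F.zero
  ... | true = cong₂ _+_ (≡-sym (+-identityʳ (f F.zero))) (∑-enum (S ∘ F.suc) (f ∘ F.suc))
  ... | false = ∑-enum (S ∘ F.suc) (f ∘ F.suc)

-- Independent sets and the induced Kővári–Sós–Turán bound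

infixl 7 _∩_
_∩_ : ∀ {n} → Sub n → Sub n → Sub n
(S ∩ T) v = S v ∧ T v

⟦∩⟧ : ∀ {n} (S T : Sub n) v → ⟦ (S ∩ T) v ⟧ ≡ ⟦ S v ⟧ * ⟦ T v ⟧
⟦∩⟧ S T v = ⟦∧⟧ (S v) (T v)

∩-split : ∀ a b → ⟦ a ⟧ ≡ ⟦ a ∧ b ⟧ + ⟦ a ∧ not b ⟧
∩-split true true = refl
∩-split true false = refl
∩-split false b = refl

nb : ∀ {n} → Graph n → Fin n → Sub n
nb = adj

nonNb : ∀ {n} → Graph n → Fin n → Sub n
nonNb G v u = not (adj G v u) ∧ not (eq v u)

deg : ∀ {n} → Graph n → Sub n → Fin n → ℕ
deg G S v = ∣ S ∩ nb G v ∣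

card-split : ∀ {n} (S T : Sub n) → ∣ S ∣ ≡ ∣ S ∩ T ∣ + (∑[ v ] ⟦ S v ∧ not (T v) ⟧)
card-split S T = trans (sum-cong-≗ λ v → ∩-split (S v) (T v)) (∑-distrib-+ _ _)

-- A chosen vertex discards at most `∣ C₀ ∣ / k` candidates, its non-neighbours in `C₀`, itself
-- included. The last hypothesis says that the surviving candidates outnumber what `j` further
-- choices can discard.
greedy-clique : ∀ {n} (G : Graph n) k (C₀ : Sub n) →
  (∀ v → C₀ v ≡ true → k * (∑[ u ] ⟦ C₀ u ∧ not (adj G v u) ⟧) ≤ ∣ C₀ ∣) →
  ∀ j (C : Sub n) → (∀ {v} → C v ≡ true → C₀ v ≡ true) → j * ∣ C₀ ∣ < k * ∣ C ∣ →
  Σ (Fin (suc j) → Fin n) λ f → (∀ i → C (f i) ≡ true) × (∀ a b → a ≢ b → Edge G (f a) (f b))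
greedy-clique {n} G k C₀ few j C C⊆ h with card-pos⇒∃ C (n≢0⇒n>0 λ e → n≮0 {j * ∣ C₀ ∣} (subst (j * ∣ C₀ ∣ <_) (trans (cong (k *_) e) (*-zeroʳ k)) h))
greedy-clique G k C₀ few zero C C⊆ h | v , v∈ =
  (λ _ → v) , (λ _ → v∈) , λ { F.zero F.zero ne → ⊥-elim (ne refl) }
greedy-clique {n} G k C₀ few (suc j) C C⊆ h | v , v∈ =
  cons v f , (λ { F.zero → v∈ ; (F.suc i) → ∧-elimˡ (inC i) }) , edges
  where
  bound : j * ∣ C₀ ∣ < k * ∣ C ∩ nb G v ∣
  bound = +-cancelˡ-< ∣ C₀ ∣ _ _ (begin-strict
    ∣ C₀ ∣ + j * ∣ C₀ ∣  <⟨ h ⟩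
    k * ∣ C ∣  ≡⟨ trans (cong (k *_) (card-split C (nb G v))) (trans (*-distribˡ-+ k ∣ C ∩ nb G v ∣ _) (+-comm (k * ∣ C ∩ nb G v ∣) _)) ⟩
    k * (∑[ u ] ⟦ C u ∧ not (adj G v u) ⟧) + k * ∣ C ∩ nb G v ∣
      ≤⟨ +-monoˡ-≤ _ (*-monoʳ-≤ k (card-mono {S = λ u → C u ∧ not (adj G v u)} {T = λ u → C₀ u ∧ not (adj G v u)} λ {u} p → ∧-intro (C⊆ (∧-elimˡ p)) (∧-elimʳ {C u} p))) ⟩
    k * (∑[ u ] ⟦ C₀ u ∧ not (adj G v u) ⟧) + k * ∣ C ∩ nb G v ∣ ≤⟨ +-monoˡ-≤ _ (few v (C⊆ v∈)) ⟩
    ∣ C₀ ∣ + k * ∣ C ∩ nb G v ∣ ∎)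
    where open ≤-Reasoning
  rec = greedy-clique G k C₀ few j (C ∩ nb G v) (λ p → C⊆ (∧-elimˡ p)) bound
  f = proj₁ rec
  inC = proj₁ (proj₂ rec)
  edges : ∀ a b → a ≢ b → Edge G (cons v f a) (cons v f b)
  edges F.zero F.zero ne = ⊥-elim (ne refl)
  edges F.zero (F.suc b) ne = ∧-elimʳ {C (f b)} (inC b)
  edges (F.suc a) F.zero ne = trans (Graph.sym G (f a) v) (∧-elimʳ {C (f a)} (inC a))
  edges (F.suc a) (F.suc b) ne = proj₂ (proj₂ rec) a b (λ e → ne (cong F.suc e))

edge⇒≢ : ∀ {n} (G : Graph n) {u v} → Edge G u v → u ≢ v
edge⇒≢ G e refl = true≢false e (irrefl G _)

edges⇒injective : ∀ {n k} (G : Graph n) (f : Fin k → Fin n) → (∀ a b → a ≢ b → Edge G (f a) (f b)) → Injective _≡_ _≡_ f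
edges⇒injective G f h {a} {b} e with a FP.≟ b
... | yes p = p
... | no ne = ⊥-elim (edge⇒≢ G (h a b ne) e)

-- The number of ordered independent `t`-tuples of distinct vertices of `S`. One independent set
-- would not do: the averaging in `popular-tuple` needs many of them in each neighbourhood.
indTuples : ∀ {n} → Graph n → ℕ → Sub n → ℕ
indTuples G zero S = 1
indTuples G (suc t) S = ∑[ v ] ⟦ S v ⟧ * indTuples G t (S ∩ nonNb G v)

indTuples-cong : ∀ {n} (G : Graph n) t {S T : Sub n} → (∀ v → S v ≡ T v) → indTuples G t S ≡ indTuples G t T
indTuples-cong G zero h = refl
indTuples-cong G (suc t) h = sum-cong-≗ λ v → cong₂ _*_ (cong ⟦_⟧ (h v))
  (indTuples-cong G t λ u → cong (_∧ nonNb G v u) (h u))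

-- The triangular number `t * (t + 1) / 2`. The first of `suc t` vertices costs one factor `a` for
-- its choice and shrinks the candidate set by a factor `a`, which costs `a ^ t` in the remaining
-- count.
tupleExp : ℕ → ℕ
tupleExp zero = 0
tupleExp (suc t) = suc (t + tupleExp t)

IndSet : ∀ {n} → Graph n → ℕ → Sub n → Set
IndSet {n} G t S = Σ (Fin t → Fin n) λ f → Injective _≡_ _≡_ f × (∀ a b → adj G (f a) (f b) ≡ false) × (∀ a → S (f a) ≡ true)

indSet-cons : ∀ {n} (G : Graph n) {t} (S : Sub n) v → S v ≡ true → IndSet G t (S ∩ nonNb G v) → IndSet G (suc t) S
indSet-cons {n} G {t} S v v∈ (f , inj , ind , inS) = cons v f , inj′ , ind′ , (λ { F.zero → v∈ ; (F.suc i) → ∧-elimˡ (inS i) })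
  where
  non : ∀ i → nonNb G v (f i) ≡ true
  non i = ∧-elimʳ {S (f i)} (inS i)
  nadj : ∀ i → adj G v (f i) ≡ false
  nadj i = not-elim (∧-elimˡ (non i))
  neq : ∀ i → v ≢ f i
  neq i = eq-false⇒≢ (not-elim (∧-elimʳ {not (adj G v (f i))} (non i)))
  inj′ : Injective _≡_ _≡_ (cons v f)
  inj′ {F.zero} {F.zero} e = refl
  inj′ {F.zero} {F.suc j} e = ⊥-elim (neq j e)
  inj′ {F.suc i} {F.zero} e = ⊥-elim (neq i (≡-sym e))
  inj′ {F.suc i} {F.suc j} e = cong F.suc (inj e)
  ind′ : ∀ a b → adj G (cons v f a) (cons v f b) ≡ false
  ind′ F.zero F.zero = irrefl G v
  ind′ F.zero (F.suc b) = nadj b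
  ind′ (F.suc a) F.zero = trans (Graph.sym G (f a) v) (nadj a)
  ind′ (F.suc a) (F.suc b) = ind a b

indTuples⇒indSet : ∀ {n} (G : Graph n) t (S : Sub n) → 1 ≤ indTuples G t S → IndSet G t S
indTuples⇒indSet G zero S h = (λ ()) , (λ {}) , (λ ()) , λ ()
indTuples⇒indSet G (suc t) S h
  with v , p ← ∑-pos⇒∃ _ h
  with v∈ , q ← ⟦⟧-pos {S v} _ p
  = indSet-cons G S v v∈ (indTuples⇒indSet G t _ q)

^-*-distrib : ∀ a b t → (a * b) ^ t ≡ a ^ t * b ^ t
^-*-distrib a b zero = refl
^-*-distrib a b (suc t) = trans (cong (a * b *_) (^-*-distrib a b t)) (lem a b (a ^ t) (b ^ t))
  where
  lem : ∀ a b x y → a * b * (x * y) ≡ a * x * (b * y)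
  lem = solve-∀

module _ {n : ℕ} (G : Graph n) (w : ℕ) (noClique : ¬ HasClique G (suc w)) where
  private
    -- One factor 2 pays for passing to more than half of `S` in `good-half`, the other for counting
    -- a vertex among its own non-neighbours; `suc w` is the size of the clique to be grown.
    a = 4 * suc w

  -- Otherwise more than half of S has few non-neighbours in S, and a clique can be grown greedily there.
  good-half : ∀ (S : Sub n) → a ≤ ∣ S ∣ →
    ∣ S ∣ ≤ 2 * (∑[ v ] ⟦ S v ∧ ⌊ ∣ S ∣ ≤? a * ∣ S ∩ nonNb G v ∣ ⌋ ⟧)
  good-half S h with ∣ S ∣ ≤? 2 * (∑[ v ] ⟦ S v ∧ ⌊ ∣ S ∣ ≤? a * ∣ S ∩ nonNb G v ∣ ⌋ ⟧)
  ... | yes p = p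
  ... | no ¬p = ⊥-elim (noClique (f , edges⇒injective G f fe , fe))
    where
    good : Sub n
    good v = ⌊ ∣ S ∣ ≤? a * ∣ S ∩ nonNb G v ∣ ⌋
    C : Sub n
    C v = S v ∧ not (good v)
    s = ∣ S ∣
    bad-many : s < 2 * ∣ C ∣
    bad-many = +-cancelˡ-< s s (2 * ∣ C ∣) (begin-strict
      s + s ≡⟨ cong₂ _+_ (card-split S good) (card-split S good) ⟩
      (∣ S ∩ good ∣ + ∣ C ∣) + (∣ S ∩ good ∣ + ∣ C ∣) ≡⟨ lem ∣ S ∩ good ∣ ∣ C ∣ ⟩
      2 * ∣ S ∩ good ∣ + 2 * ∣ C ∣ <⟨ +-monoˡ-< (2 * ∣ C ∣) (≰⇒> ¬p) ⟩
      s + 2 * ∣ C ∣ ∎)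
      where
      open ≤-Reasoning
      lem : ∀ x y → (x + y) + (x + y) ≡ 2 * x + 2 * y
      lem = solve-∀
    few : ∀ v → C v ≡ true → suc w * (∑[ u ] ⟦ C u ∧ not (adj G v u) ⟧) ≤ ∣ C ∣
    few v v∈ = *-cancelˡ-≤ 4 (begin
      4 * (suc w * m) ≤⟨ *-monoʳ-≤ 4 (*-monoʳ-≤ (suc w) m≤) ⟩
      4 * (suc w * (1 + x)) ≡⟨ lem (suc w) x ⟩
      a + a * x ≤⟨ +-mono-≤ h (<⇒≤ (≰⇒> λ q → true≢false (⌊⌋-intro (s ≤? a * x) q) (not-elim (∧-elimʳ {S v} v∈)))) ⟩
      s + s ≤⟨ +-mono-≤ (<⇒≤ bad-many) (<⇒≤ bad-many) ⟩
      2 * ∣ C ∣ + 2 * ∣ C ∣ ≡⟨ lem2 ∣ C ∣ ⟩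
      4 * ∣ C ∣ ∎)
      where
      open ≤-Reasoning
      m = ∑[ u ] ⟦ C u ∧ not (adj G v u) ⟧
      x = ∣ S ∩ nonNb G v ∣
      lem : ∀ k x → 4 * (k * (1 + x)) ≡ 4 * k + 4 * k * x
      lem = solve-∀
      lem2 : ∀ y → 2 * y + 2 * y ≡ 4 * y
      lem2 = solve-∀
      one : (∑[ u ] ⟦ eq v u ⟧ * 1) ≡ 1
      one = ∑-eq v (λ _ → 1)
      pt : ∀ s g e q → ⟦ (s ∧ g) ∧ not e ⟧ ≤ ⟦ q ⟧ * 1 + ⟦ s ∧ (not e ∧ not q) ⟧
      pt false g e q = z≤n
      pt true false e q = z≤n
      pt true true true q = z≤n
      pt true true false true = s≤s z≤n
      pt true true false false = s≤s z≤n
      m≤ : m ≤ 1 + x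
      m≤ = begin
        m ≤⟨ ∑-mono (λ u → pt (S u) (not (good u)) (adj G v u) (eq v u)) ⟩
        (∑[ u ] ⟦ eq v u ⟧ * 1 + ⟦ (S ∩ nonNb G v) u ⟧) ≡⟨ ∑-distrib-+ (λ u → ⟦ eq v u ⟧ * 1) _ ⟩
        (∑[ u ] ⟦ eq v u ⟧ * 1) + x ≡⟨ cong (_+ x) one ⟩
        1 + x ∎
    Cpos : 0 < ∣ C ∣
    Cpos = n≢0⇒n>0 λ e → n≮0 (subst (λ z → s < 2 * z) e bad-many)
    cl = greedy-clique G (suc w) C few w C (λ p → p) (*-monoˡ-< ∣ C ∣ ⦃ >-nonZero Cpos ⦄ (n<1+n w))
    f = proj₁ cl
    fe = proj₂ (proj₂ cl)

  -- Supersaturation: by `good-half` at least half of the vertices of `S` leave `∣ S ∣ / a`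
  -- candidates for the rest of the tuple, and that set is still large enough for the induction.
  indTuples-lower : ∀ t (S : Sub n) → a ^ t ≤ ∣ S ∣ → ∣ S ∣ ^ t ≤ a ^ tupleExp t * indTuples G t S
  indTuples-lower zero S h = ≤-refl
  indTuples-lower (suc t) S h = begin
    s * s ^ t ≤⟨ *-monoˡ-≤ (s ^ t) (good-half S a≤s) ⟩
    2 * (∑[ v ] ⟦ S v ∧ good v ⟧) * s ^ t ≡⟨ *-assoc 2 (∑[ v ] ⟦ S v ∧ good v ⟧) (s ^ t) ⟩
    2 * ((∑[ v ] ⟦ S v ∧ good v ⟧) * s ^ t) ≡⟨ cong (2 *_) (∑-*ʳ (s ^ t) _) ⟩
    2 * (∑[ v ] ⟦ S v ∧ good v ⟧ * s ^ t) ≤⟨ *-mono-≤ 2≤a (∑-mono pt) ⟩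
    a * (∑[ v ] A * (⟦ S v ⟧ * indTuples G t (S ∩ nonNb G v))) ≡⟨ cong (a *_) (∑-*ˡ A _) ⟨
    a * (A * indTuples G (suc t) S) ≡⟨ *-assoc a A _ ⟨
    a * A * indTuples G (suc t) S ∎
    where
    open ≤-Reasoning
    s = ∣ S ∣
    A = a ^ (t + tupleExp t)
    good : Sub n
    good v = ⌊ s ≤? a * ∣ S ∩ nonNb G v ∣ ⌋
    2≤a : 2 ≤ a
    2≤a = *-mono-≤ {2} {4} {1} {suc w} (s≤s (s≤s z≤n)) (s≤s z≤n)
    a>0 : 1 ≤ a
    a>0 = ≤-trans (s≤s z≤n) 2≤a
    a≤s : a ≤ s
    a≤s = ≤-trans (≤-trans (≤-reflexive (≡-sym (*-identityʳ a))) (*-monoʳ-≤ a (m^n>0 a ⦃ >-nonZero a>0 ⦄ t))) h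
    pt : ∀ v → ⟦ S v ∧ good v ⟧ * s ^ t ≤ A * (⟦ S v ⟧ * indTuples G t (S ∩ nonNb G v))
    pt v with S v | true-or-false (good v)
    ... | false | _ = z≤n
    ... | true | inj₂ e rewrite e = z≤n
    ... | true | inj₁ e rewrite e = begin
      1 * s ^ t ≡⟨ *-identityˡ (s ^ t) ⟩
      s ^ t ≤⟨ ^-monoˡ-≤ t sv ⟩
      (a * x) ^ t ≡⟨ ^-*-distrib a x t ⟩
      a ^ t * x ^ t ≤⟨ *-monoʳ-≤ (a ^ t) (indTuples-lower t (S ∩ nonNb G v) (*-cancelˡ-≤ a ⦃ >-nonZero a>0 ⦄ (≤-trans h sv))) ⟩
      a ^ t * (a ^ tupleExp t * J) ≡⟨ *-assoc (a ^ t) _ J ⟨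
      a ^ t * a ^ tupleExp t * J ≡⟨ cong (_* J) (^-distribˡ-+-* a t (tupleExp t)) ⟨
      A * J ≡⟨ cong (A *_) (*-identityˡ J) ⟨
      A * (1 * J) ∎
      where
      x = ∣ S ∩ nonNb G v ∣
      J = indTuples G t (S ∩ nonNb G v)
      sv : s ≤ a * x
      sv = ⌊⌋-elim (s ≤? a * x) e

  -- A Ramsey bound that is polynomial in the clique bound for fixed `t`.
  indSet-exists : ∀ t (S : Sub n) → a ^ t ≤ ∣ S ∣ → IndSet G t S
  indSet-exists t S h = indTuples⇒indSet G t S (n≢0⇒n>0 λ e → n≮0 (begin-strict
    0 <⟨ m^n>0 ∣ S ∣ ⦃ >-nonZero (≤-trans (m^n>0 a t) h) ⦄ t ⟩
    ∣ S ∣ ^ t ≤⟨ indTuples-lower t S h ⟩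
    a ^ tupleExp t * indTuples G t S ≡⟨ cong (a ^ tupleExp t *_) e ⟩
    a ^ tupleExp t * 0 ≡⟨ *-zeroʳ (a ^ tupleExp t) ⟩
    0 ∎))
    where open ≤-Reasoning

-- `K_{r,t}` is a subdivision of itself, with every `ℓ i j` equal to zero, so excluding induced
-- subdivisions also excludes induced bicliques.
biclique⇒subdivision : ∀ {n r t} (G : Graph n) {X Y : Sub n} ((f , _) : IndSet G r X) ((g , _) : IndSet G t Y) →
  (∀ i j → Edge G (f i) (g j)) → ContainsInducedSubdivK r t G
biclique⇒subdivision {n} {r} {t} G (f , f-inj , f-ind , _) (g , g-inj , g-ind , _) e = (λ _ _ → 0) , φ , φ-inj , pres , refl′
  where
  open Subdivision r t (λ _ _ → 0)
  φ : SV → Fin n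
  φ (left i) = f i
  φ (right j) = g j
  φ-inj : Injective _≡_ _≡_ φ
  φ-inj {left i} {left i′} p = cong left (f-inj p)
  φ-inj {left i} {right j} p = ⊥-elim (edge⇒≢ G (e i j) p)
  φ-inj {right j} {left i} p = ⊥-elim (edge⇒≢ G (e i j) (≡-sym p))
  φ-inj {right j} {right j′} p = cong right (g-inj p)
  pres : ∀ u v → SAdj u v → Edge G (φ u) (φ v)
  pres _ _ (inj₁ (direct i j _)) = e i j
  pres _ _ (inj₂ (direct i j _)) = trans (Graph.sym G (g j) (f i)) (e i j)
  refl′ : ∀ u v → Edge G (φ u) (φ v) → SAdj u v
  refl′ (left i) (left i′) p = ⊥-elim (true≢false p (f-ind i i′))
  refl′ (left i) (right j) p = inj₁ (direct i j refl)
  refl′ (right j) (left i) p = inj₂ (direct i j refl)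
  refl′ (right j) (right j′) p = ⊥-elim (true≢false p (g-ind j j′))

-- The number of pairs of an independent tuple of X and a common neighbour in Y.
stars : ∀ {n} → Graph n → ℕ → Sub n → Sub n → ℕ
stars G t X Y = ∑[ y ] ⟦ Y y ⟧ * indTuples G t (X ∩ nb G y)

-- Sorting by the first vertex `v` of the tuple leaves a count of the same kind, one vertex shorter,
-- among the non-neighbours of `v` in `X` and its neighbours in `Y`.
stars-suc : ∀ {n} (G : Graph n) t X Y →
  stars G (suc t) X Y ≡ (∑[ v ] ⟦ X v ⟧ * stars G t (X ∩ nonNb G v) (Y ∩ nb G v))
stars-suc G t X Y = begin
  (∑[ y ] ⟦ Y y ⟧ * (∑[ v ] ⟦ (X ∩ nb G y) v ⟧ * J y v)) ≡⟨ sum-cong-≗ (λ y → ∑-*ˡ ⟦ Y y ⟧ _) ⟩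
  (∑[ y ] ∑[ v ] ⟦ Y y ⟧ * (⟦ (X ∩ nb G y) v ⟧ * J y v)) ≡⟨ ∑-swap (λ y v → ⟦ Y y ⟧ * (⟦ (X ∩ nb G y) v ⟧ * J y v)) ⟩
  (∑[ v ] ∑[ y ] ⟦ Y y ⟧ * (⟦ (X ∩ nb G y) v ⟧ * J y v)) ≡⟨ sum-cong-≗ (λ v → sum-cong-≗ λ y → pt v y) ⟩
  (∑[ v ] ∑[ y ] ⟦ X v ⟧ * (⟦ (Y ∩ nb G v) y ⟧ * J′ y v)) ≡⟨ sum-cong-≗ (λ v → ∑-*ˡ ⟦ X v ⟧ _) ⟨
  (∑[ v ] ⟦ X v ⟧ * stars G t (X ∩ nonNb G v) (Y ∩ nb G v)) ∎
  where
  open ≡-Reasoning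
  J J′ : _ → _ → ℕ
  J y v = indTuples G t ((X ∩ nb G y) ∩ nonNb G v)
  J′ y v = indTuples G t ((X ∩ nonNb G v) ∩ nb G y)
  perm : ∀ a b c → (a ∧ b) ∧ c ≡ (a ∧ c) ∧ b
  perm true b c = ∧-comm b c
  perm false b c = refl
  lem : ∀ y x e j → y * (x * e * j) ≡ x * (y * e * j)
  lem = solve-∀
  pt : ∀ v y → ⟦ Y y ⟧ * (⟦ (X ∩ nb G y) v ⟧ * J y v) ≡ ⟦ X v ⟧ * (⟦ (Y ∩ nb G v) y ⟧ * J′ y v)
  pt v y rewrite ⟦∩⟧ X (nb G y) v | ⟦∩⟧ Y (nb G v) y | Graph.sym G v y
    | indTuples-cong G t {(X ∩ nb G y) ∩ nonNb G v} {(X ∩ nonNb G v) ∩ nb G y} (λ u → perm (X u) (adj G y u) (nonNb G v u))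
    = lem ⟦ Y y ⟧ ⟦ X v ⟧ ⟦ adj G y v ⟧ (J′ y v)

weighted-pigeonhole : ∀ {n} (X : Sub n) (f : Fin n → ℕ) {κ b} → 1 ≤ b → 1 ≤ κ → ∣ X ∣ ≤ κ →
  κ * b ≤ (∑[ v ] ⟦ X v ⟧ * f v) → ∃ λ v → X v ≡ true × b ≤ f v
weighted-pigeonhole {n} X f {κ} {suc b} _ κ≥1 X≤ h with FP.any? (λ v → (X v B.≟ true) ×-dec (suc b ≤? f v))
... | yes p = p
... | no ¬p = ⊥-elim (<⇒≱ (*-monoʳ-< κ ⦃ >-nonZero κ≥1 ⦄ (n<1+n b)) (begin
  κ * suc b ≤⟨ h ⟩
  (∑[ v ] ⟦ X v ⟧ * f v) ≤⟨ ∑-sub-≤ X b (λ v v∈ → s≤s⁻¹ (≰⇒> λ q → ¬p (v , v∈ , q))) ⟩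
  ∣ X ∣ * b ≤⟨ *-monoˡ-≤ b X≤ ⟩
  κ * b ∎))
  where open ≤-Reasoning

-- Pigeonhole over one tuple vertex at a time: each of the `r` rounds loses a factor `κ`, and `Y`
-- shrinks to the neighbours of the vertex just chosen.
popular-tuple : ∀ {n} (G : Graph n) r (X Y : Sub n) {κ c} → 1 ≤ c → 1 ≤ κ → ∣ X ∣ ≤ κ → κ ^ r * c ≤ stars G r X Y →
  Σ (IndSet G r X) λ T → Σ (Sub n) λ Y′ → c ≤ ∣ Y′ ∣ × (∀ y → Y′ y ≡ true → Y y ≡ true × (∀ i → Edge G (proj₁ T i) y))
popular-tuple G zero X Y {κ} {c} c≥1 κ≥1 X≤ h =
  ((λ ()) , (λ {}) , (λ ()) , λ ()) , Y ,
  subst (c ≤_) (∑-card Y) (subst (_≤ stars G zero X Y) (+-identityʳ c) h) , λ y p → p , λ ()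
popular-tuple G (suc r) X Y {κ} {c} c≥1 κ≥1 X≤ h
  with v , v∈ , q ← weighted-pigeonhole X _ (*-mono-≤ (m^n>0 κ ⦃ >-nonZero κ≥1 ⦄ r) c≥1) κ≥1 X≤
         (subst₂ _≤_ (*-assoc κ (κ ^ r) c) (stars-suc G r X Y) h)
  with T , Y′ , c≤ , com ← popular-tuple G r (X ∩ nonNb G v) (Y ∩ nb G v) {κ} {c} c≥1 κ≥1 (≤-trans (card-mono {T = X} ∧-elimˡ) X≤) q
  = indSet-cons G X v v∈ T , Y′ , c≤ ,
    λ y p → let yY , ye = com y p in ∧-elimˡ yY , λ { F.zero → ∧-elimʳ {Y y} yY ; (F.suc i) → ye i }

-- Induced subdivisions from linkages

data Reach {n} (G : Graph n) (P : Fin n → Set) : Fin n → Fin n → Set where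
  here : ∀ {u} → P u → Reach G P u u
  step : ∀ {u v x} → P u → Edge G u v → Reach G P v x → Reach G P u x

reach-∈ : ∀ {n} {G : Graph n} {P u v} → Reach G P u v → P u
reach-∈ (here p) = p
reach-∈ (step p _ _) = p

reach-snoc : ∀ {n} {G : Graph n} {P u v x} → Reach G P u v → Edge G v x → P x → Reach G P u x
reach-snoc (here p) e q = step p e (here q)
reach-snoc (step p e r) e′ q = step p e (reach-snoc r e′ q)

reach-trans : ∀ {n} {G : Graph n} {P u v x} → Reach G P u v → Reach G P v x → Reach G P u x
reach-trans (here p) s = s
reach-trans (step p e r) s = step p e (reach-trans r s)

reach-sym : ∀ {n} {G : Graph n} {P u v} → Reach G P u v → Reach G P v u
reach-sym (here p) = here p
reach-sym {G = G} (step {u} {v} p e r) = reach-snoc (reach-sym r) (trans (Graph.sym G v u) e) p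

reach-map : ∀ {n} {G : Graph n} {P Q : Fin n → Set} → (∀ {u} → P u → Q u) → ∀ {u v} → Reach G P u v → Reach G Q u v
reach-map f (here p) = here (f p)
reach-map f (step p e r) = step (f p) e (reach-map f r)

all-at : ∀ {A : Set} {P : A → Set} {us : List A} → All P us → ∀ l → P (lookup us l)
all-at (p ∷ _) F.zero = p
all-at (_ ∷ ps) (F.suc l) = all-at ps l

Away : ∀ {n} → Graph n → Fin n → Fin n → Set
Away G v x = adj G v x ≡ false × v ≢ x

-- An induced path through the listed vertices, whose last vertex is the only neighbour of b.
data IndPath {n} (G : Graph n) (b : Fin n) : List (Fin n) → Set where
  end : ∀ {v} → Edge G v b → IndPath G b (v ∷ [])
  link : ∀ {v u us} → Edge G v u → adj G v b ≡ false → v ≢ u → All (Away G v) us → IndPath G b (u ∷ us) → IndPath G b (v ∷ u ∷ us)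

module _ {n : ℕ} (G : Graph n) (P : Fin n → Set) (b : Fin n) where

  -- The search starts at the end near `b`, so `v` is joined at its last contact with the path, and
  -- all vertices between that contact and `b` are already known to be away from `v`. If `v` lies on
  -- the path, the part from `v` on is kept.
  attach-or-away : ∀ v us → P v → adj G v b ≡ false → All P us → us ≡ [] ⊎ IndPath G b us →
    (Σ (List (Fin n)) λ q → IndPath G b (v ∷ q) × All P q) ⊎ All (Away G v) us
  attach-or-away v [] v∈ vb [] _ = inj₂ []
  attach-or-away v (u ∷ us) v∈ vb (u∈ ∷ us∈) (inj₂ path) with attach-or-away v us v∈ vb us∈ (tail path)
    where
    tail : IndPath G b (u ∷ us) → us ≡ [] ⊎ IndPath G b us
    tail (end _) = inj₁ refl
    tail (link _ _ _ _ p) = inj₂ p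
  ... | inj₁ found = inj₁ found
  ... | inj₂ away with v FP.≟ u
  ... | yes refl = inj₁ (us , path , us∈)
  ... | no v≢u with true-or-false (adj G v u)
  ... | inj₁ e = inj₁ (u ∷ us , link e vb v≢u away path , u∈ ∷ us∈)
  ... | inj₂ ne = inj₂ ((ne , v≢u) ∷ away)

  prepend : ∀ v u us → P v → All P (u ∷ us) → Edge G v u → IndPath G b (u ∷ us) → Σ (List (Fin n)) λ q → IndPath G b (v ∷ q) × All P q
  prepend v u us v∈ us∈ e path with true-or-false (adj G v b)
  ... | inj₁ vb = [] , end vb , []
  ... | inj₂ vb with attach-or-away v (u ∷ us) v∈ vb us∈ (inj₂ path)
  ... | inj₁ found = found
  ... | inj₂ ((ne , _) ∷ _) = ⊥-elim (true≢false e ne)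

  reach⇒path : ∀ {u v} → Reach G P u v → Edge G v b → Σ (List (Fin n)) λ q → IndPath G b (u ∷ q) × All P q
  reach⇒path (here p) e = [] , end e , []
  reach⇒path (step {u} {v} p e r) e′ with q , path , q∈ ← reach⇒path r e′ = prepend u v q p (reach-∈ r ∷ q∈) e path

path-ends : ∀ {n} (G : Graph n) {b} us → IndPath G b us → ∀ (k : Fin (length us)) →
  (suc (toℕ k) ≡ length us → Edge G (lookup us k) b) × (Edge G (lookup us k) b → suc (toℕ k) ≡ length us)
path-ends G (v ∷ []) (end e) F.zero = (λ _ → e) , λ _ → refl
path-ends G (v ∷ u ∷ us) (link _ vb _ _ p) F.zero = (λ ()) , λ e → ⊥-elim (true≢false e vb)
path-ends G (v ∷ u ∷ us) (link _ _ _ _ p) (F.suc k) with f , g ← path-ends G (u ∷ us) p k =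
  (λ e → f (suc-injective e)) , λ e → cong suc (g e)

path-inner : ∀ {n} (G : Graph n) {b} us → IndPath G b us → ∀ (k l : Fin (length us)) →
  (suc (toℕ k) ≡ toℕ l → Edge G (lookup us k) (lookup us l)) ×
  (Edge G (lookup us k) (lookup us l) → suc (toℕ k) ≡ toℕ l ⊎ suc (toℕ l) ≡ toℕ k)
path-inner G (v ∷ []) (end e) F.zero F.zero = (λ ()) , λ e → ⊥-elim (true≢false e (irrefl G v))
path-inner G (v ∷ u ∷ us) (link e _ _ _ p) F.zero F.zero = (λ ()) , λ e → ⊥-elim (true≢false e (irrefl G v))
path-inner G (v ∷ u ∷ us) (link e vb _ _ p) F.zero (F.suc F.zero) = (λ _ → e) , λ _ → inj₁ refl
path-inner G (v ∷ u ∷ us) (link e vb _ aw p) F.zero (F.suc (F.suc l)) =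
  (λ ()) , λ e → ⊥-elim (true≢false e (proj₁ (all-at aw l)))
path-inner G (v ∷ u ∷ us) (link _ _ _ _ p) (F.suc F.zero) F.zero = (λ ()) , λ _ → inj₂ refl
path-inner G (v ∷ u ∷ us) (link _ _ _ aw p) (F.suc (F.suc k)) F.zero =
  (λ ()) , λ e → ⊥-elim (true≢false (trans (Graph.sym G v _) e) (proj₁ (all-at aw k)))
path-inner G (v ∷ u ∷ us) (link e vb _ _ p) (F.suc k) (F.suc l) with f , g ← path-inner G (u ∷ us) p k l =
  (λ e → f (suc-injective e)) , λ e → Sum.map (cong suc) (cong suc) (g e)

path-injective : ∀ {n} (G : Graph n) {b} us → IndPath G b us → Injective _≡_ _≡_ (lookup us)
path-injective G (v ∷ us) p {F.zero} {F.zero} e = refl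
path-injective G (v ∷ u ∷ us) (link _ _ ne aw p) {F.zero} {F.suc F.zero} e = ⊥-elim (ne e)
path-injective G (v ∷ u ∷ us) (link _ _ ne aw p) {F.zero} {F.suc (F.suc l)} e = ⊥-elim (proj₂ (all-at aw l) e)
path-injective G (v ∷ u ∷ us) (link _ _ ne aw p) {F.suc F.zero} {F.zero} e = ⊥-elim (ne (≡-sym e))
path-injective G (v ∷ u ∷ us) (link _ _ ne aw p) {F.suc (F.suc k)} {F.zero} e = ⊥-elim (proj₂ (all-at aw k) (≡-sym e))
path-injective G (v ∷ u ∷ us) (link _ _ _ _ p) {F.suc k} {F.suc l} e = cong F.suc (path-injective G (u ∷ us) p e)

-- The interface from which the subdivision is read off. The sets `P i j` are merely connected and
-- without contact to each other; they may contain many vertices besides the induced path that is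
-- picked out of them later.
record Linkage {n : ℕ} (G : Graph n) (r t : ℕ) : Set₁ where
  field
    W : Fin r ⊎ Fin t → Fin n
    P : Fin r → Fin t → Fin n → Set
    W-injective : Injective _≡_ _≡_ W
    W-indep : ∀ x y → adj G (W x) (W y) ≡ false
    P-not-W : ∀ {i j v} x → P i j v → W x ≢ v
    P-W : ∀ {i j v} x → P i j v → Edge G (W x) v → x ≡ inj₁ i ⊎ x ≡ inj₂ j
    P-P : ∀ {i j i′ j′ v v′} → P i j v → P i′ j′ v′ → v ≡ v′ ⊎ Edge G v v′ → i ≡ i′ × j ≡ j′
    connected : ∀ i j → Σ (Fin n) λ u → Σ (Fin n) λ v → Edge G (W (inj₁ i)) u × Reach G (P i j) u v × Edge G v (W (inj₂ j))

module _ {n r t : ℕ} (G : Graph n) (K : Linkage G r t) where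
  open Linkage K

  private
    record Thread (i : Fin r) (j : Fin t) : Set where
      field
        hd : Fin n
        tl : List (Fin n)
        path : IndPath G (W (inj₂ j)) (hd ∷ tl)
        edge : Edge G (W (inj₁ i)) hd
        away : All (Away G (W (inj₁ i))) tl
        inP : All (P i j) (hd ∷ tl)
    open Thread

    thread : ∀ i j → Thread i j
    thread i j
      with u , v , e , reach , e′ ← connected i j
      with q , path , q∈ ← reach⇒path G (P i j) (W (inj₂ j)) reach e′
      -- Taking the left end as one more vertex of the walk makes it adjacent to the first path
      -- vertex alone. The predicate is enlarged to admit it, and `drop` removes it again.
      with prepend G (λ x → P i j x ⊎ W (inj₁ i) ≡ x) (W (inj₂ j)) (W (inj₁ i)) u q (inj₂ refl) (inj₁ (reach-∈ reach) ∷ All.map inj₁ q∈) e path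
    ... | [] , end e″ , _ = ⊥-elim (true≢false e″ (W-indep (inj₁ i) (inj₂ j)))
    ... | hd ∷ tl , link e″ _ ne away path′ , hd∈ ∷ tl∈ = record
      { hd = hd ; tl = tl ; path = path′ ; edge = e″ ; away = away
      ; inP = drop ne hd∈ ∷ All.zipWith (λ { ((_ , ne) , p) → drop ne p }) (away , tl∈) }
      where
      drop : ∀ {x} → W (inj₁ i) ≢ x → P i j x ⊎ W (inj₁ i) ≡ x → P i j x
      drop ne (inj₁ p) = p
      drop ne (inj₂ p) = ⊥-elim (ne p)

    verts : Fin r → Fin t → List (Fin n)
    verts i j = hd (thread i j) ∷ tl (thread i j)

    ℓ : Fin r → Fin t → ℕ
    ℓ i j = length (verts i j)

  open Subdivision r t ℓ

  private
    φ : SV → Fin n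
    φ (left i) = W (inj₁ i)
    φ (right j) = W (inj₂ j)
    φ (mid i j k) = lookup (verts i j) k

    φ∈P : ∀ i j k → P i j (φ (mid i j k))
    φ∈P i j k = all-at (inP (thread i j)) k

    inj₁-inj : ∀ {x y : Fin r} → inj₁ {B = Fin t} x ≡ inj₁ y → x ≡ y
    inj₁-inj refl = refl

    inj₂-inj : ∀ {x y : Fin t} → inj₂ {A = Fin r} x ≡ inj₂ y → x ≡ y
    inj₂-inj refl = refl

    φ-injective : Injective _≡_ _≡_ φ
    φ-injective {left i} {left i′} p = cong left (inj₁-inj (W-injective p))
    φ-injective {left i} {right j} p with () ← W-injective p
    φ-injective {left i} {mid i′ j k} p = ⊥-elim (P-not-W (inj₁ i) (φ∈P i′ j k) p)
    φ-injective {right j} {left i} p with () ← W-injective p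
    φ-injective {right j} {right j′} p = cong right (inj₂-inj (W-injective p))
    φ-injective {right j} {mid i′ j′ k} p = ⊥-elim (P-not-W (inj₂ j) (φ∈P i′ j′ k) p)
    φ-injective {mid i j k} {left i′} p = ⊥-elim (P-not-W (inj₁ i′) (φ∈P i j k) (≡-sym p))
    φ-injective {mid i j k} {right j′} p = ⊥-elim (P-not-W (inj₂ j′) (φ∈P i j k) (≡-sym p))
    φ-injective {mid i j k} {mid i′ j′ k′} p with refl , refl ← P-P (φ∈P i j k) (φ∈P i′ j′ k′) (inj₁ p) =
      cong (mid i j) (path-injective G (verts i j) (path (thread i j)) p)

    left-mid : ∀ i i′ j k → Edge G (W (inj₁ i)) (φ (mid i′ j k)) → SAdj (left i) (mid i′ j k)
    left-mid i i′ j k e with P-W (inj₁ i) (φ∈P i′ j k) e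
    left-mid i i′ j F.zero e | inj₁ refl = inj₁ (first i j F.zero refl)
    left-mid i i′ j (F.suc k) e | inj₁ refl = ⊥-elim (true≢false e (proj₁ (all-at (away (thread i j)) k)))

    right-mid : ∀ j i j′ k → Edge G (φ (mid i j′ k)) (W (inj₂ j)) → SAdj (mid i j′ k) (right j)
    right-mid j i j′ k e with P-W (inj₂ j) (φ∈P i j′ k) (trans (Graph.sym G _ _) e)
    ... | inj₂ refl = inj₁ (last i j k (proj₂ (path-ends G (verts i j) (path (thread i j)) k) e))

    step-edge : ∀ {u v} → Step u v → Edge G (φ u) (φ v)
    step-edge (first i j F.zero _) = edge (thread i j)
    step-edge (inner i j k k′ e) = proj₁ (path-inner G (verts i j) (path (thread i j)) k k′) e
    step-edge (last i j k e) = proj₁ (path-ends G (verts i j) (path (thread i j)) k) e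

    edge-step : ∀ u v → Edge G (φ u) (φ v) → SAdj u v
    edge-step (left i) (left i′) e = ⊥-elim (true≢false e (W-indep _ _))
    edge-step (left i) (right j) e = ⊥-elim (true≢false e (W-indep _ _))
    edge-step (left i) (mid i′ j k) e = left-mid i i′ j k e
    edge-step (right j) (left i) e = ⊥-elim (true≢false e (W-indep _ _))
    edge-step (right j) (right j′) e = ⊥-elim (true≢false e (W-indep _ _))
    edge-step (right j) (mid i j′ k) e = Sum.swap (right-mid j i j′ k (trans (Graph.sym G _ _) e))
    edge-step (mid i j k) (left i′) e = Sum.swap (left-mid i′ i j k (trans (Graph.sym G _ _) e))
    edge-step (mid i j k) (right j′) e = right-mid j′ i j k e
    edge-step (mid i j k) (mid i′ j′ k′) e with refl , refl ← P-P (φ∈P i j k) (φ∈P i′ j′ k′) (inj₂ e) =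
      Sum.map (inner i j k k′) (inner i j k′ k) (proj₂ (path-inner G (verts i j) (path (thread i j)) k k′) e)

  linkage⇒subdivision : ContainsInducedSubdivK r t G
  linkage⇒subdivision = ℓ , φ , φ-injective ,
    (λ { u v (inj₁ s) → step-edge s ; u v (inj₂ s) → trans (Graph.sym G (φ u) (φ v)) (step-edge s) }) , edge-step

module _ {n : ℕ} (G : Graph n) (w r t : ℕ) (noClique : ¬ HasClique G (suc w)) (noSub : ¬ ContainsInducedSubdivK r t G) where
  private
    a = 4 * suc w
    A = a ^ tupleExp r
  open ≤-Reasoning

  -- Every `y` sees at least `s ^ r / A` independent `r`-tuples in `X`, and there are at most
  -- `κ ^ r` tuples in all, so some tuple has `a ^ t` common neighbours in `Y`. These contain an
  -- independent `t`-set, which completes an induced biclique.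
  induced-kst : ∀ (X Y : Sub n) s κ → a ^ r ≤ s → 1 ≤ κ → ∣ X ∣ ≤ κ →
    (∀ y → Y y ≡ true → s ≤ ∣ X ∩ nb G y ∣) → a ^ tupleExp r * (κ ^ r * a ^ t) ≤ ∣ Y ∣ * s ^ r → ⊥
  induced-kst X Y s κ as κ≥1 X≤ nbs h
    with T , Y′ , c≤ , com ← popular-tuple G r X Y {κ} {a ^ t} (m^n>0 a t) κ≥1 X≤
           (*-cancelˡ-≤ A ⦃ >-nonZero (m^n>0 a (tupleExp r)) ⦄ (begin
             A * (κ ^ r * a ^ t) ≤⟨ h ⟩
             ∣ Y ∣ * s ^ r ≤⟨ ∑-sub-≥ Y (s ^ r) (λ y y∈ → ≤-trans (^-monoˡ-≤ r (nbs y y∈))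
               (indTuples-lower G w noClique r (X ∩ nb G y) (≤-trans as (nbs y y∈)))) ⟩
             (∑[ y ] ⟦ Y y ⟧ * (A * indTuples G r (X ∩ nb G y))) ≡⟨ sum-cong-≗ (λ y → x∙yz≈y∙xz ⟦ Y y ⟧ A _) ⟩
             (∑[ y ] A * (⟦ Y y ⟧ * indTuples G r (X ∩ nb G y))) ≡⟨ ∑-*ˡ A _ ⟨
             A * stars G r X Y ∎))
    = noSub (biclique⇒subdivision G {X} {Y′} T U λ i j → proj₂ (com (proj₁ U j) (proj₂ (proj₂ (proj₂ U)) j)) i)
    where
    U = indSet-exists G w noClique t Y′ c≤

-- Degree sums and Mader's contraction argument

-- Twice the number of edges inside `S`; comparing densities through it avoids halving.
degSum : ∀ {n} → Graph n → Sub n → ℕ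
degSum G S = ∑[ u ] ⟦ S u ⟧ * deg G S u

deg-∑ : ∀ {n} (G : Graph n) (S : Sub n) u → deg G S u ≡ (∑[ v ] ⟦ S v ⟧ * ⟦ adj G u v ⟧)
deg-∑ G S u = sum-cong-≗ (⟦∩⟧ S (nb G u))

deg-split : ∀ {n} (G : Graph n) (S : Sub n) {v} → S v ≡ true → ∀ u → deg G S u ≡ ⟦ adj G u v ⟧ + deg G (S ∖ v) u
deg-split G S p u = trans (deg-∑ G S u) (trans (∑-split S (λ x → ⟦ adj G u x ⟧) p)
  (cong (⟦ adj G u _ ⟧ +_) (≡-sym (deg-∑ G (S ∖ _) u))))

deg-self : ∀ {n} (G : Graph n) (S : Sub n) {v} → S v ≡ true → deg G S v ≡ deg G (S ∖ v) v
deg-self G S {v} p = trans (deg-split G S p v) (cong (λ b → ⟦ b ⟧ + deg G (S ∖ v) v) (irrefl G v))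

degSum-∖ : ∀ {n} (G : Graph n) (S : Sub n) {v} → S v ≡ true → degSum G S ≡ degSum G (S ∖ v) + 2 * deg G S v
degSum-∖ G S {v} p = begin
  degSum G S ≡⟨ ∑-split S (deg G S) p ⟩
  d + (∑[ u ] ⟦ S′ u ⟧ * deg G S u) ≡⟨ cong (d +_) (sum-cong-≗ λ u → trans (cong (⟦ S′ u ⟧ *_) (deg-split G S p u)) (*-distribˡ-+ ⟦ S′ u ⟧ _ _)) ⟩
  d + (∑[ u ] ⟦ S′ u ⟧ * ⟦ adj G u v ⟧ + ⟦ S′ u ⟧ * deg G S′ u) ≡⟨ cong (d +_) (∑-distrib-+ _ _) ⟩
  d + ((∑[ u ] ⟦ S′ u ⟧ * ⟦ adj G u v ⟧) + degSum G S′) ≡⟨ cong (λ z → d + (z + degSum G S′)) back ⟩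
  d + (d + degSum G S′) ≡⟨ lem d (degSum G S′) ⟩
  degSum G S′ + 2 * d ∎
  where
  open ≡-Reasoning
  S′ = S ∖ v
  d = deg G S v
  lem : ∀ x y → x + (x + y) ≡ y + 2 * x
  lem = solve-∀
  back : (∑[ u ] ⟦ S′ u ⟧ * ⟦ adj G u v ⟧) ≡ d
  back = trans (sum-cong-≗ λ u → cong (λ b → ⟦ S′ u ⟧ * ⟦ b ⟧) (Graph.sym G u v))
    (trans (≡-sym (deg-∑ G S′ v)) (≡-sym (deg-self G S p)))

deg-mono : ∀ {n} (G : Graph n) {S T : Sub n} → (∀ {v} → S v ≡ true → T v ≡ true) → ∀ v → deg G S v ≤ deg G T v
deg-mono G {S} h v = card-mono {S = S ∩ nb G v} λ {u} p → ∧-intro (h (∧-elimˡ p)) (∧-elimʳ {S u} p)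

deg≤card : ∀ {n} (G : Graph n) (S : Sub n) v → deg G S v ≤ ∣ S ∣
deg≤card G S v = card-mono {S = S ∩ nb G v} {T = S} ∧-elimˡ

-- A model of `K_{m,h}` as a minor in which the vertices on the side of `W` are not contracted.
record Web {n : ℕ} (F : Graph n) (S : Sub n) (m h : ℕ) : Set where
  field
    U : Fin m → Sub n
    W : Sub n
    W-large : h ≤ ∣ W ∣
    U⊆S : ∀ {i u} → U i u ≡ true → S u ≡ true
    W⊆S : ∀ {u} → W u ≡ true → S u ≡ true
    U-connected : ∀ i {u v} → U i u ≡ true → U i v ≡ true → Reach F (λ x → U i x ≡ true) u v
    U-dominates : ∀ i w → W w ≡ true → ∃ λ u → U i u ≡ true × Edge F u w
    U-disjoint : ∀ {i j u} → U i u ≡ true → U j u ≡ true → i ≡ j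
    UW-disjoint : ∀ {i u} → U i u ≡ true → W u ≡ true → ⊥

web-⊆ : ∀ {n} {F : Graph n} {S T : Sub n} {m h} → (∀ {u} → S u ≡ true → T u ≡ true) → Web F S m h → Web F T m h
web-⊆ S⊆T w = record
  { U = U ; W = W ; W-large = W-large ; U⊆S = λ {i} p → S⊆T (U⊆S {i} p) ; W⊆S = λ p → S⊆T (W⊆S p)
  ; U-connected = U-connected ; U-dominates = U-dominates
  ; U-disjoint = U-disjoint ; UW-disjoint = λ {i} → UW-disjoint {i} }
  where open Web w

module Mader {n : ℕ} (F : Graph n) (h : ℕ) (h≥1 : 1 ≤ h) where
  private
    dominated? : ∀ (U : Sub n) v → Dec (∃ λ u → U u ≡ true × Edge F u v)
    dominated? U v = FP.any? λ u → (U u B.≟ true) ×-dec (adj F u v B.≟ true)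

    -- The neighbours in `R` of the vertex to which `U` is contracted.
    bdry : Sub n → Sub n → Sub n
    bdry U R v = R v ∧ ⌊ dominated? U v ⌋

    _∪₁_ : Sub n → Fin n → Sub n
    (U ∪₁ v) u = U u ∨ eq v u

    ∪₁-cases : ∀ U {v} u → (U ∪₁ v) u ≡ true → U u ≡ true ⊎ v ≡ u
    ∪₁-cases U u p with U u
    ... | true = inj₁ refl
    ... | false = inj₂ (eq⇒≡ p)

    ∪₁-old : ∀ U {v u} → U u ≡ true → (U ∪₁ v) u ≡ true
    ∪₁-old U p rewrite p = refl

    ∪₁-new : ∀ U v → (U ∪₁ v) v ≡ true
    ∪₁-new U v with U v
    ... | true = refl
    ... | false = eq-refl v

    Connected : Sub n → Set
    Connected U = ∀ {u v} → U u ≡ true → U v ≡ true → Reach F (λ x → U x ≡ true) u v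

    -- Inclusion-exclusion: apart from `v`, the new boundary is the union of the old one and of the
    -- neighbours of `v` in `R`. For a boundary vertex `v`, the loss `1 + deg F (bdry U R) v` is the
    -- number of edges that disappear when `v` is contracted into `U`.
    bdry-grow : ∀ U R v → R v ≡ true →
      ∣ bdry U R ∣ + deg F R v ≤ ∣ bdry (U ∪₁ v) (R ∖ v) ∣ + 1 + deg F (bdry U R) v
    bdry-grow U R v v∈ = begin
      ∣ bdry U R ∣ + deg F R v ≡⟨ ∑-distrib-+ _ _ ⟨
      (∑[ x ] ⟦ bdry U R x ⟧ + ⟦ R x ∧ adj F v x ⟧) ≤⟨ ∑-mono pt ⟩
      (∑[ x ] (⟦ bdry U′ R′ x ⟧ + ⟦ eq v x ⟧ * 1) + ⟦ bdry U R x ∧ adj F v x ⟧) ≡⟨ ∑-distrib-+ _ _ ⟩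
      (∑[ x ] ⟦ bdry U′ R′ x ⟧ + ⟦ eq v x ⟧ * 1) + deg F (bdry U R) v
        ≡⟨ cong (_+ deg F (bdry U R) v) (trans (∑-distrib-+ _ _) (cong (∣ bdry U′ R′ ∣ +_) (∑-eq v (λ _ → 1)))) ⟩
      ∣ bdry U′ R′ ∣ + 1 + deg F (bdry U R) v ∎
      where
      open ≤-Reasoning
      U′ = U ∪₁ v
      R′ = R ∖ v
      pt : ∀ x → ⟦ bdry U R x ⟧ + ⟦ R x ∧ adj F v x ⟧ ≤ (⟦ bdry U′ R′ x ⟧ + ⟦ eq v x ⟧ * 1) + ⟦ bdry U R x ∧ adj F v x ⟧
      pt x with v FP.≟ x
      pt x | yes refl rewrite irrefl F v | ∧-comm (R v) false | ∧-comm (bdry U R v) false =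
        ≤-trans (≤-reflexive (+-identityʳ _)) (⟦⟧≤1 (bdry U R v))
      pt x | no v≢x with dominated? U′ x | dominated? U x | R x | true-or-false (adj F v x)
      ... | _ | yes _ | false | _ = z≤n
      ... | _ | no _ | false | _ = z≤n
      ... | yes _ | yes _ | true | inj₁ e rewrite e = ≤-refl
      ... | yes _ | yes _ | true | inj₂ e rewrite e = ≤-refl
      ... | yes _ | no _ | true | inj₁ e rewrite e = ≤-refl
      ... | yes _ | no _ | true | inj₂ e rewrite e = z≤n
      ... | no ¬d | yes (u , u∈ , ue) | true | _ = ⊥-elim (¬d (u , ∪₁-old U u∈ , ue))
      ... | no ¬d | no _ | true | inj₁ e = ⊥-elim (¬d (v , ∪₁-new U v , e))
      ... | no ¬d | no _ | true | inj₂ e rewrite e = z≤n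

    degSum-empty : ∀ S → ∣ S ∣ ≡ 0 → degSum F S ≡ 0
    degSum-empty S e = n≤0⇒n≡0 (≤-trans (∑-sub-≤ S n (λ v _ → card-≤n _)) (≤-reflexive (cong (_* n) e)))

    -- The threshold doubles because average degree `2 * cost (suc m)` yields a boundary graph of
    -- minimum degree only `cost (suc m)`, and the recursion asks there for average degree
    -- `2 * cost m`.
    cost : ℕ → ℕ
    cost m = 2 ^ m * h

    cost≥1 : ∀ m → 1 ≤ cost m
    cost≥1 m = *-mono-≤ (m^n>0 2 m) h≥1

  private module Step (m : ℕ) (rec : ∀ N → 1 ≤ ∣ N ∣ → 2 * cost m * ∣ N ∣ ≤ degSum F N → Web F N m h) where
    mutual
      contract : ∀ f (S : Sub n) → ∣ S ∣ ≤ f → 1 ≤ ∣ S ∣ → 2 * cost (suc m) * ∣ S ∣ ≤ degSum F S → Web F S (suc m) h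
      contract zero S S≤ S≥1 dense = ⊥-elim (<⇒≱ S≥1 S≤)
      contract (suc f) S S≤ S≥1 dense with v , v∈ ← card-pos⇒∃ S S≥1 =
        grow f S (eq v) (S ∖ v)
          (λ { p → subst (λ x → S x ≡ true) (eq⇒≡ p) v∈ }) (∖-⊆ S) (λ p q → ∖-≢ S q (eq⇒≡ p))
          conn (s≤s⁻¹ (≤-trans (≤-reflexive (≡-sym (card-∖ S v∈))) S≤)) base
        where
        open ≤-Reasoning
        conn : Connected (eq v)
        conn {x} p q with refl ← eq⇒≡ {u = v} p with refl ← eq⇒≡ {u = v} q = here p
        Λ = cost (suc m)
        bd : deg F S v ≤ ∣ bdry (eq v) (S ∖ v) ∣
        bd = ≤-trans (≤-reflexive (deg-self F S v∈)) (card-mono {S = (S ∖ v) ∩ nb F v} λ {x} p →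
          ∧-intro (∧-elimˡ p) (⌊⌋-intro (dominated? (eq v) x) (v , eq-refl v , ∧-elimʳ {(S ∖ v) x} p)))
        base : 2 * Λ * suc ∣ S ∖ v ∣ ≤ degSum F (S ∖ v) + 2 * ∣ bdry (eq v) (S ∖ v) ∣
        base = begin
          2 * Λ * suc ∣ S ∖ v ∣ ≡⟨ cong (2 * Λ *_) (card-∖ S v∈) ⟨
          2 * Λ * ∣ S ∣ ≤⟨ dense ⟩
          degSum F S ≡⟨ degSum-∖ F S v∈ ⟩
          degSum F (S ∖ v) + 2 * deg F S v ≤⟨ +-monoʳ-≤ (degSum F (S ∖ v)) (*-monoʳ-≤ 2 bd) ⟩
          degSum F (S ∖ v) + 2 * ∣ bdry (eq v) (S ∖ v) ∣ ∎

      -- R is the part of S outside the contracted set U; the hypothesis bounds the density of S / U.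
      grow : ∀ f (S U R : Sub n) → (∀ {u} → U u ≡ true → S u ≡ true) → (∀ {u} → R u ≡ true → S u ≡ true) →
        (∀ {u} → U u ≡ true → R u ≡ true → ⊥) → Connected U → ∣ R ∣ ≤ f →
        2 * cost (suc m) * suc ∣ R ∣ ≤ degSum F R + 2 * ∣ bdry U R ∣ → Web F S (suc m) h
      grow f S U R U⊆ R⊆ disj conn R≤ dense
        -- Absorbing such a vertex removes one vertex and at most `cost (suc m)` edges from the
        -- contracted graph, so the density hypothesis survives.
        with FP.any? (λ v → (bdry U R v B.≟ true) ×-dec (suc (deg F (bdry U R) v) ≤? cost (suc m)))
      grow zero S U R U⊆ R⊆ disj conn R≤ dense | yes (v , v∈ , small) =
        ⊥-elim (<⇒≱ (∃⇒card-pos R {v} (∧-elimˡ v∈)) R≤)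
      grow (suc f) S U R U⊆ R⊆ disj conn R≤ dense | yes (v , v∈ , small) =
        grow f S (U ∪₁ v) (R ∖ v)
          (λ {u} p → Sum.[ U⊆ , (λ { refl → R⊆ vR }) ] (∪₁-cases U u p)) (λ p → R⊆ (∖-⊆ R p))
          (λ {u} p q → Sum.[ (λ p′ → disj p′ (∖-⊆ R q)) , ∖-≢ R q ] (∪₁-cases U u p))
          conn′ (s≤s⁻¹ (≤-trans (≤-reflexive (≡-sym (card-∖ R vR))) R≤)) dense′
        where
        open ≤-Reasoning
        vR = ∧-elimˡ {R v} v∈
        Λ = cost (suc m)
        dom = ⌊⌋-elim (dominated? U v) (∧-elimʳ {R v} v∈)
        old : ∀ {x y} → U x ≡ true → U y ≡ true → Reach F (λ z → (U ∪₁ v) z ≡ true) x y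
        old p q = reach-map (∪₁-old U) (conn p q)
        fromv : ∀ {y} → U y ≡ true → Reach F (λ z → (U ∪₁ v) z ≡ true) v y
        fromv q = step (∪₁-new U v) (trans (Graph.sym F v _) (proj₂ (proj₂ dom))) (old (proj₁ (proj₂ dom)) q)
        conn′ : Connected (U ∪₁ v)
        conn′ {x} {y} p q with ∪₁-cases U x p | ∪₁-cases U y q
        ... | inj₁ p′ | inj₁ q′ = old p′ q′
        ... | inj₁ p′ | inj₂ refl = reach-sym (fromv p′)
        ... | inj₂ refl | inj₁ q′ = fromv q′
        ... | inj₂ refl | inj₂ refl = here p
        dense′ : 2 * Λ * suc ∣ R ∖ v ∣ ≤ degSum F (R ∖ v) + 2 * ∣ bdry (U ∪₁ v) (R ∖ v) ∣
        dense′ = +-cancelʳ-≤ (2 * deg F R v + 2 * Λ) _ _ (begin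
          2 * Λ * suc ∣ R ∖ v ∣ + (2 * deg F R v + 2 * Λ) ≡⟨ lem₁ (2 * Λ) ∣ R ∖ v ∣ (2 * deg F R v) ⟩
          2 * Λ * suc (suc ∣ R ∖ v ∣) + 2 * deg F R v ≡⟨ cong (λ z → 2 * Λ * suc z + 2 * deg F R v) (card-∖ R vR) ⟨
          2 * Λ * suc ∣ R ∣ + 2 * deg F R v ≤⟨ +-monoˡ-≤ (2 * deg F R v) dense ⟩
          (degSum F R + 2 * ∣ bdry U R ∣) + 2 * deg F R v ≡⟨ lem₂ (degSum F R) ∣ bdry U R ∣ (deg F R v) ⟩
          degSum F R + 2 * (∣ bdry U R ∣ + deg F R v) ≤⟨ +-mono-≤ (≤-reflexive (degSum-∖ F R vR)) (*-monoʳ-≤ 2 (bdry-grow U R v vR)) ⟩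
          (degSum F (R ∖ v) + 2 * deg F R v) + 2 * (B′ + 1 + deg F (bdry U R) v) ≡⟨ lem₃ (degSum F (R ∖ v)) (2 * deg F R v) B′ (deg F (bdry U R) v) ⟩
          degSum F (R ∖ v) + 2 * B′ + (2 * deg F R v + 2 * suc (deg F (bdry U R) v)) ≤⟨ +-monoʳ-≤ (degSum F (R ∖ v) + 2 * B′) (+-monoʳ-≤ (2 * deg F R v) (*-monoʳ-≤ 2 small)) ⟩
          degSum F (R ∖ v) + 2 * B′ + (2 * deg F R v + 2 * Λ) ∎)
          where
          B′ = ∣ bdry (U ∪₁ v) (R ∖ v) ∣
          lem₁ : ∀ x y z → x * suc y + (z + x) ≡ x * suc (suc y) + z
          lem₁ = solve-∀
          lem₂ : ∀ x y z → (x + 2 * y) + 2 * z ≡ x + 2 * (y + z)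
          lem₂ = solve-∀
          lem₃ : ∀ x y z t → (x + y) + 2 * (z + 1 + t) ≡ x + 2 * z + (y + 2 * suc t)
          lem₃ = solve-∀
      grow f S U R U⊆ R⊆ disj conn R≤ dense | no ¬small with 1 ≤? ∣ bdry U R ∣
      -- No edge joins `U` to `R`, so `R` alone carries the density and the contraction restarts
      -- inside it.
      ... | no empty = web-⊆ R⊆ (contract f R R≤ R≥1 (≤-trans (*-monoʳ-≤ (2 * Λ) (n≤1+n _)) dense₀))
        where
        Λ = cost (suc m)
        dense₀ : 2 * Λ * suc ∣ R ∣ ≤ degSum F R
        dense₀ = subst (2 * Λ * suc ∣ R ∣ ≤_)
          (trans (cong (λ z → degSum F R + 2 * z) (n<1⇒n≡0 (≰⇒> empty))) (+-identityʳ _)) dense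
        R≥1 : 1 ≤ ∣ R ∣
        R≥1 = n≢0⇒n>0 λ e → <⇒≱ (*-mono-≤ (*-mono-≤ {1} {2} (s≤s z≤n) (cost≥1 (suc m))) (s≤s (z≤n {∣ R ∣})))
          (≤-trans dense₀ (≤-reflexive (degSum-empty R e)))
      -- Now the boundary has minimum degree at least `cost (suc m)`. A web inside it is dominated
      -- by `U`, which joins as one more connected set.
      ... | yes nonempty = record
        { U = cons U (Web.U w) ; W = Web.W w ; W-large = Web.W-large w
        ; U⊆S = λ { {F.zero} p → U⊆ p ; {F.suc i} p → R⊆ (∧-elimˡ (Web.U⊆S w {i} p)) }
        ; W⊆S = λ p → R⊆ (∧-elimˡ (Web.W⊆S w p))
        ; U-connected = λ { F.zero → conn ; (F.suc i) → Web.U-connected w i }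
        ; U-dominates = λ { F.zero x x∈ → ⌊⌋-elim (dominated? U x) (∧-elimʳ {R x} (Web.W⊆S w x∈)) ; (F.suc i) → Web.U-dominates w i }
        ; U-disjoint = λ { {F.zero} {F.zero} _ _ → refl
                         ; {F.zero} {F.suc j} p q → ⊥-elim (disj p (∧-elimˡ (Web.U⊆S w {j} q)))
                         ; {F.suc i} {F.zero} p q → ⊥-elim (disj q (∧-elimˡ (Web.U⊆S w {i} p)))
                         ; {F.suc i} {F.suc j} p q → cong F.suc (Web.U-disjoint w p q) }
        ; UW-disjoint = λ { {F.zero} p q → disj p (∧-elimˡ (Web.W⊆S w q)) ; {F.suc i} p q → Web.UW-disjoint w {i} p q } }
        where
        N = bdry U R
        dense″ : 2 * cost m * ∣ N ∣ ≤ degSum F N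
        dense″ = ≤-trans (≤-reflexive (trans (*-comm (2 * cost m) ∣ N ∣) (cong (∣ N ∣ *_) (≡-sym (*-assoc 2 (2 ^ m) h)))))
          (∑-sub-≥ N (cost (suc m)) λ v v∈ → ≮⇒≥ λ q → ¬small (v , v∈ , q))
        w = rec N nonempty dense″

  web : ∀ m (S : Sub n) → 1 ≤ ∣ S ∣ → 2 * cost m * ∣ S ∣ ≤ degSum F S → Web F S m h
  web zero S S≥1 dense = record
    { U = λ () ; W = S ; W-large = large ; U⊆S = λ { {()} } ; W⊆S = λ p → p ; U-connected = λ ()
    ; U-dominates = λ () ; U-disjoint = λ { {()} } ; UW-disjoint = λ { {()} } }
    where
    open ≤-Reasoning
    large : h ≤ ∣ S ∣
    large = *-cancelʳ-≤ h ∣ S ∣ ∣ S ∣ ⦃ >-nonZero S≥1 ⦄ (begin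
      h * ∣ S ∣ ≤⟨ *-monoˡ-≤ ∣ S ∣ (≤-trans (m≤m+n h h) (≤-reflexive (lem h))) ⟩
      2 * cost 0 * ∣ S ∣ ≤⟨ dense ⟩
      degSum F S ≤⟨ ∑-sub-≤ S ∣ S ∣ (λ v _ → deg≤card F S v) ⟩
      ∣ S ∣ * ∣ S ∣ ∎)
      where
      lem : ∀ h → h + h ≡ 2 * (1 * h)
      lem = solve-∀
  web (suc m) S = Step.contract m (web m) n S (card-≤n S)

-- An induced subdivision of F in G: the edge x x′ of F is represented by the connector set conn x x′.
record Frame {n : ℕ} (G F : Graph n) : Set₁ where
  field
    conn : Fin n → Fin n → Fin n → Set
    indep : ∀ {x x′ u u′} → Edge F x x′ → Edge F u u′ → adj G x u ≡ false
    conn-sym : ∀ {x x′ y} → conn x x′ y → conn x′ x y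
    conn-avoids : ∀ {x x′ y u u′} → conn x x′ y → Edge F u u′ → u ≢ y
    conn-touches : ∀ {x x′ y u u′} → conn x x′ y → Edge F u u′ → Edge G u y → u ≡ x ⊎ u ≡ x′
    conn-separate : ∀ {x x′ y u u′ v} → conn x x′ y → conn u u′ v → y ≡ v ⊎ Edge G y v → u ≡ x ⊎ u ≡ x′
    linked : ∀ {x x′} → Edge F x x′ → Σ (Fin n) λ y → Σ (Fin n) λ y′ → Edge G x y × Reach G (conn x x′) y y′ × Edge G y′ x′

module _ {n r t : ℕ} (G F : Graph n) (r≥1 : 1 ≤ r) (t≥1 : 1 ≤ t) (Φ : Frame G F) (web : Web F full (r * t) (r + t)) where
  open Frame Φ
  private
    module Wb = Web web

    picked = pick (r + t) Wb.W Wb.W-large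

    W : Fin r ⊎ Fin t → Fin n
    W x = proj₁ picked (F.join r t x)

    W∈ : ∀ x → Wb.W (W x) ≡ true
    W∈ x = proj₂ (proj₂ picked) (F.join r t x)

    W-inj : Injective _≡_ _≡_ W
    W-inj {x} {y} e = trans (≡-sym (FP.splitAt-join r t x))
      (trans (cong (F.splitAt r) (proj₁ (proj₂ picked) e)) (FP.splitAt-join r t y))

    U : Fin r → Fin t → Fin n → Set
    U i j u = Wb.U (combine i j) u ≡ true

    UW : ∀ {i j u} x → U i j u → u ≢ W x
    UW {i} {j} x u∈ refl = Wb.UW-disjoint {combine i j} u∈ (W∈ x)

    fin₀ : ∀ {k} → 1 ≤ k → Fin k
    fin₀ (s≤s _) = F.zero

    dominator : ∀ i j x → Σ (Fin n) λ u → U i j u × Edge F u (W x)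
    dominator i j x = Wb.U-dominates (combine i j) (W x) (W∈ x)

    flip-edge : ∀ (H : Graph n) {u v} → Edge H u v → Edge H v u
    flip-edge H {u} {v} e = trans (Graph.sym H v u) e

    -- A frame speaks only of vertices that have an edge in `F`, so the vertices of the web must be
    -- shown to be non-isolated before its clauses apply.
    W-edge : ∀ x → ∃ λ u → Edge F (W x) u
    W-edge x with u , _ , e ← dominator (fin₀ r≥1) (fin₀ t≥1) x = u , flip-edge F e

    U-edge : ∀ {i j u} → U i j u → ∃ λ v → Edge F u v
    U-edge {i} {j} u∈ with u₀ , u₀∈ , e ← dominator i j (inj₁ i) with Wb.U-connected (combine i j) u∈ u₀∈
    ... | here _ = _ , e
    ... | step _ e′ _ = _ , e′

    -- The set `U i j` dominates all of `W`, but only the connectors to the two ends `i` and `j` are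
    -- taken in; this keeps `P i j` away from the other vertices of `W`.
    data P (i : Fin r) (j : Fin t) (v : Fin n) : Set where
      in-U : U i j v → P i j v
      in-conn : ∀ {u u′} → U i j u → U i j u′ ⊎ u′ ≡ W (inj₁ i) ⊎ u′ ≡ W (inj₂ j) → conn u u′ v → P i j v

    U-U : ∀ {i j i′ j′ u} → U i j u → U i′ j′ u → i ≡ i′ × j ≡ j′
    U-U {i} {j} {i′} {j′} p q = FP.combine-injective i j i′ j′ (Wb.U-disjoint p q)

    U-end : ∀ {i j i′ j′ u x x′} → U i j u → U i′ j′ x → U i′ j′ x′ ⊎ x′ ≡ W (inj₁ i′) ⊎ x′ ≡ W (inj₂ j′) →
      u ≡ x ⊎ u ≡ x′ → i ≡ i′ × j ≡ j′
    U-end u∈ x∈ x′∈ (inj₁ refl) = U-U u∈ x∈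
    U-end u∈ x∈ (inj₁ x′∈) (inj₂ refl) = U-U u∈ x′∈
    U-end {i′ = i′} u∈ x∈ (inj₂ (inj₁ e)) (inj₂ refl) = ⊥-elim (UW (inj₁ i′) u∈ e)
    U-end {j′ = j′} u∈ x∈ (inj₂ (inj₂ e)) (inj₂ refl) = ⊥-elim (UW (inj₂ j′) u∈ e)

    P-P : ∀ {i j i′ j′ v v′} → P i j v → P i′ j′ v′ → v ≡ v′ ⊎ Edge G v v′ → i ≡ i′ × j ≡ j′
    P-P (in-U p) (in-U q) (inj₁ refl) = U-U p q
    P-P (in-U p) (in-U q) (inj₂ e) = ⊥-elim (true≢false e (indep (proj₂ (U-edge p)) (proj₂ (U-edge q))))
    P-P (in-U p) (in-conn q q′ c) (inj₁ e) = ⊥-elim (conn-avoids c (proj₂ (U-edge p)) e)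
    P-P (in-U p) (in-conn q q′ c) (inj₂ e) = U-end p q q′ (conn-touches c (proj₂ (U-edge p)) e)
    P-P (in-conn p p′ c) (in-U q) (inj₁ e) = ⊥-elim (conn-avoids c (proj₂ (U-edge q)) (≡-sym e))
    P-P (in-conn p p′ c) (in-U q) (inj₂ e) with refl , refl ← U-end q p p′ (conn-touches c (proj₂ (U-edge q)) (flip-edge G e)) = refl , refl
    P-P (in-conn p p′ c) (in-conn q q′ d) e = U-end p q q′ (conn-separate d c (Sum.map ≡-sym (flip-edge G) e))

    P-W : ∀ {i j v} x → P i j v → Edge G (W x) v → x ≡ inj₁ i ⊎ x ≡ inj₂ j
    P-W x (in-U p) e = ⊥-elim (true≢false e (indep (proj₂ (W-edge x)) (proj₂ (U-edge p))))
    P-W x (in-conn p p′ c) e with conn-touches c (proj₂ (W-edge x)) e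
    ... | inj₁ e′ = ⊥-elim (UW x p (≡-sym e′))
    P-W x (in-conn p (inj₁ p′) c) e | inj₂ e′ = ⊥-elim (UW x p′ (≡-sym e′))
    P-W x (in-conn p (inj₂ (inj₁ refl)) c) e | inj₂ e′ = inj₁ (W-inj e′)
    P-W x (in-conn p (inj₂ (inj₂ refl)) c) e | inj₂ e′ = inj₂ (W-inj e′)

    reach-lift : ∀ {i j u v} → Reach F (U i j) u v → Reach G (P i j) u v
    reach-lift (here p) = here (in-U p)
    reach-lift (step p e r) with y , y′ , e₁ , c , e₂ ← linked e =
      step (in-U p) e₁ (reach-trans (reach-snoc (reach-map (in-conn p (inj₁ (reach-∈ r))) c) e₂ (in-U (reach-∈ r))) (reach-lift r))

    connected : ∀ i j → Σ (Fin n) λ u → Σ (Fin n) λ v → Edge G (W (inj₁ i)) u × Reach G (P i j) u v × Edge G v (W (inj₂ j))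
    connected i j
      with u , u∈ , e ← dominator i j (inj₁ i)
      with v , v∈ , e′ ← dominator i j (inj₂ j)
      with y₁ , y₁′ , a₁ , c₁ , b₁ ← linked (flip-edge F e)
      with y₂ , y₂′ , a₂ , c₂ , b₂ ← linked e′
      = y₁ , y₂′ , a₁ ,
        reach-trans (reach-snoc (reach-map (λ c → in-conn u∈ (inj₂ (inj₁ refl)) (conn-sym c)) c₁) b₁ (in-U u∈))
          (reach-trans (reach-lift (Wb.U-connected (combine i j) u∈ v∈))
            (step (in-U v∈) a₂ (reach-map (in-conn v∈ (inj₂ (inj₂ refl))) c₂))) ,
        b₂

    linkage : Linkage G r t
    linkage = record
      { W = W ; P = P ; W-injective = W-inj
      ; W-indep = λ x y → indep (proj₂ (W-edge x)) (proj₂ (W-edge y))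
      ; P-not-W = λ { x (in-U p) e → UW x p (≡-sym e) ; x (in-conn p _ c) → conn-avoids c (proj₂ (W-edge x)) }
      ; P-W = P-W ; P-P = P-P ; connected = connected }

  frame-web⇒subdivision : ContainsInducedSubdivK r t G
  frame-web⇒subdivision = linkage⇒subdivision G linkage

DenseFrame : ∀ {n} → Graph n → ℕ → Set₁
DenseFrame {n} G Λ = Σ (Graph n) λ F → Σ (Sub n) λ X → Frame G F × (∀ {u v} → Edge F u v → X u ≡ true) × Λ * ∣ X ∣ < (∑[ u ] ∣ nb F u ∣)

-- The average degree `2 * cost (r * t)` with `h = r + t`: one connected set for each edge of
-- `K_{r,t}` and one further vertex for each of its vertices.
maderBound : ℕ → ℕ → ℕ
maderBound r t = 2 * (2 ^ (r * t) * (r + t))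

denseFrame⇒subdivision : ∀ {n r t} (G : Graph n) → 1 ≤ r → 1 ≤ t → DenseFrame G (maderBound r t) → ContainsInducedSubdivK r t G
denseFrame⇒subdivision {n} {r} {t} G r≥1 t≥1 (F , X , Φ , F⊆X , dense) =
  frame-web⇒subdivision G F r≥1 t≥1 Φ (web-⊆ (λ _ → refl) (Mader.web F (r + t) (≤-trans r≥1 (m≤m+n r t)) (r * t) X X≥1 dense′))
  where
  open ≤-Reasoning
  pt : ∀ u v → ⟦ adj F u v ⟧ ≡ ⟦ X u ⟧ * ⟦ X v ∧ adj F u v ⟧
  pt u v with true-or-false (adj F u v)
  ... | inj₁ e rewrite e | F⊆X e | F⊆X (trans (Graph.sym F v u) e) = refl
  ... | inj₂ e rewrite e | ∧-comm (X v) false | *-zeroʳ ⟦ X u ⟧ = refl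
  total : (∑[ u ] ∣ nb F u ∣) ≡ degSum F X
  total = sum-cong-≗ λ u → trans (sum-cong-≗ (pt u)) (≡-sym (∑-*ˡ ⟦ X u ⟧ _))
  dense′ : 2 * (2 ^ (r * t) * (r + t)) * ∣ X ∣ ≤ degSum F X
  dense′ = ≤-trans (<⇒≤ dense) (≤-reflexive total)
  X≥1 : 1 ≤ ∣ X ∣
  X≥1 with u , p ← ∑-pos⇒∃ _ (≤-trans (s≤s z≤n) (≤-trans dense (≤-reflexive total))) = ∃⇒card-pos X (proj₁ (⟦⟧-pos {X u} _ p))

-- Degeneracy

-- An elimination order witnessing that `S` induces a `d`-degenerate subgraph.
data Peel {n : ℕ} (G : Graph n) (d : ℕ) : Sub n → Set where
  done : ∀ {S} → (∀ v → S v ≡ false) → Peel G d S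
  remove : ∀ {S} v → S v ≡ true → deg G S v ≤ d → Peel G d (S ∖ v) → Peel G d S

Core : ∀ {n} → Graph n → ℕ → Sub n → Set
Core {n} G d S = Σ (Sub n) λ T → (∀ {v} → T v ≡ true → S v ≡ true) × 1 ≤ ∣ T ∣ × (∀ v → T v ≡ true → d < deg G T v)

peel-or-core : ∀ {n} (G : Graph n) d S → Peel G d S ⊎ Core G d S
peel-or-core {n} G d S = go n S (card-≤n S)
  where
  go : ∀ f S → ∣ S ∣ ≤ f → Peel G d S ⊎ Core G d S
  go f S S≤ with FP.any? (λ v → (S v B.≟ true) ×-dec (deg G S v ≤? d)) | FP.any? (λ v → S v B.≟ true)
  ... | _ | no empty = inj₁ (done λ v → ¬true⇒false λ p → empty (v , p))
  ... | no ¬p | yes (v , v∈) = inj₂ (S , (λ p → p) , ∃⇒card-pos S v∈ , λ u u∈ → ≰⇒> λ q → ¬p (u , u∈ , q))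
  go zero S S≤ | yes (v , v∈ , _) | yes _ = ⊥-elim (<⇒≱ (∃⇒card-pos S v∈) S≤)
  go (suc f) S S≤ | yes (v , v∈ , small) | yes _ with go f (S ∖ v) (s≤s⁻¹ (≤-trans (≤-reflexive (≡-sym (card-∖ S v∈))) S≤))
  ... | inj₁ p = inj₁ (remove v v∈ small p)
  ... | inj₂ (T , T⊆ , T≥1 , core) = inj₂ (T , (λ p → ∖-⊆ S (T⊆ p)) , T≥1 , core)

peel-degSum : ∀ {n} (G : Graph n) {d S} → Peel G d S → degSum G S ≤ 2 * d * ∣ S ∣
peel-degSum G (done empty) = ≤-trans (≤-reflexive (∑-zero λ u → cong (_* deg G _ u) (cong ⟦_⟧ (empty u)))) z≤n
peel-degSum G {d} {S} (remove v v∈ small p) = begin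
  degSum G S ≡⟨ degSum-∖ G S v∈ ⟩
  degSum G (S ∖ v) + 2 * deg G S v ≤⟨ +-mono-≤ (peel-degSum G p) (*-monoʳ-≤ 2 small) ⟩
  2 * d * ∣ S ∖ v ∣ + 2 * d ≡⟨ lem d ∣ S ∖ v ∣ ⟩
  2 * d * suc ∣ S ∖ v ∣ ≡⟨ cong (2 * d *_) (card-∖ S v∈) ⟨
  2 * d * ∣ S ∣ ∎
  where
  open ≤-Reasoning
  lem : ∀ d x → 2 * d * x + 2 * d ≡ 2 * d * suc x
  lem = solve-∀

free-colour : ∀ {n} (G : Graph n) {d} (S : Sub n) (c : Fin n → Fin (suc d)) v → deg G S v ≤ d →
  ∃ λ k → ∀ u → (S ∩ nb G v) u ≡ true → c u ≢ k
free-colour {n} G {d} S c v small with FP.any? (λ k → FP.all? λ u → ((S ∩ nb G v) u B.≟ true) →-dec ¬? (c u FP.≟ k))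
... | yes p = p
... | no ¬p = ⊥-elim (<⇒≱ (s≤s small) (begin
  suc d ≡⟨ *-identityʳ (suc d) ⟨
  suc d * 1 ≤⟨ ∑-const-≥ 1 used ⟩
  (∑[ k ] ∑[ u ] ⟦ N u ⟧ * (⟦ eq (c u) k ⟧ * 1)) ≡⟨ ∑-swap (λ k u → ⟦ N u ⟧ * (⟦ eq (c u) k ⟧ * 1)) ⟩
  (∑[ u ] ∑[ k ] ⟦ N u ⟧ * (⟦ eq (c u) k ⟧ * 1)) ≡⟨ sum-cong-≗ (λ u → trans (≡-sym (∑-*ˡ ⟦ N u ⟧ _)) (trans (cong (⟦ N u ⟧ *_) (∑-eq (c u) (λ _ → 1))) (*-identityʳ _))) ⟩
  deg G S v ∎))
  where
  open ≤-Reasoning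
  N = S ∩ nb G v
  used : ∀ k → 1 ≤ (∑[ u ] ⟦ N u ⟧ * (⟦ eq (c u) k ⟧ * 1))
  used k with FP.any? (λ u → (N u B.≟ true) ×-dec (c u FP.≟ k))
  ... | no ¬q = ⊥-elim (¬p (k , λ u u∈ e → ¬q (u , u∈ , e)))
  ... | yes (u , u∈ , refl) = ≤-trans (≤-reflexive (cong₂ (λ a b → ⟦ a ⟧ * (⟦ b ⟧ * 1)) (≡-sym u∈) (≡-sym (eq-refl (c u))))) (term≤∑ _ u)

peel-colour : ∀ {n} (G : Graph n) {d S} → Peel G d S →
  Σ (Fin n → Fin (suc d)) λ c → ∀ u v → S u ≡ true → S v ≡ true → Edge G u v → c u ≢ c v
peel-colour G (done empty) = (λ _ → F.zero) , λ u v u∈ → ⊥-elim (true≢false u∈ (empty u))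
peel-colour {n} G {d} {S} (remove x x∈ small p)
  with c , proper ← peel-colour G p
  with k , free ← free-colour G {d} S c x small
  = c′ , proper′
  where
  c′ : Fin n → Fin (suc d)
  c′ u = if eq x u then k else c u
  proper′ : ∀ u v → S u ≡ true → S v ≡ true → Edge G u v → c′ u ≢ c′ v
  proper′ u v u∈ v∈ e with x FP.≟ u | x FP.≟ v
  ... | yes refl | yes refl = ⊥-elim (true≢false e (irrefl G u))
  ... | yes refl | no ne = λ q → free v (∧-intro v∈ e) (≡-sym q)
  ... | no ne | yes refl = free u (∧-intro u∈ (trans (Graph.sym G v u) e))
  ... | no ne | no ne′ = proper u v (∖-intro S u∈ ne) (∖-intro S v∈ ne′) e

-- Degrees inside `S` may be unbounded although `S` is degenerate. Orienting the edges lets an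
-- adjacency of two sampled vertices be charged to its tail, which has few out-neighbours.
record Orientation {n : ℕ} (G : Graph n) (d : ℕ) (S : Sub n) : Set where
  field
    out : Fin n → Sub n
    out-small : ∀ u → ∣ out u ∣ ≤ d
    out⊆adj : ∀ {u v} → out u v ≡ true → Edge G u v
    oriented : ∀ {u v} → S u ≡ true → S v ≡ true → Edge G u v → out u v ≡ true ⊎ out v u ≡ true

peel-orientation : ∀ {n} (G : Graph n) {d S} → Peel G d S → Orientation G d S
peel-orientation {n} G (done empty) = record
  { out = λ _ _ → false ; out-small = λ _ → ≤-trans (≤-reflexive (∑-zero {n} λ _ → refl)) z≤n
  ; out⊆adj = λ () ; oriented = λ {u} u∈ → ⊥-elim (true≢false u∈ (empty u)) }
peel-orientation {n} G {d} {S} (remove x x∈ small p) = record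
  { out = out′ ; out-small = small′ ; out⊆adj = λ {u} → adj′ u ; oriented = λ {u} {v} → oriented′ u v }
  where
  open Orientation (peel-orientation G p)
  out′ : Fin n → Sub n
  out′ u = if eq x u then S ∩ nb G x else out u
  small′ : ∀ u → ∣ out′ u ∣ ≤ d
  small′ u with x FP.≟ u
  ... | yes _ = small
  ... | no _ = out-small u
  adj′ : ∀ u {v} → out′ u v ≡ true → Edge G u v
  adj′ u {v} q with x FP.≟ u
  ... | yes refl = ∧-elimʳ {S v} q
  ... | no _ = out⊆adj q
  oriented′ : ∀ u v → S u ≡ true → S v ≡ true → Edge G u v → out′ u v ≡ true ⊎ out′ v u ≡ true
  oriented′ u v u∈ v∈ e with x FP.≟ u | x FP.≟ v
  ... | yes refl | _ = inj₁ (∧-intro v∈ e)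
  ... | no _ | yes refl = inj₂ (∧-intro u∈ (trans (Graph.sym G v u) e))
  ... | no ne | no ne′ = oriented (∖-intro S u∈ ne) (∖-intro S v∈ ne′) e

-- The largest colour class of a proper colouring with `suc d` colours, which exists because a
-- `Core` would contain a vertex of degree above `d`.
large-independent : ∀ {n} (G : Graph n) d (S : Sub n) → (∀ v → S v ≡ true → deg G S v ≤ d) →
  Σ (Sub n) λ A → (∀ {v} → A v ≡ true → S v ≡ true) × (∀ {u v} → A u ≡ true → A v ≡ true → adj G u v ≡ false) × ∣ S ∣ ≤ suc d * ∣ A ∣
large-independent {n} G d S bounded with peel-or-core G d S
... | inj₂ (T , T⊆ , T≥1 , core) with v , v∈ ← card-pos⇒∃ T T≥1 =
  ⊥-elim (<⇒≱ (core v v∈) (≤-trans (deg-mono G T⊆ v) (bounded v (T⊆ v∈))))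
... | inj₁ p with c , proper ← peel-colour G p = result
  where
  class : Fin (suc d) → Sub n
  class k u = S u ∧ eq (c u) k
  total : ∣ S ∣ ≡ (∑[ k ] ∣ class k ∣)
  total = trans (sum-cong-≗ λ u → pt u) (∑-swap (λ u k → ⟦ class k u ⟧))
    where
    pt : ∀ u → ⟦ S u ⟧ ≡ (∑[ k ] ⟦ class k u ⟧)
    pt u = ≡-sym (trans (sum-cong-≗ λ k → trans (⟦∧⟧ (S u) (eq (c u) k)) (cong (⟦ S u ⟧ *_) (≡-sym (*-identityʳ ⟦ eq (c u) k ⟧))))
      (trans (≡-sym (∑-*ˡ ⟦ S u ⟧ _)) (trans (cong (⟦ S u ⟧ *_) (∑-eq (c u) (λ _ → 1))) (*-identityʳ _))))
  result : Σ (Sub n) λ A → (∀ {v} → A v ≡ true → S v ≡ true) × (∀ {u v} → A u ≡ true → A v ≡ true → adj G u v ≡ false) × ∣ S ∣ ≤ suc d * ∣ A ∣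
  result with FP.any? (λ k → ∣ S ∣ ≤? suc d * ∣ class k ∣)
  ... | yes (k , big) = class k , (λ p → ∧-elimˡ p) , (λ {u} {v} p q → ¬true⇒false λ e → proper u v (∧-elimˡ p) (∧-elimˡ q) e
    (trans (eq⇒≡ (∧-elimʳ {S u} p)) (≡-sym (eq⇒≡ (∧-elimʳ {S v} q))))) , big
  ... | no ¬big = ⊥-elim (<⇒≱ lt (≤-reflexive (cong (suc d *_) total)))
    where
    open ≤-Reasoning
    lt : suc d * (∑[ k ] ∣ class k ∣) < suc d * ∣ S ∣
    lt = begin-strict
      suc d * (∑[ k ] ∣ class k ∣) ≡⟨ ∑-*ˡ (suc d) _ ⟩
      (∑[ k ] suc d * ∣ class k ∣) <⟨ sum< ⟩
      suc d * ∣ S ∣ ∎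
      where
      S≥1 : 1 ≤ ∣ S ∣
      S≥1 = ≤-trans (s≤s z≤n) (≰⇒> λ q → ¬big (F.zero , q))
      sum< : (∑[ k ] suc d * ∣ class k ∣) < suc d * ∣ S ∣
      sum< = ≤-trans (s≤s (∑-const-≤ (∣ S ∣ ∸ 1) λ k → <⇒≤pred (≰⇒> λ q → ¬big (k , q))))
        (*-monoʳ-< (suc d) (≤-reflexive (m+[n∸m]≡n S≥1)))

-- Random subsets: 𝔼 q n F is (1 + q)ⁿ times the expectation of F on a random subset in which
-- every element is present independently with probability 1 / (1 + q).
𝔼 : ℕ → ∀ n → (Sub n → ℕ) → ℕ
𝔼 q zero F = F λ ()
𝔼 q (suc n) F = 𝔼 q n (λ s → F (cons true s)) + q * 𝔼 q n (λ s → F (cons false s))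

𝔼-mono : ∀ q n {F G : Sub n → ℕ} → (∀ s → F s ≤ G s) → 𝔼 q n F ≤ 𝔼 q n G
𝔼-mono q zero h = h _
𝔼-mono q (suc n) h = +-mono-≤ (𝔼-mono q n λ s → h _) (*-monoʳ-≤ q (𝔼-mono q n λ s → h _))

𝔼-cong : ∀ q n {F G : Sub n → ℕ} → (∀ s → F s ≡ G s) → 𝔼 q n F ≡ 𝔼 q n G
𝔼-cong q n h = ≤-antisym (𝔼-mono q n λ s → ≤-reflexive (h s)) (𝔼-mono q n λ s → ≤-reflexive (≡-sym (h s)))

𝔼-+ : ∀ q n (F G : Sub n → ℕ) → 𝔼 q n (λ s → F s + G s) ≡ 𝔼 q n F + 𝔼 q n G
𝔼-+ q zero F G = refl
𝔼-+ q (suc n) F G = trans (cong₂ (λ x y → x + q * y) (𝔼-+ q n _ _) (𝔼-+ q n _ _)) (lem q (𝔼 q n _) (𝔼 q n _) (𝔼 q n _) (𝔼 q n _))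
  where
  lem : ∀ q a b c d → (a + b) + q * (c + d) ≡ (a + q * c) + (b + q * d)
  lem = solve-∀

𝔼-* : ∀ q n c (F : Sub n → ℕ) → 𝔼 q n (λ s → c * F s) ≡ c * 𝔼 q n F
𝔼-* q zero c F = refl
𝔼-* q (suc n) c F = trans (cong₂ (λ x y → x + q * y) (𝔼-* q n c _) (𝔼-* q n c _)) (lem q c (𝔼 q n _) (𝔼 q n _))
  where
  lem : ∀ q c a b → c * a + q * (c * b) ≡ c * (a + q * b)
  lem = solve-∀

opaque
  unfolding sum

  𝔼-∑ : ∀ q n {m} (F : Fin m → Sub n → ℕ) → 𝔼 q n (λ s → ∑[ i ] F i s) ≡ (∑[ i ] 𝔼 q n (F i))
  𝔼-∑ q n {zero} F = 𝔼-* q n 0 (λ _ → 0)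
  𝔼-∑ q n {suc m} F = trans (𝔼-+ q n (F F.zero) _) (cong (𝔼 q n (F F.zero) +_) (𝔼-∑ q n (F ∘ F.suc)))

𝔼-const : ∀ q n → 𝔼 q n (λ _ → 1) ≡ suc q ^ n
𝔼-const q zero = refl
𝔼-const q (suc n) = cong (λ x → x + q * x) (𝔼-const q n)

-- The first moment method, deciding the membership of one element at a time.
𝔼-<⇒∃ : ∀ q n (F G : Sub n → ℕ) → 𝔼 q n F < 𝔼 q n G → ∃ λ s → F s < G s
𝔼-<⇒∃ q zero F G h = _ , h
𝔼-<⇒∃ q (suc n) F G h with 𝔼 q n (λ s → F (cons true s)) <? 𝔼 q n (λ s → G (cons true s))
... | yes p with s , r ← 𝔼-<⇒∃ q n _ _ p = cons true s , r
... | no ¬p with 𝔼 q n (λ s → F (cons false s)) <? 𝔼 q n (λ s → G (cons false s))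
... | yes p with s , r ← 𝔼-<⇒∃ q n _ _ p = cons false s , r
... | no ¬p′ = ⊥-elim (<⇒≱ h (+-mono-≤ (≮⇒≥ ¬p) (*-monoʳ-≤ q (≮⇒≥ ¬p′))))

Ignores : ∀ {n} → (Sub n → ℕ) → Fin n → Set
Ignores {n} F v = ∀ s s′ → (∀ u → v ≢ u → s u ≡ s′ u) → F s ≡ F s′

-- The presence of `v` has probability `1 / suc q` and is independent of everything that ignores
-- `v`.
𝔼-hit : ∀ q n (F : Sub n → ℕ) v → Ignores F v → suc q * 𝔼 q n (λ s → ⟦ s v ⟧ * F s) ≡ 𝔼 q n F
𝔼-hit q (suc n) F F.zero ig = begin
  suc q * (𝔼 q n (λ s → 1 * F (cons true s)) + q * 𝔼 q n (λ s → 0)) ≡⟨ cong₂ (λ x y → suc q * (x + q * y)) (𝔼-* q n 1 _) (𝔼-* q n 0 (λ _ → 0)) ⟩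
  suc q * (1 * a + q * 0) ≡⟨ lem q a ⟩
  a + q * a ≡⟨ cong (λ x → a + q * x) (𝔼-cong q n λ s → ig (cons true s) (cons false s) λ { F.zero ne → ⊥-elim (ne refl) ; (F.suc u) _ → refl }) ⟩
  a + q * 𝔼 q n (λ s → F (cons false s)) ∎
  where
  open ≡-Reasoning
  a = 𝔼 q n (λ s → F (cons true s))
  lem : ∀ q a → suc q * (1 * a + q * 0) ≡ a + q * a
  lem = solve-∀
𝔼-hit q (suc n) F (F.suc v) ig = begin
  suc q * (a + q * b) ≡⟨ lem q a b ⟩
  suc q * a + q * (suc q * b) ≡⟨ cong₂ (λ x y → x + q * y) (𝔼-hit q n _ v (ig′ true)) (𝔼-hit q n _ v (ig′ false)) ⟩
  𝔼 q n (λ s → F (cons true s)) + q * 𝔼 q n (λ s → F (cons false s)) ∎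
  where
  open ≡-Reasoning
  a = 𝔼 q n (λ s → ⟦ s v ⟧ * F (cons true s))
  b = 𝔼 q n (λ s → ⟦ s v ⟧ * F (cons false s))
  lem : ∀ q a b → suc q * (a + q * b) ≡ suc q * a + q * (suc q * b)
  lem = solve-∀
  ig′ : ∀ x → Ignores (λ s → F (cons x s)) v
  ig′ x s s′ h = ig (cons x s) (cons x s′) λ { F.zero _ → refl ; (F.suc u) ne → h u λ e → ne (cong F.suc e) }

hits : ∀ {n k} → Vec (Fin n) k → Sub n → ℕ
hits [] s = 1
hits (x ∷ xs) s = ⟦ s x ⟧ * hits xs s

Distinct : ∀ {n k} → Vec (Fin n) k → Set
Distinct = AllPairs _≢_

hits-ignores : ∀ {n k} {v : Fin n} (xs : Vec (Fin n) k) → VAll.All (v ≢_) xs → Ignores (hits xs) v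
hits-ignores [] [] s s′ h = refl
hits-ignores (x ∷ xs) (p ∷ ps) s s′ h = cong₂ (λ a b → ⟦ a ⟧ * b) (h x p) (hits-ignores xs ps s s′ h)

𝔼-hits : ∀ q n {k} (xs : Vec (Fin n) k) → Distinct xs → suc q ^ k * 𝔼 q n (hits xs) ≡ suc q ^ n
𝔼-hits q n [] [] = trans (+-identityʳ _) (𝔼-const q n)
𝔼-hits q n {suc k} (x ∷ xs) (p ∷ ps) = begin
  suc q * suc q ^ k * 𝔼 q n (hits (x ∷ xs)) ≡⟨ lem (suc q) (suc q ^ k) _ ⟩
  suc q ^ k * (suc q * 𝔼 q n (hits (x ∷ xs))) ≡⟨ cong (suc q ^ k *_) (𝔼-hit q n (hits xs) x (hits-ignores xs p)) ⟩
  suc q ^ k * 𝔼 q n (hits xs) ≡⟨ 𝔼-hits q n xs ps ⟩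
  suc q ^ n ∎
  where
  open ≡-Reasoning
  lem : ∀ a b c → a * b * c ≡ b * (a * c)
  lem = solve-∀

-- Sums over tuples and expected numbers of sampled patterns

∑^ : ∀ {n} k → (Vec (Fin n) k → ℕ) → ℕ
∑^ zero f = f []
∑^ (suc k) f = ∑[ v ] ∑^ k (λ vs → f (v ∷ vs))

∑^-mono : ∀ {n} k {f g : Vec (Fin n) k → ℕ} → (∀ vs → f vs ≤ g vs) → ∑^ k f ≤ ∑^ k g
∑^-mono zero h = h []
∑^-mono (suc k) h = ∑-mono λ v → ∑^-mono k λ vs → h (v ∷ vs)

∑^-cong : ∀ {n} k {f g : Vec (Fin n) k → ℕ} → (∀ vs → f vs ≡ g vs) → ∑^ k f ≡ ∑^ k g
∑^-cong k h = ≤-antisym (∑^-mono k λ vs → ≤-reflexive (h vs)) (∑^-mono k λ vs → ≤-reflexive (≡-sym (h vs)))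

∑^-+ : ∀ {n} k (f g : Vec (Fin n) k → ℕ) → ∑^ k (λ vs → f vs + g vs) ≡ ∑^ k f + ∑^ k g
∑^-+ zero f g = refl
∑^-+ (suc k) f g = trans (sum-cong-≗ λ v → ∑^-+ k _ _) (∑-distrib-+ _ _)

∑^-*ˡ : ∀ {n} k c (f : Vec (Fin n) k → ℕ) → c * ∑^ k f ≡ ∑^ k (λ vs → c * f vs)
∑^-*ˡ zero c f = refl
∑^-*ˡ (suc k) c f = trans (∑-*ˡ c _) (sum-cong-≗ λ v → ∑^-*ˡ k c _)

𝔼-∑^ : ∀ q n {m} k (F : Vec (Fin m) k → Sub n → ℕ) → 𝔼 q n (λ s → ∑^ k (λ vs → F vs s)) ≡ ∑^ k (λ vs → 𝔼 q n (F vs))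
𝔼-∑^ q n zero F = refl
𝔼-∑^ q n (suc k) F = trans (𝔼-∑ q n _) (sum-cong-≗ λ v → 𝔼-∑^ q n k _)

-- Two independent samples, at the rates `1 / suc p` and `1 / suc q`.
𝔼₂ : ℕ → ℕ → ∀ n → (Sub n → Sub n → ℕ) → ℕ
𝔼₂ p q n F = 𝔼 p n λ X → 𝔼 q n λ Z → F X Z

𝔼₂-<⇒∃ : ∀ p q n (F G : Sub n → Sub n → ℕ) → 𝔼₂ p q n F < 𝔼₂ p q n G → ∃ λ X → ∃ λ Z → F X Z < G X Z
𝔼₂-<⇒∃ p q n F G h with X , h′ ← 𝔼-<⇒∃ p n _ _ h with Z , h″ ← 𝔼-<⇒∃ q n _ _ h′ = X , Z , h″

𝔼₂-+ : ∀ p q n (F G : Sub n → Sub n → ℕ) → 𝔼₂ p q n (λ X Z → F X Z + G X Z) ≡ 𝔼₂ p q n F + 𝔼₂ p q n G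
𝔼₂-+ p q n F G = trans (𝔼-cong p n λ X → 𝔼-+ q n (F X) (G X)) (𝔼-+ p n _ _)

𝔼₂-* : ∀ p q n c (F : Sub n → Sub n → ℕ) → 𝔼₂ p q n (λ X Z → c * F X Z) ≡ c * 𝔼₂ p q n F
𝔼₂-* p q n c F = trans (𝔼-cong p n λ X → 𝔼-* q n c (F X)) (𝔼-* p n c _)

𝔼₂-events : ∀ p q n {k a b} (stat : Vec (Fin n) k → Bool) (xs : Vec (Fin n) k → Vec (Fin n) a) (zs : Vec (Fin n) k → Vec (Fin n) b) →
  (∀ vs → stat vs ≡ true → Distinct (xs vs) × Distinct (zs vs)) →
  suc p ^ a * suc q ^ b * 𝔼₂ p q n (λ X Z → ∑^ k (λ vs → ⟦ stat vs ⟧ * (hits (xs vs) X * hits (zs vs) Z)))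
    ≡ suc p ^ n * suc q ^ n * ∑^ k (λ vs → ⟦ stat vs ⟧)
𝔼₂-events p q n {k} {a} {b} stat xs zs distinct = begin
  c * 𝔼₂ p q n (λ X Z → ∑^ k (λ vs → ⟦ stat vs ⟧ * (hits (xs vs) X * hits (zs vs) Z)))
    ≡⟨ cong (c *_) (trans (𝔼-cong p n λ X → 𝔼-∑^ q n k _) (𝔼-∑^ p n k _)) ⟩
  c * ∑^ k (λ vs → 𝔼₂ p q n (λ X Z → ⟦ stat vs ⟧ * (hits (xs vs) X * hits (zs vs) Z))) ≡⟨ ∑^-*ˡ k c _ ⟩
  ∑^ k (λ vs → c * 𝔼₂ p q n (λ X Z → ⟦ stat vs ⟧ * (hits (xs vs) X * hits (zs vs) Z))) ≡⟨ ∑^-cong k pt ⟩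
  ∑^ k (λ vs → Ω * ⟦ stat vs ⟧) ≡⟨ ∑^-*ˡ k Ω _ ⟨
  Ω * ∑^ k (λ vs → ⟦ stat vs ⟧) ∎
  where
  open ≡-Reasoning
  c = suc p ^ a * suc q ^ b
  Ω = suc p ^ n * suc q ^ n
  lem : ∀ a b x y → a * b * (y * x) ≡ (a * x) * (b * y)
  lem = solve-∀
  pt : ∀ vs → c * 𝔼₂ p q n (λ X Z → ⟦ stat vs ⟧ * (hits (xs vs) X * hits (zs vs) Z)) ≡ Ω * ⟦ stat vs ⟧
  pt vs with stat vs in e
  ... | false = trans (cong (c *_) (trans (𝔼-cong p n λ X → 𝔼-* q n 0 (λ _ → 0)) (𝔼-* p n 0 (λ _ → 0)))) (trans (*-zeroʳ c) (≡-sym (*-zeroʳ Ω)))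
  ... | true = begin
    c * 𝔼₂ p q n (λ X Z → 1 * (hits (xs vs) X * hits (zs vs) Z))
      ≡⟨ cong (c *_) (trans (𝔼₂-* p q n 1 _) (*-identityˡ _)) ⟩
    c * 𝔼₂ p q n (λ X Z → hits (xs vs) X * hits (zs vs) Z)
      ≡⟨ cong (c *_) (trans (𝔼-cong p n λ X → trans (𝔼-* q n (hits (xs vs) X) (hits (zs vs))) (*-comm (hits (xs vs) X) _)) (𝔼-* p n (𝔼 q n (hits (zs vs))) (hits (xs vs)))) ⟩
    c * (𝔼 q n (hits (zs vs)) * 𝔼 p n (hits (xs vs))) ≡⟨ lem (suc p ^ a) (suc q ^ b) _ _ ⟩
    (suc p ^ a * 𝔼 p n (hits (xs vs))) * (suc q ^ b * 𝔼 q n (hits (zs vs)))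
      ≡⟨ cong₂ _*_ (𝔼-hits p n (xs vs) (proj₁ (distinct vs e))) (𝔼-hits q n (zs vs) (proj₂ (distinct vs e))) ⟩
    Ω ≡⟨ *-identityʳ Ω ⟨
    Ω * 1 ∎

-- A pattern of `k` vertices of which `a` must fall into `X` and `b` into `Z`. As the two samples
-- are independent, distinctness is asked only within each list, and a pattern then occurs with
-- probability exactly `1 / (suc p ^ a * suc q ^ b)`.
record Event (n k a b : ℕ) : Set where
  field
    stat : Vec (Fin n) k → Bool
    xs : Vec (Fin n) k → Vec (Fin n) a
    zs : Vec (Fin n) k → Vec (Fin n) b
    distinct : ∀ vs → stat vs ≡ true → Distinct (xs vs) × Distinct (zs vs)

  term : Sub n → Sub n → Vec (Fin n) k → ℕ
  term X Z vs = ⟦ stat vs ⟧ * (hits (xs vs) X * hits (zs vs) Z)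

  mean : ℕ → ℕ → ℕ
  mean p q = 𝔼₂ p q n λ X Z → ∑^ k (term X Z)

  count : ℕ
  count = ∑^ k λ vs → ⟦ stat vs ⟧

  mean-count : ∀ p q → suc p ^ a * suc q ^ b * mean p q ≡ suc p ^ n * suc q ^ n * count
  mean-count p q = 𝔼₂-events p q n stat xs zs distinct

-- The balanced case

∑-≤-weighted : ∀ {n} (w : Fin n → ℕ) {g : Fin n → ℕ} {m} c → sum w ≤ m → (∀ v → g v ≤ w v * c) → sum g ≤ m * c
∑-≤-weighted w c hw hg = ≤-trans (∑-mono hg) (≤-trans (≤-reflexive (≡-sym (∑-*ʳ c w))) (*-monoˡ-≤ c hw))

one : ∀ {b} → b ≡ true → 1 ≤ ⟦ b ⟧
one refl = ≤-refl

infixr 5 _⊛_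
_⊛_ : ∀ {x y} → 1 ≤ x → 1 ≤ y → 1 ≤ x * y
_⊛_ = *-mono-≤

-- The number of walks of length three from `u` to `v`, trivially at most `D * D` when degrees are
-- at most `D`. For `u = v` it counts ordered triangles at `u`.
cross : ∀ {n} → Graph n → Fin n → Fin n → ℕ
cross G u v = ∑[ x ] ⟦ adj G u x ⟧ * (∑[ x′ ] ⟦ adj G v x′ ⟧ * ⟦ adj G x x′ ⟧)

module WalkSums {n : ℕ} (G : Graph n) (d D σ : ℕ) (low : ∀ v → d ≤ ∣ nb G v ∣) (high : ∀ v → ∣ nb G v ∣ ≤ D)
  (sparse : ∀ u v → σ * cross G u v ≤ D * D) where

  A : Fin n → Fin n → ℕ
  A u v = ⟦ adj G u v ⟧

  A-sym : ∀ u v → A u v ≡ A v u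
  A-sym u v = cong ⟦_⟧ (Graph.sym G u v)

  middle : (Fin n → Fin n → Fin n → Fin n → ℕ) → Fin n → Fin n → ℕ
  middle h y y′ = ∑[ x ] A y x * (∑[ x′ ] A y′ x′ * h y y′ x x′)

  -- Walks x y y′ x′ are summed with the middle edge outermost, so that every bound below is obtained from the inside out.
  walks : (Fin n → Fin n → Fin n → Fin n → ℕ) → ℕ
  walks h = ∑[ y ] ∑[ y′ ] A y y′ * middle h y y′

  walks-≥ : n * (d * (d * d)) ≤ walks (λ _ _ _ _ → 1)
  walks-≥ = ∑-const-≥ _ λ y → lower y _ λ y′ → lower y _ λ x → ≤-trans (low y′) (≤-reflexive (sum-cong-≗ λ x′ → ≡-sym (*-identityʳ _)))
    where
    lower : ∀ u {f : Fin n → ℕ} c → (∀ v → c ≤ f v) → d * c ≤ (∑[ v ] A u v * f v)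
    lower u c h = ≤-trans (*-monoˡ-≤ c (low u)) (≤-trans (≤-reflexive (∑-*ʳ c _)) (∑-mono λ v → *-monoʳ-≤ (A u v) (h v)))

  nbr-≤ : ∀ u {f : Fin n → ℕ} c → (∀ v → f v ≤ c) → (∑[ v ] A u v * f v) ≤ D * c
  nbr-≤ u c h = ∑-*-≤ (A u) c (high u) h

  nbr-sum-≤ : ∀ u {f : Fin n → ℕ} → (∑[ v ] A u v * f v) ≤ sum f
  nbr-sum-≤ u = ∑-mono λ v → ≤-trans (*-monoˡ-≤ _ (⟦⟧≤1 (adj G u v))) (≤-reflexive (+-identityʳ _))

  walks-≤ : ∀ h B → (∀ y y′ → middle h y y′ ≤ B) → walks h ≤ n * (D * B)
  walks-≤ h B H = ∑-const-≤ (D * B) λ y → nbr-≤ y B (H y)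

  σ-∑ : ∀ {f : Fin n → ℕ} {B} → (∀ v → σ * f v ≤ B) → ∀ u → σ * (∑[ v ] A u v * f v) ≤ D * B
  σ-∑ {f} {B} h u = ≤-trans (≤-reflexive (trans (∑-*ˡ σ _) (sum-cong-≗ λ v → x∙yz≈y∙xz σ (A u v) (f v)))) (nbr-≤ u B h)

  σ-walks-≤ : ∀ h B → (∀ y y′ → σ * middle h y y′ ≤ B) → σ * walks h ≤ n * (D * B)
  σ-walks-≤ h B H = ≤-trans (≤-reflexive (∑-*ˡ σ _)) (∑-const-≤ (D * B) λ y → σ-∑ (H y) y)

  walks-const : ∀ h c → (∀ y y′ x x′ → h y y′ x x′ ≤ c) → walks h ≤ n * (D * (D * (D * c)))
  walks-const h c H = walks-≤ h _ λ y y′ → nbr-≤ y _ λ x → nbr-≤ y′ _ λ x′ → H y y′ x x′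

  σ-walks-const : ∀ h c → (∀ y y′ x x′ → σ * h y y′ x x′ ≤ c) → σ * walks h ≤ n * (D * (D * (D * c)))
  σ-walks-const h c H = σ-walks-≤ h _ λ y y′ → σ-∑ (λ x → σ-∑ (λ x′ → H y y′ x x′) y′) y

  ∑-one : (v : Fin n) → (∑[ u ] ⟦ eq v u ⟧) ≡ 1
  ∑-one v = trans (sum-cong-≗ λ u → ≡-sym (*-identityʳ ⟦ eq v u ⟧)) (∑-eq v (λ _ → 1))

  walks-closed : walks (λ y y′ x x′ → ⟦ eq x x′ ⟧) ≤ n * (D * (D * 1))
  walks-closed = walks-≤ _ _ λ y y′ → nbr-≤ y 1 λ x → ≤-trans (nbr-sum-≤ y′) (≤-reflexive (∑-one x))

  walks-back : walks (λ y y′ x x′ → ⟦ eq y x′ ⟧) ≤ n * (D * (D * 1))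
  walks-back = walks-≤ _ _ λ y y′ → nbr-≤ y 1 λ x → ≤-trans (nbr-sum-≤ y′) (≤-reflexive (∑-one y))

  walks-back′ : walks (λ y y′ x x′ → ⟦ eq y′ x ⟧) ≤ n * (D * (D * 1))
  walks-back′ = walks-≤ _ _ λ y y′ → ≤-trans (nbr-sum-≤ y) (≤-trans
    (∑-≤-weighted (λ x → ⟦ eq y′ x ⟧) {m = 1} D (≤-reflexive (∑-one y′)) λ x →
      ≤-trans (nbr-≤ y′ ⟦ eq y′ x ⟧ λ _ → ≤-refl) (≤-reflexive (*-comm D _)))
    (≤-reflexive (*-comm 1 D)))

  walks-square : σ * walks (λ y y′ x x′ → A x x′) ≤ n * (D * (D * D))
  walks-square = σ-walks-≤ _ _ sparse

  -- Summing the triangles on each edge at `y` gives `cross G y y`, so every weight dominated by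
  -- triangles inherits the saving `σ`.
  triangles : ∀ y (c : Fin n → ℕ) → (∀ y′ → c y′ ≤ D * (∑[ x ] A y x * A y′ x)) → σ * (∑[ y′ ] A y y′ * c y′) ≤ D * (D * D)
  triangles y c h = begin
    σ * (∑[ y′ ] A y y′ * c y′) ≤⟨ *-monoʳ-≤ σ (∑-mono λ y′ → *-monoʳ-≤ (A y y′) (h y′)) ⟩
    σ * (∑[ y′ ] A y y′ * (D * (∑[ x ] A y x * A y′ x))) ≡⟨ cong (σ *_) (trans (sum-cong-≗ λ y′ → x∙yz≈y∙xz (A y y′) D _) (≡-sym (∑-*ˡ D _))) ⟩
    σ * (D * cross G y y) ≡⟨ x∙yz≈y∙xz σ D _ ⟩
    D * (σ * cross G y y) ≤⟨ *-monoʳ-≤ D (sparse y y) ⟩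
    D * (D * D) ∎
    where
    open ≤-Reasoning

  walks-triangle : σ * walks (λ y y′ x x′ → A x y′) ≤ n * (D * (D * D))
  walks-triangle = ≤-trans (≤-reflexive (∑-*ˡ σ _)) (∑-const-≤ _ λ y → triangles y (middle (λ y y′ x x′ → A x y′) y) λ y′ →
    ≤-trans (∑-mono λ x → *-monoʳ-≤ (A y x) (nbr-≤ y′ (A x y′) λ _ → ≤-refl))
      (≤-reflexive (trans (sum-cong-≗ λ x → trans (x∙yz≈y∙xz (A y x) D _) (cong (λ z → D * (A y x * z)) (A-sym x y′))) (≡-sym (∑-*ˡ D _)))))

  walks-triangle′ : σ * walks (λ y y′ x x′ → A y x′) ≤ n * (D * (D * D))
  walks-triangle′ = ≤-trans (≤-reflexive (∑-*ˡ σ _)) (∑-const-≤ _ λ y → triangles y (middle (λ y y′ x x′ → A y x′) y) λ y′ →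
    nbr-≤ y _ λ x → ≤-reflexive (sum-cong-≗ λ x′ → *-comm (A y′ x′) (A y x′)))

  walks-ext-triangle : σ * walks (λ y y′ x x′ → ∑[ z ] A y z * A z x) ≤ n * (D * (D * (D * D)))
  walks-ext-triangle = σ-walks-≤ _ _ λ y y′ → triangles y (λ x → ∑[ x′ ] A y′ x′ * (∑[ z ] A y z * A z x)) λ x →
    nbr-≤ y′ _ λ _ → ≤-reflexive (sum-cong-≗ λ z → cong (A y z *_) (A-sym z x))

  -- The vertices `y`, `y′`, `x′`, `z` form a closed walk of length four, so the sum over `x′` and
  -- `z` is `cross G y′ y`.
  walks-ext-square : σ * walks (λ y y′ x x′ → ∑[ z ] A y z * A z x′) ≤ n * (D * (D * (D * D)))
  walks-ext-square = σ-walks-≤ _ _ λ y y′ → σ-∑ {B = D * D} (λ x → ≤-trans (*-monoʳ-≤ σ (≤-reflexive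
    (sum-cong-≗ λ x′ → cong (A y′ x′ *_) (sum-cong-≗ λ z → cong (A y z *_) (A-sym z x′))))) (sparse y′ y)) y

  ∑^⇒walks : ∀ j (f : Vec (Fin n) (4 + j) → ℕ) (g : Fin n → Fin n → Fin n → Fin n → Vec (Fin n) j → ℕ) →
    (∀ y y′ x x′ vs → f (y ∷ y′ ∷ x ∷ x′ ∷ vs) ≤ A y y′ * (A y x * (A y′ x′ * g y y′ x x′ vs))) →
    ∑^ (4 + j) f ≤ walks (λ y y′ x x′ → ∑^ j (g y y′ x x′))
  ∑^⇒walks j f g h = ∑-mono λ y → ∑-mono λ y′ → begin
    (∑[ x ] ∑[ x′ ] ∑^ j (λ vs → f (y ∷ y′ ∷ x ∷ x′ ∷ vs)))
      ≤⟨ ∑-mono (λ x → ∑-mono λ x′ → ∑^-mono j λ vs → h y y′ x x′ vs) ⟩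
    (∑[ x ] ∑[ x′ ] ∑^ j (λ vs → A y y′ * (A y x * (A y′ x′ * g y y′ x x′ vs))))
      ≡⟨ sum-cong-≗ (λ x → trans (sum-cong-≗ λ x′ → trans (≡-sym (∑^-*ˡ j (A y y′) _)) (cong (A y y′ *_)
           (trans (≡-sym (∑^-*ˡ j (A y x) _)) (cong (A y x *_) (≡-sym (∑^-*ˡ j (A y′ x′) _))))))
           (trans (≡-sym (∑-*ˡ (A y y′) _)) (cong (A y y′ *_) (≡-sym (∑-*ˡ (A y x) _))))) ⟩
    (∑[ x ] A y y′ * (A y x * (∑[ x′ ] A y′ x′ * ∑^ j (g y y′ x x′)))) ≡⟨ ∑-*ˡ (A y y′) _ ⟨
    A y y′ * middle (λ y y′ x x′ → ∑^ j (g y y′ x x′)) y y′ ∎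
    where open ≤-Reasoning

-- The expected number of paths whose ends and inner vertices are sampled at rates 1 / P and 1 / Q exceeds the
-- expected number of conflicts plus Λ times the number of sampled ends; σ is the saving from local sparsity.
Balance : (d D σ Λ P Q : ℕ) → Set
Balance d D σ Λ P Q = Λ * (P * P * (Q * Q * (Q * Q))) * σ + 2 * (2 * (σ * (Q * Q)) * (D * (D * (D * D))) + σ * Q * (D * (D * (D * (D * D)))) + 2 * (P * Q) * (D * (D * (D * D))) + P * (D * (D * (D * (D * D)))))
    + 6 * (P * (Q * Q)) * (D * (D * D)) < σ * (P * (Q * Q)) * (d * (d * d))

-- The factor `M`, that is `P³ Q⁴ σ`, clears all denominators, since no pattern samples more than
-- three ends or four inner vertices. Each mean then becomes `Ω` times a count.
balance-arithmetic : ∀ (p q n d D σ Λ Ω eX eIn ea ee eb e₁ e₂ ed NIn Na Ne Nb N₁ N₂ Nd : ℕ) (let P = suc p ; Q = suc q) → 1 ≤ n → 1 ≤ Ω →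
  P ^ 1 * Q ^ 0 * eX ≡ Ω * n → P ^ 2 * Q ^ 2 * eIn ≡ Ω * NIn →
  P ^ 3 * Q ^ 2 * ea ≡ Ω * Na → P ^ 3 * Q ^ 2 * ee ≡ Ω * Ne → P ^ 3 * Q ^ 3 * eb ≡ Ω * Nb →
  P ^ 2 * Q ^ 3 * e₁ ≡ Ω * N₁ → P ^ 2 * Q ^ 3 * e₂ ≡ Ω * N₂ → P ^ 2 * Q ^ 4 * ed ≡ Ω * Nd →
  Na ≤ n * (D * (D * (D * D))) → Ne ≤ n * (D * (D * (D * D))) → Nb ≤ n * (D * (D * (D * (D * D)))) →
  σ * N₁ ≤ n * (D * (D * (D * D))) → σ * N₂ ≤ n * (D * (D * (D * D))) → σ * Nd ≤ n * (D * (D * (D * (D * D)))) →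
  σ * (n * (d * (d * d))) ≤ σ * NIn + 6 * (n * (D * (D * D))) →
  Balance d D σ Λ P Q →
  Λ * eX + 2 * (ea + ee + eb + e₁ + e₂ + ed) < eIn
balance-arithmetic p q n d D σ Λ Ω eX eIn ea ee eb e₁ e₂ ed NIn Na Ne Nb N₁ N₂ Nd n≥1 Ω≥1 hX hIn ha he hb h₁ h₂ hd ba be bb b₁ b₂ bd bIn numeric =
  *-cancelˡ-< M _ _ (begin-strict
    M * (Λ * eX + 2 * (ea + ee + eb + e₁ + e₂ + ed))
      ≡⟨ expand P Q σ Λ eX ea ee eb e₁ e₂ ed ⟩
    Λ * (P * P * (Q * Q * (Q * Q))) * σ * (P ^ 1 * Q ^ 0 * eX) + 2 * (σ * (Q * Q) * (P ^ 3 * Q ^ 2 * ea + P ^ 3 * Q ^ 2 * ee) + σ * Q * (P ^ 3 * Q ^ 3 * eb) + P * Q * (σ * (P ^ 2 * Q ^ 3 * e₁) + σ * (P ^ 2 * Q ^ 3 * e₂)) + P * (σ * (P ^ 2 * Q ^ 4 * ed)))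
      ≡⟨ cong₂ _+_ (cong (Λ * (P * P * (Q * Q * (Q * Q))) * σ *_) hX)
           (cong (2 *_) (cong₂ _+_ (cong₂ _+_ (cong₂ _+_ (cong (σ * (Q * Q) *_) (cong₂ _+_ ha he)) (cong (σ * Q *_) hb))
             (cong (P * Q *_) (cong₂ (λ x y → σ * x + σ * y) h₁ h₂))) (cong (λ x → P * (σ * x)) hd))) ⟩
    Λ * (P * P * (Q * Q * (Q * Q))) * σ * (Ω * n) + 2 * (σ * (Q * Q) * (Ω * Na + Ω * Ne) + σ * Q * (Ω * Nb) + P * Q * (σ * (Ω * N₁) + σ * (Ω * N₂)) + P * (σ * (Ω * Nd)))
      ≡⟨ factor P Q σ Λ n Ω Na Ne Nb N₁ N₂ Nd ⟩
    Ω * (Λ * (P * P * (Q * Q * (Q * Q))) * σ * n + 2 * (σ * (Q * Q) * (Na + Ne) + σ * Q * Nb + P * Q * (σ * N₁ + σ * N₂) + P * (σ * Nd)))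
      <⟨ *-monoʳ-< Ω ⦃ >-nonZero Ω≥1 ⦄ (+-cancelʳ-< (P * (Q * Q) * (6 * (n * (D * (D * D))))) _ _ main) ⟩
    Ω * (P * (Q * Q) * (σ * NIn)) ≡⟨ collect P Q σ Ω NIn ⟩
    P * (Q * Q) * σ * (Ω * NIn) ≡⟨ cong (P * (Q * Q) * σ *_) hIn ⟨
    P * (Q * Q) * σ * (P ^ 2 * Q ^ 2 * eIn) ≡⟨ collect′ P Q σ eIn ⟩
    M * eIn ∎)
  where
  open ≤-Reasoning
  P = suc p
  Q = suc q
  M = P * P * P * (Q * Q * (Q * Q)) * σ
  D₃ = D * (D * D)
  D₄ = D * D₃
  D₅ = D * D₄
  expand : ∀ P Q σ Λ eX ea ee eb e₁ e₂ ed → P * P * P * (Q * Q * (Q * Q)) * σ * (Λ * eX + 2 * (ea + ee + eb + e₁ + e₂ + ed)) ≡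
    Λ * (P * P * (Q * Q * (Q * Q))) * σ * (P * 1 * 1 * eX) + 2 * (σ * (Q * Q) * (P * (P * (P * 1)) * (Q * (Q * 1)) * ea + P * (P * (P * 1)) * (Q * (Q * 1)) * ee) + σ * Q * (P * (P * (P * 1)) * (Q * (Q * (Q * 1))) * eb) + P * Q * (σ * (P * (P * 1) * (Q * (Q * (Q * 1))) * e₁) + σ * (P * (P * 1) * (Q * (Q * (Q * 1))) * e₂)) + P * (σ * (P * (P * 1) * (Q * (Q * (Q * (Q * 1)))) * ed)))
  expand = solve-∀
  factor : ∀ P Q σ Λ n Ω Na Ne Nb N₁ N₂ Nd → Λ * (P * P * (Q * Q * (Q * Q))) * σ * (Ω * n) + 2 * (σ * (Q * Q) * (Ω * Na + Ω * Ne) + σ * Q * (Ω * Nb) + P * Q * (σ * (Ω * N₁) + σ * (Ω * N₂)) + P * (σ * (Ω * Nd))) ≡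
    Ω * (Λ * (P * P * (Q * Q * (Q * Q))) * σ * n + 2 * (σ * (Q * Q) * (Na + Ne) + σ * Q * Nb + P * Q * (σ * N₁ + σ * N₂) + P * (σ * Nd)))
  factor = solve-∀
  collect : ∀ P Q σ Ω N → Ω * (P * (Q * Q) * (σ * N)) ≡ P * (Q * Q) * σ * (Ω * N)
  collect = solve-∀
  collect′ : ∀ P Q σ e → P * (Q * Q) * σ * (P * (P * 1) * (Q * (Q * 1)) * e) ≡ P * P * P * (Q * Q * (Q * Q)) * σ * e
  collect′ = solve-∀
  regroup : ∀ P Q σ Λ n D₃ D₄ D₅ → Λ * (P * P * (Q * Q * (Q * Q))) * σ * n + 2 * (σ * (Q * Q) * (n * D₄ + n * D₄) + σ * Q * (n * D₅) + P * Q * (n * D₄ + n * D₄) + P * (n * D₅)) + P * (Q * Q) * (6 * (n * D₃)) ≡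
    n * (Λ * (P * P * (Q * Q * (Q * Q))) * σ + 2 * (2 * (σ * (Q * Q)) * D₄ + σ * Q * D₅ + 2 * (P * Q) * D₄ + P * D₅) + 6 * (P * (Q * Q)) * D₃)
  regroup = solve-∀
  regroup′ : ∀ P Q σ n d₃ → n * (σ * (P * (Q * Q)) * d₃) ≡ P * (Q * Q) * (σ * (n * d₃))
  regroup′ = solve-∀
  main : Λ * (P * P * (Q * Q * (Q * Q))) * σ * n + 2 * (σ * (Q * Q) * (Na + Ne) + σ * Q * Nb + P * Q * (σ * N₁ + σ * N₂) + P * (σ * Nd)) + P * (Q * Q) * (6 * (n * D₃))
    < P * (Q * Q) * (σ * NIn) + P * (Q * Q) * (6 * (n * D₃))
  main = begin-strict
    Λ * (P * P * (Q * Q * (Q * Q))) * σ * n + 2 * (σ * (Q * Q) * (Na + Ne) + σ * Q * Nb + P * Q * (σ * N₁ + σ * N₂) + P * (σ * Nd)) + P * (Q * Q) * (6 * (n * D₃))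
      ≤⟨ +-monoˡ-≤ (P * (Q * Q) * (6 * (n * D₃))) (+-monoʳ-≤ (Λ * (P * P * (Q * Q * (Q * Q))) * σ * n) (*-monoʳ-≤ 2
           (+-mono-≤ (+-mono-≤ (+-mono-≤ (*-monoʳ-≤ (σ * (Q * Q)) (+-mono-≤ ba be)) (*-monoʳ-≤ (σ * Q) bb))
             (*-monoʳ-≤ (P * Q) (+-mono-≤ b₁ b₂))) (*-monoʳ-≤ P bd)))) ⟩
    Λ * (P * P * (Q * Q * (Q * Q))) * σ * n + 2 * (σ * (Q * Q) * (n * D₄ + n * D₄) + σ * Q * (n * D₅) + P * Q * (n * D₄ + n * D₄) + P * (n * D₅)) + P * (Q * Q) * (6 * (n * D₃))
      ≡⟨ regroup P Q σ Λ n D₃ D₄ D₅ ⟩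
    n * (Λ * (P * P * (Q * Q * (Q * Q))) * σ + 2 * (2 * (σ * (Q * Q)) * D₄ + σ * Q * D₅ + 2 * (P * Q) * D₄ + P * D₅) + 6 * (P * (Q * Q)) * D₃)
      <⟨ *-monoʳ-< n ⦃ >-nonZero n≥1 ⦄ numeric ⟩
    n * (σ * (P * (Q * Q)) * (d * (d * d))) ≡⟨ regroup′ P Q σ n (d * (d * d)) ⟩
    P * (Q * Q) * (σ * (n * (d * (d * d)))) ≤⟨ *-monoʳ-≤ (P * (Q * Q)) bIn ⟩
    P * (Q * Q) * (σ * NIn + 6 * (n * D₃)) ≡⟨ *-distribˡ-+ (P * (Q * Q)) (σ * NIn) _ ⟩
    P * (Q * Q) * (σ * NIn) + P * (Q * Q) * (6 * (n * D₃)) ∎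

iff : ∀ {a b} → (a ≡ true → b ≡ true) → (b ≡ true → a ≡ true) → a ≡ b
iff {true} f g = ≡-sym (f refl)
iff {false} {false} f g = refl
iff {false} {true} f g = g refl

f₄ : ∀ {n} → (Fin n → Fin n → Fin n → Fin n → ℕ) → Vec (Fin n) 4 → ℕ
f₄ h (a ∷ b ∷ c ∷ d ∷ []) = h a b c d

f₁ : ∀ {n} → (Fin n → ℕ) → Vec (Fin n) 1 → ℕ
f₁ h (a ∷ []) = h a

f₂ : ∀ {n} → (Fin n → Fin n → ℕ) → Vec (Fin n) 2 → ℕ
f₂ h (a ∷ b ∷ []) = h a b

≤-from-pos : ∀ {m k} → m ≤ 1 → (1 ≤ m → 1 ≤ k) → m ≤ k
≤-from-pos {zero} _ _ = z≤n
≤-from-pos {suc zero} _ h = h (s≤s z≤n)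
≤-from-pos {suc (suc _)} (s≤s ()) _

*-pos : ∀ a b → 1 ≤ a * b → 1 ≤ a × 1 ≤ b
*-pos (suc a) zero h = ⊥-elim (n≮0 (subst (1 ≤_) (*-zeroʳ a) h))
*-pos (suc a) (suc b) h = s≤s z≤n , s≤s z≤n

zero-or-pos : ∀ {g} c c′ → (c ≡ 0 → c′ ≡ 0 → 1 ≤ g) → 1 ≤ g + (c + c′)
zero-or-pos zero zero h = ≤-trans (h refl refl) (m≤m+n _ _)
zero-or-pos {g} zero (suc c′) h = ≤-trans (s≤s z≤n) (m≤n+m (suc c′) g)
zero-or-pos {g} (suc c) c′ h = ≤-trans (s≤s z≤n) (m≤n+m (suc c + c′) g)

∑^-f₄-flip : ∀ {n} (h : Fin n → Fin n → Fin n → Fin n → ℕ) → ∑^ 4 (f₄ λ a b c d → h b a d c) ≡ ∑^ 4 (f₄ h)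
∑^-f₄-flip h = trans (∑-swap _) (sum-cong-≗ λ b → sum-cong-≗ λ a → ∑-swap _)

∑^-+₆ : ∀ {n} k (a b c d e f : Vec (Fin n) k → ℕ) → ∑^ k (λ vs → a vs + (b vs + (c vs + (d vs + (e vs + f vs))))) ≡
  ∑^ k a + (∑^ k b + (∑^ k c + (∑^ k d + (∑^ k e + ∑^ k f))))
∑^-+₆ k a b c d e f = trans (∑^-+ k a _) (cong (∑^ k a +_) (trans (∑^-+ k b _) (cong (∑^ k b +_) (trans (∑^-+ k c _) (cong (∑^ k c +_)
  (trans (∑^-+ k d _) (cong (∑^ k d +_) (∑^-+ k e f))))))))

≤-∑^ : ∀ {n} k (f : Vec (Fin n) k → ℕ) vs → f vs ≤ ∑^ k f
≤-∑^ zero f [] = ≤-refl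
≤-∑^ (suc k) f (v ∷ vs) = ≤-trans (≤-∑^ k (λ vs → f (v ∷ vs)) vs) (term≤∑ (λ v → ∑^ k (λ vs → f (v ∷ vs))) v)

at-most-one : ∀ {m n} (b : Fin m → Fin n → Bool) → (∀ i j i′ j′ → b i j ≡ true → b i′ j′ ≡ true → i ≡ i′ × j ≡ j′) →
  (c : Bool) → (∀ i j → b i j ≡ true → c ≡ true) → (∑[ i ] ∑[ j ] ⟦ b i j ⟧) ≤ ⟦ c ⟧
at-most-one b unique c imp with FP.any? (λ i → FP.any? λ j → b i j B.≟ true)
... | no ¬p = ≤-trans (≤-reflexive (∑-zero λ i → ∑-zero λ j → cong ⟦_⟧ (¬true⇒false λ e → ¬p (i , j , e)))) z≤n
... | yes (i₀ , j₀ , e₀) = begin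
  (∑[ i ] ∑[ j ] ⟦ b i j ⟧) ≤⟨ ∑-mono (λ i → ∑-mono λ j → ⟦⟧-le (b i j) λ e → one (trans (cong₂ eq refl (≡-sym (proj₁ (unique _ _ _ _ e₀ e)))) (eq-refl i₀)) ⊛ one (trans (cong₂ eq refl (≡-sym (proj₂ (unique _ _ _ _ e₀ e)))) (eq-refl j₀)) ⊛ ≤-refl {1}) ⟩
  (∑[ i ] ∑[ j ] ⟦ eq i₀ i ⟧ * (⟦ eq j₀ j ⟧ * 1)) ≡⟨ sum-cong-≗ (λ i → trans (≡-sym (∑-*ˡ ⟦ eq i₀ i ⟧ _)) (cong (⟦ eq i₀ i ⟧ *_) (∑-eq j₀ (λ _ → 1)))) ⟩
  (∑[ i ] ⟦ eq i₀ i ⟧ * 1) ≡⟨ ∑-eq i₀ (λ _ → 1) ⟩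
  1 ≤⟨ one (imp i₀ j₀ e₀) ⟩
  ⟦ c ⟧ ∎
  where open ≤-Reasoning

module PathCount {n : ℕ} (G : Graph n) (d D σ : ℕ) (low : ∀ v → d ≤ ∣ nb G v ∣) (high : ∀ v → ∣ nb G v ∣ ≤ D)
  (sparse : ∀ u v → σ * cross G u v ≤ D * D) (σ≤D : σ ≤ D) where
  open WalkSums G d D σ low high sparse

  private
    V = Fin n

  flipE : ∀ {u v} → Edge G u v → Edge G v u
  flipE {u} {v} e = trans (Graph.sym G v u) e

  edge? : ∀ u v → Dec (Edge G u v)
  edge? u v = adj G u v B.≟ true

  -- x y y′ x′ is an induced path.
  Path : V → V → V → V → Set
  Path y y′ x x′ = Edge G y y′ × Edge G y x × Edge G y′ x′ × x ≢ x′ × y ≢ x′ × y′ ≢ x × ¬ Edge G x x′ × ¬ Edge G x y′ × ¬ Edge G y x′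

  opaque
    path? : ∀ y y′ x x′ → Dec (Path y y′ x x′)
    path? y y′ x x′ = edge? y y′ ×-dec edge? y x ×-dec edge? y′ x′ ×-dec ¬? (x FP.≟ x′) ×-dec ¬? (y FP.≟ x′) ×-dec ¬? (y′ FP.≟ x)
      ×-dec ¬? (edge? x x′) ×-dec ¬? (edge? x y′) ×-dec ¬? (edge? y x′)

  path-flip : ∀ {y y′ x x′} → Path y y′ x x′ → Path y′ y x′ x
  path-flip (a , b , c , e₁ , e₂ , e₃ , f₁ , f₂ , f₃) =
    flipE a , c , b , (λ q → e₁ (≡-sym q)) , e₃ , e₂ , (λ q → f₁ (flipE q)) , (λ q → f₃ (flipE q)) , (λ q → f₂ (flipE q))

  walks-flat : ∀ h → walks h ≡ ∑^ 4 (f₄ λ y y′ x x′ → A y y′ * (A y x * (A y′ x′ * h y y′ x x′)))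
  walks-flat h = sum-cong-≗ λ y → sum-cong-≗ λ y′ → trans (∑-*ˡ (A y y′) _) (sum-cong-≗ λ x →
    trans (cong (A y y′ *_) (∑-*ˡ (A y x) _)) (∑-*ˡ (A y y′) _))

  -- A walk that is not an induced path has one of six defects. The three coincidences of vertices
  -- cost a factor `D` each, which `σ ≤ D` makes enough; the three chords are rare by local
  -- sparsity.
  many-paths : σ * (n * (d * (d * d))) ≤ σ * ∑^ 4 (f₄ λ y y′ x x′ → ⟦ ⌊ path? y y′ x x′ ⌋ ⟧) + 6 * (n * (D * (D * D)))
  many-paths = begin
    σ * (n * (d * (d * d))) ≤⟨ *-monoʳ-≤ σ walks-≥ ⟩
    σ * walks (λ _ _ _ _ → 1) ≤⟨ *-monoʳ-≤ σ split ⟩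
    σ * (N + (w₁ + (w₂ + (w₃ + (w₄ + (w₅ + w₆)))))) ≡⟨ lem σ N w₁ w₂ w₃ w₄ w₅ w₆ ⟩
    σ * N + (σ * w₁ + (σ * w₂ + (σ * w₃ + (σ * w₄ + (σ * w₅ + σ * w₆)))))
      ≤⟨ +-monoʳ-≤ (σ * N) (+-mono-≤ (short w₁ walks-closed) (+-mono-≤ (short w₂ walks-back) (+-mono-≤ (short w₃ walks-back′)
           (+-mono-≤ walks-square (+-mono-≤ walks-triangle walks-triangle′))))) ⟩
    σ * N + (B + (B + (B + (B + (B + B))))) ≡⟨ lem′ (σ * N) B ⟩
    σ * N + 6 * B ∎
    where
    open ≤-Reasoning
    N = ∑^ 4 (f₄ λ y y′ x x′ → ⟦ ⌊ path? y y′ x x′ ⌋ ⟧)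
    h₁ h₂ h₃ h₄ h₅ h₆ : V → V → V → V → ℕ
    h₁ y y′ x x′ = ⟦ eq x x′ ⟧
    h₂ y y′ x x′ = ⟦ eq y x′ ⟧
    h₃ y y′ x x′ = ⟦ eq y′ x ⟧
    h₄ y y′ x x′ = A x x′
    h₅ y y′ x x′ = A x y′
    h₆ y y′ x x′ = A y x′
    w₁ = walks h₁
    w₂ = walks h₂
    w₃ = walks h₃
    w₄ = walks h₄
    w₅ = walks h₅
    w₆ = walks h₆
    B = n * (D * (D * D))
    lem : ∀ s a b c d e f g → s * (a + (b + (c + (d + (e + (f + g)))))) ≡ s * a + (s * b + (s * c + (s * d + (s * e + (s * f + s * g)))))
    lem = solve-∀
    lem′ : ∀ a b → a + (b + (b + (b + (b + (b + b))))) ≡ a + 6 * b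
    lem′ = solve-∀
    short : ∀ w → w ≤ n * (D * (D * 1)) → σ * w ≤ B
    short w h = ≤-trans (*-mono-≤ σ≤D h) (≤-reflexive (lem″ D n))
      where
      lem″ : ∀ D n → D * (n * (D * (D * 1))) ≡ n * (D * (D * D))
      lem″ = solve-∀
    flat : (V → V → V → V → ℕ) → Vec V 4 → ℕ
    flat h = f₄ λ y y′ x x′ → A y y′ * (A y x * (A y′ x′ * h y y′ x x′))
    ⟦_⟧₃ : Bool → ℕ
    ⟦ b ⟧₃ = 1 * (1 * (1 * ⟦ b ⟧))
    some-true : ∀ a b c d e f → (a ≡ false → b ≡ false → c ≡ false → d ≡ false → e ≡ false → f ≡ false → ⊥) →
      1 ≤ ⟦ a ⟧₃ + (⟦ b ⟧₃ + (⟦ c ⟧₃ + (⟦ d ⟧₃ + (⟦ e ⟧₃ + ⟦ f ⟧₃))))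
    some-true true b c d e f h = s≤s z≤n
    some-true false true c d e f h = s≤s z≤n
    some-true false false true d e f h = s≤s z≤n
    some-true false false false true e f h = s≤s z≤n
    some-true false false false false true f h = s≤s z≤n
    some-true false false false false false true h = s≤s z≤n
    some-true false false false false false false h = ⊥-elim (h refl refl refl refl refl refl)
    pt : ∀ vs → flat (λ _ _ _ _ → 1) vs ≤ f₄ (λ y y′ x x′ → ⟦ ⌊ path? y y′ x x′ ⌋ ⟧) vs + (flat h₁ vs + (flat h₂ vs + (flat h₃ vs + (flat h₄ vs + (flat h₅ vs + flat h₆ vs)))))
    pt (y ∷ y′ ∷ x ∷ x′ ∷ []) with path? y y′ x x′ | true-or-false (adj G y y′) | true-or-false (adj G y x) | true-or-false (adj G y′ x′)
    ... | _ | inj₂ e | _ | _ rewrite e = z≤n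
    ... | _ | inj₁ e | inj₂ e′ | _ rewrite e | e′ = z≤n
    ... | _ | inj₁ e | inj₁ e′ | inj₂ e″ rewrite e | e′ | e″ = z≤n
    ... | yes _ | inj₁ e | inj₁ e′ | inj₁ e″ rewrite e | e′ | e″ = m≤m+n 1 _
    ... | no ¬path | inj₁ e | inj₁ e′ | inj₁ e″ with (λ rest → ¬path (e , e′ , e″ , rest))
    ... | ¬rest rewrite e | e′ | e″ = some-true (eq x x′) (eq y x′) (eq y′ x) (adj G x x′) (adj G x y′) (adj G y x′)
      λ a b c p₁ p₂ p₃ → ¬rest (eq-false⇒≢ a , eq-false⇒≢ b , eq-false⇒≢ c , (λ q → true≢false q p₁) , (λ q → true≢false q p₂) , (λ q → true≢false q p₃))
    split : walks (λ _ _ _ _ → 1) ≤ N + (w₁ + (w₂ + (w₃ + (w₄ + (w₅ + w₆)))))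
    split = begin
      walks (λ _ _ _ _ → 1) ≡⟨ walks-flat (λ _ _ _ _ → 1) ⟩
      ∑^ 4 (flat (λ _ _ _ _ → 1)) ≤⟨ ∑^-mono 4 pt ⟩
      ∑^ 4 (λ vs → f₄ (λ y y′ x x′ → ⟦ ⌊ path? y y′ x x′ ⌋ ⟧) vs + (flat h₁ vs + (flat h₂ vs + (flat h₃ vs + (flat h₄ vs + (flat h₅ vs + flat h₆ vs))))))
        ≡⟨ ∑^-+ 4 (f₄ λ y y′ x x′ → ⟦ ⌊ path? y y′ x x′ ⌋ ⟧) (λ vs → flat h₁ vs + (flat h₂ vs + (flat h₃ vs + (flat h₄ vs + (flat h₅ vs + flat h₆ vs))))) ⟩
      N + ∑^ 4 (λ vs → flat h₁ vs + (flat h₂ vs + (flat h₃ vs + (flat h₄ vs + (flat h₅ vs + flat h₆ vs)))))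
        ≡⟨ cong (N +_) (∑^-+₆ 4 (flat h₁) (flat h₂) (flat h₃) (flat h₄) (flat h₅) (flat h₆)) ⟩
      N + (∑^ 4 (flat h₁) + (∑^ 4 (flat h₂) + (∑^ 4 (flat h₃) + (∑^ 4 (flat h₄) + (∑^ 4 (flat h₅) + ∑^ 4 (flat h₆))))))
        ≡⟨ cong (N +_) (cong₂ _+_ (walks-flat h₁) (cong₂ _+_ (walks-flat h₂) (cong₂ _+_ (walks-flat h₃) (cong₂ _+_ (walks-flat h₄) (cong₂ _+_ (walks-flat h₅) (walks-flat h₆)))))) ⟨
      N + (w₁ + (w₂ + (w₃ + (w₄ + (w₅ + w₆))))) ∎

module Balanced {n : ℕ} (G : Graph n) (d D σ p q Λ : ℕ) (n≥1 : 1 ≤ n) (low : ∀ v → d ≤ ∣ nb G v ∣) (high : ∀ v → ∣ nb G v ∣ ≤ D)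
  (sparse : ∀ u v → σ * cross G u v ≤ D * D) (σ≤D : σ ≤ D)
  (numeric : Balance d D σ Λ (suc p) (suc q)) where
  open WalkSums G d D σ low high sparse
  open PathCount G d D σ low high sparse σ≤D
  open Event

  private
    V = Fin n

    μ : ∀ {k a b} → Event n k a b → ℕ
    μ E = mean E p q

    E-vertex : Event n 1 1 0
    E-vertex = record { stat = λ _ → true ; xs = λ vs → vs ; zs = λ _ → [] ; distinct = λ { (u ∷ []) _ → [] ∷ [] , [] } }

    E-path : Event n 4 2 2
    E-path = record
      { stat = λ { (y ∷ y′ ∷ x ∷ x′ ∷ []) → ⌊ path? y y′ x x′ ⌋ }
      ; xs = λ { (y ∷ y′ ∷ x ∷ x′ ∷ []) → x ∷ x′ ∷ [] } ; zs = λ { (y ∷ y′ ∷ x ∷ x′ ∷ []) → y ∷ y′ ∷ [] }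
      ; distinct = λ { (y ∷ y′ ∷ x ∷ x′ ∷ []) e → let a , _ , _ , b , _ = ⌊⌋-elim (path? y y′ x x′) e in
          ((b ∷ []) ∷ [] ∷ []) , ((edge⇒≢ G a ∷ []) ∷ [] ∷ []) } }

    -- The ways in which an induced path x y y′ x′ can conflict with further sampled vertices; u, u′ are
    -- sampled as ends and z, z′ as inner vertices.
    opaque
      end? : ∀ v y y′ x x′ u → Dec (Path y y′ x x′ × x ≢ u × x′ ≢ u × Edge G v u)
      end? v y y′ x x′ u = path? y y′ x x′ ×-dec ¬? (x FP.≟ u) ×-dec ¬? (x′ FP.≟ u) ×-dec edge? v u

      inner? : ∀ v y y′ x x′ z → Dec (Path y y′ x x′ × y ≢ z × y′ ≢ z × Edge G y z × Edge G z v)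
      inner? v y y′ x x′ z = path? y y′ x x′ ×-dec ¬? (y FP.≟ z) ×-dec ¬? (y′ FP.≟ z) ×-dec edge? y z ×-dec edge? z v

      c? : ∀ y y′ x x′ z u → Dec (Path y y′ x x′ × x ≢ u × x′ ≢ u × y ≢ z × y′ ≢ z × Edge G y z × Edge G z u)
      c? y y′ x x′ z u = path? y y′ x x′ ×-dec ¬? (x FP.≟ u) ×-dec ¬? (x′ FP.≟ u) ×-dec ¬? (y FP.≟ z) ×-dec ¬? (y′ FP.≟ z) ×-dec edge? y z ×-dec edge? z u

      g? : ∀ y y′ x x′ z z′ → Dec (Path y y′ x x′ × y ≢ z × y′ ≢ z × y ≢ z′ × y′ ≢ z′ × Edge G x z × Edge G x′ z′ × Edge G z z′)
      g? y y′ x x′ z z′ = path? y y′ x x′ ×-dec ¬? (y FP.≟ z) ×-dec ¬? (y′ FP.≟ z) ×-dec ¬? (y FP.≟ z′) ×-dec ¬? (y′ FP.≟ z′)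
        ×-dec edge? x z ×-dec edge? x′ z′ ×-dec edge? z z′

    path-distinct : ∀ {y y′ x x′} → Path y y′ x x′ → y ≢ y′ × x ≢ x′
    path-distinct (a , _ , _ , b , _) = edge⇒≢ G a , b

    E-end : (V → V → V → V → V) → Event n 5 3 2
    E-end v = record
      { stat = λ { (y ∷ y′ ∷ x ∷ x′ ∷ u ∷ []) → ⌊ end? (v y y′ x x′) y y′ x x′ u ⌋ }
      ; xs = λ { (y ∷ y′ ∷ x ∷ x′ ∷ u ∷ []) → x ∷ x′ ∷ u ∷ [] } ; zs = λ { (y ∷ y′ ∷ x ∷ x′ ∷ u ∷ []) → y ∷ y′ ∷ [] }
      ; distinct = λ { (y ∷ y′ ∷ x ∷ x′ ∷ u ∷ []) e → let P , n₁ , n₂ , _ = ⌊⌋-elim (end? (v y y′ x x′) y y′ x x′ u) e ; m₁ , m₂ = path-distinct P in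
          ((m₂ ∷ n₁ ∷ []) ∷ (n₂ ∷ []) ∷ [] ∷ []) , ((m₁ ∷ []) ∷ [] ∷ []) } }

    E-inner : (V → V → V → V → V) → Event n 5 2 3
    E-inner v = record
      { stat = λ { (y ∷ y′ ∷ x ∷ x′ ∷ z ∷ []) → ⌊ inner? (v y y′ x x′) y y′ x x′ z ⌋ }
      ; xs = λ { (y ∷ y′ ∷ x ∷ x′ ∷ z ∷ []) → x ∷ x′ ∷ [] } ; zs = λ { (y ∷ y′ ∷ x ∷ x′ ∷ z ∷ []) → y ∷ y′ ∷ z ∷ [] }
      ; distinct = λ { (y ∷ y′ ∷ x ∷ x′ ∷ z ∷ []) e → let P , n₃ , n₄ , _ = ⌊⌋-elim (inner? (v y y′ x x′) y y′ x x′ z) e ; m₁ , m₂ = path-distinct P in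
          ((m₂ ∷ []) ∷ [] ∷ []) , ((m₁ ∷ n₃ ∷ []) ∷ (n₄ ∷ []) ∷ [] ∷ []) } }

    E-a E-b : Event n 5 3 2
    E-a = E-end λ y y′ x x′ → y
    E-b = E-end λ y y′ x x′ → x

    E-d E-e : Event n 5 2 3
    E-d = E-inner λ y y′ x x′ → x
    E-e = E-inner λ y y′ x x′ → x′

    E-c : Event n 6 3 3
    E-c = record
      { stat = λ { (y ∷ y′ ∷ x ∷ x′ ∷ z ∷ u ∷ []) → ⌊ c? y y′ x x′ z u ⌋ }
      ; xs = λ { (y ∷ y′ ∷ x ∷ x′ ∷ z ∷ u ∷ []) → x ∷ x′ ∷ u ∷ [] } ; zs = λ { (y ∷ y′ ∷ x ∷ x′ ∷ z ∷ u ∷ []) → y ∷ y′ ∷ z ∷ [] }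
      ; distinct = λ { (y ∷ y′ ∷ x ∷ x′ ∷ z ∷ u ∷ []) e → let P , n₁ , n₂ , n₃ , n₄ , _ = ⌊⌋-elim (c? y y′ x x′ z u) e ; m₁ , m₂ = path-distinct P in
          ((m₂ ∷ n₁ ∷ []) ∷ (n₂ ∷ []) ∷ [] ∷ []) , ((m₁ ∷ n₃ ∷ []) ∷ (n₄ ∷ []) ∷ [] ∷ []) } }

    E-g : Event n 6 2 4
    E-g = record
      { stat = λ { (y ∷ y′ ∷ x ∷ x′ ∷ z ∷ z′ ∷ []) → ⌊ g? y y′ x x′ z z′ ⌋ }
      ; xs = λ { (y ∷ y′ ∷ x ∷ x′ ∷ z ∷ z′ ∷ []) → x ∷ x′ ∷ [] } ; zs = λ { (y ∷ y′ ∷ x ∷ x′ ∷ z ∷ z′ ∷ []) → y ∷ y′ ∷ z ∷ z′ ∷ [] }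
      ; distinct = λ { (y ∷ y′ ∷ x ∷ x′ ∷ z ∷ z′ ∷ []) e → let P , n₁ , n₂ , n₃ , n₄ , _ , _ , zz = ⌊⌋-elim (g? y y′ x x′ z z′) e ; m₁ , m₂ = path-distinct P in
          ((m₂ ∷ []) ∷ [] ∷ []) , ((m₁ ∷ n₁ ∷ n₃ ∷ []) ∷ (n₂ ∷ n₄ ∷ []) ∷ (edge⇒≢ G zz ∷ []) ∷ [] ∷ []) } }

    count-end : ∀ v → count (E-end v) ≤ n * (D * (D * (D * D)))
    count-end v = ≤-trans (∑^⇒walks 1 (λ vs → ⟦ stat (E-end v) vs ⟧) (λ y y′ x x′ → f₁ λ u → A (v y y′ x x′) u) (λ { y y′ x x′ (u ∷ []) → ⟦⟧-le _ λ e →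
      let (a , b , c , _) , _ , _ , q = ⌊⌋-elim (end? (v y y′ x x′) y y′ x x′ u) e in one a ⊛ one b ⊛ one c ⊛ one q }))
      (walks-const _ D λ y y′ x x′ → high (v y y′ x x′))

    count-c : count E-c ≤ n * (D * (D * (D * (D * D))))
    count-c = ≤-trans (∑^⇒walks 2 (λ vs → ⟦ stat E-c vs ⟧) (λ y y′ x x′ → f₂ λ z u → A y z * A z u) (λ { y y′ x x′ (z ∷ u ∷ []) → ⟦⟧-le _ λ e →
      let (a , b , c , _) , _ , _ , _ , _ , q , q′ = ⌊⌋-elim (c? y y′ x x′ z u) e in one a ⊛ one b ⊛ one c ⊛ one q ⊛ one q′ }))
      (walks-const _ (D * D) λ y y′ x x′ → ≤-trans (≤-reflexive (sum-cong-≗ λ z → ≡-sym (∑-*ˡ (A y z) _))) (nbr-≤ y D high))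

    count-inner : ∀ v {B} → σ * walks (λ y y′ x x′ → ∑[ z ] A y z * A z (v y y′ x x′)) ≤ B → σ * count (E-inner v) ≤ B
    count-inner v = ≤-trans (*-monoʳ-≤ σ (∑^⇒walks 1 (λ vs → ⟦ stat (E-inner v) vs ⟧) (λ y y′ x x′ → f₁ λ z → A y z * A z (v y y′ x x′)) (λ { y y′ x x′ (z ∷ []) → ⟦⟧-le _ λ e →
      let (a , b , c , _) , _ , _ , q , q′ = ⌊⌋-elim (inner? (v y y′ x x′) y y′ x x′ z) e in one a ⊛ one b ⊛ one c ⊛ one q ⊛ one q′ })))

    count-g : σ * count E-g ≤ n * (D * (D * (D * (D * D))))
    count-g = ≤-trans (*-monoʳ-≤ σ (∑^⇒walks 2 (λ vs → ⟦ stat E-g vs ⟧) (λ y y′ x x′ → f₂ λ z z′ → A x z * (A x′ z′ * A z z′)) (λ { y y′ x x′ (z ∷ z′ ∷ []) → ⟦⟧-le _ λ e →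
      let (a , b , c , _) , _ , _ , _ , _ , q , q′ , q″ = ⌊⌋-elim (g? y y′ x x′ z z′) e in one a ⊛ one b ⊛ one c ⊛ one q ⊛ one q′ ⊛ one q″ })))
      (σ-walks-const _ (D * D) λ y y′ x x′ → ≤-trans (*-monoʳ-≤ σ (≤-reflexive (sum-cong-≗ λ z → ≡-sym (∑-*ˡ (A x z) _)))) (sparse x x′))

    extend : ∀ {k a b} → Event n (4 + k) a b → Sub n → Sub n → V → V → V → V → ℕ
    extend {k} E X Z y y′ x x′ = ∑^ k λ vs → term E X Z (y ∷ y′ ∷ x ∷ x′ ∷ vs)

    all-conflicts : Sub n → Sub n → ℕ
    all-conflicts X Z = ∑^ 5 (term E-a X Z) + (∑^ 5 (term E-b X Z) + (∑^ 6 (term E-c X Z) + (∑^ 5 (term E-d X Z) + (∑^ 5 (term E-e X Z) + ∑^ 6 (term E-g X Z)))))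

    opaque
      conflicts : Sub n → Sub n → Vec V 4 → ℕ
      conflicts X Z (y ∷ y′ ∷ x ∷ x′ ∷ []) = extend E-a X Z y y′ x x′ + (extend E-b X Z y y′ x x′ + (extend E-c X Z y y′ x x′ +
        (extend E-d X Z y y′ x x′ + (extend E-e X Z y y′ x x′ + extend E-g X Z y y′ x x′))))

      ∑-conflicts : ∀ X Z → ∑^ 4 (conflicts X Z) ≡ all-conflicts X Z
      ∑-conflicts X Z = ∑^-+₆ 4 (f₄ (extend E-a X Z)) (f₄ (extend E-b X Z)) (f₄ (extend E-c X Z)) (f₄ (extend E-d X Z)) (f₄ (extend E-e X Z)) (f₄ (extend E-g X Z))

    six : ∀ a b c d e f → a + (b + (c + (d + (e + f)))) ≡ a + b + c + d + e + f
    six = solve-∀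

    mean-gap : 𝔼₂ p q n (λ X Z → Λ * ∑^ 1 (term E-vertex X Z) + 2 * all-conflicts X Z) < 𝔼₂ p q n (λ X Z → ∑^ 4 (term E-path X Z))
    mean-gap = subst (_< μ E-path) (≡-sym expand)
      (balance-arithmetic p q n d D σ Λ (suc p ^ n * suc q ^ n) _ _ _ _ _ _ _ _ _ _ _ _ _ _ _ n≥1
        (*-mono-≤ (m^n>0 (suc p) n) (m^n>0 (suc q) n))
        (trans (mean-count E-vertex p q) (cong (suc p ^ n * suc q ^ n *_) card-full)) (mean-count E-path p q) (mean-count E-a p q) (mean-count E-b p q) (mean-count E-c p q)
        (mean-count E-d p q) (mean-count E-e p q) (mean-count E-g p q)
        (count-end _) (count-end _) count-c (count-inner _ walks-ext-triangle) (count-inner _ walks-ext-square) count-g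
        many-paths numeric)
      where
      expand : 𝔼₂ p q n (λ X Z → Λ * ∑^ 1 (term E-vertex X Z) + 2 * all-conflicts X Z) ≡
        Λ * μ E-vertex + 2 * (μ E-a + μ E-b + μ E-c + μ E-d + μ E-e + μ E-g)
      expand = trans (𝔼₂-+ p q n (λ X Z → Λ * ∑^ 1 (term E-vertex X Z)) (λ X Z → 2 * all-conflicts X Z)) (cong₂ _+_
        (𝔼₂-* p q n Λ λ X Z → ∑^ 1 (term E-vertex X Z))
        (trans (𝔼₂-* p q n 2 all-conflicts) (cong (2 *_) (trans
          (trans (𝔼₂-+ p q n (λ X Z → ∑^ 5 (term E-a X Z)) _) (cong (μ E-a +_)
            (trans (𝔼₂-+ p q n (λ X Z → ∑^ 5 (term E-b X Z)) _) (cong (μ E-b +_)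
              (trans (𝔼₂-+ p q n (λ X Z → ∑^ 6 (term E-c X Z)) _) (cong (μ E-c +_)
                (trans (𝔼₂-+ p q n (λ X Z → ∑^ 5 (term E-d X Z)) _) (cong (μ E-d +_)
                  (𝔼₂-+ p q n (λ X Z → ∑^ 5 (term E-e X Z)) λ X Z → ∑^ 6 (term E-g X Z))))))))))
          (six (μ E-a) (μ E-b) (μ E-c) (μ E-d) (μ E-e) (μ E-g))))))

  module Sample (X Z : Sub n) where
    -- A conflict is described from the side of `x` and `y`, so the reversed path is tested as well;
    -- this is the factor 2 before `all-conflicts`.
    Good : V → V → V → V → Set
    Good y y′ x x′ = Path y y′ x x′ × (X x ≡ true × X x′ ≡ true × Z y ≡ true × Z y′ ≡ true) ×
      conflicts X Z (y ∷ y′ ∷ x ∷ x′ ∷ []) ≡ 0 × conflicts X Z (y′ ∷ y ∷ x′ ∷ x ∷ []) ≡ 0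

    opaque
      good? : ∀ y y′ x x′ → Dec (Good y y′ x x′)
      good? y y′ x x′ = path? y y′ x x′ ×-dec ((X x B.≟ true) ×-dec (X x′ B.≟ true) ×-dec (Z y B.≟ true) ×-dec (Z y′ B.≟ true)) ×-dec
        (conflicts X Z (y ∷ y′ ∷ x ∷ x′ ∷ []) ≟ 0) ×-dec (conflicts X Z (y′ ∷ y ∷ x′ ∷ x ∷ []) ≟ 0)

    good-flip : ∀ {y y′ x x′} → Good y y′ x x′ → Good y′ y x′ x
    good-flip (P , (a , b , c , d) , e , f) = path-flip P , (b , a , d , c) , f , e

    good-end : ∀ {y y′ x x′} → Good y y′ x x′ → X x ≡ true
    good-end (_ , (p , _) , _) = p

    good-inner : ∀ {y y′ x x′} → Good y y′ x x′ → Z y ≡ true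
    good-inner (_ , (_ , _ , p , _) , _) = p

    private
      component : ∀ {y y′ x x′} → Good y y′ x x′ → ∀ {m} → m ≤ conflicts X Z (y ∷ y′ ∷ x ∷ x′ ∷ []) → 1 ≤ m → ⊥
      component (_ , _ , e , _) h h′ = n≮0 (subst (1 ≤_) e (≤-trans h′ h))

      within : ∀ a b c d e f → (let s = a + (b + (c + (d + (e + f))))) → a ≤ s × b ≤ s × c ≤ s × d ≤ s × e ≤ s × f ≤ s
      within a b c d e f = m≤m+n a _ , up a (m≤m+n b _) , up a (up b (m≤m+n c _)) , up a (up b (up c (m≤m+n d _))) ,
        up a (up b (up c (up d (m≤m+n e f)))) , up a (up b (up c (up d (m≤n+m f e))))
        where
        up : ∀ {m k} a → m ≤ k → m ≤ a + k
        up {m} {k} a h = ≤-trans h (m≤n+m k a)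

      opaque
        unfolding conflicts

        parts : ∀ y y′ x x′ → (let m = conflicts X Z (y ∷ y′ ∷ x ∷ x′ ∷ [])) →
          extend E-a X Z y y′ x x′ ≤ m × extend E-b X Z y y′ x x′ ≤ m × extend E-c X Z y y′ x x′ ≤ m ×
          extend E-d X Z y y′ x x′ ≤ m × extend E-e X Z y y′ x x′ ≤ m × extend E-g X Z y y′ x x′ ≤ m
        parts y y′ x x′ = within (extend E-a X Z y y′ x x′) (extend E-b X Z y y′ x x′) (extend E-c X Z y y′ x x′)
          (extend E-d X Z y y′ x x′) (extend E-e X Z y y′ x x′) (extend E-g X Z y y′ x x′)

    no-a : ∀ {y y′ x x′} → Good y y′ x x′ → ∀ u → x ≢ u → x′ ≢ u → Edge G y u → X u ≡ true → ⊥
    no-a {y} {y′} {x} {x′} g@(P , (p₁ , p₂ , p₃ , p₄) , _) u n₁ n₂ e p = component g (≤-trans (≤-∑^ 1 (λ vs → term E-a X Z (y ∷ y′ ∷ x ∷ x′ ∷ vs)) (u ∷ [])) (proj₁ (parts y y′ x x′)))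
      (one (⌊⌋-intro (end? y y y′ x x′ u) (P , n₁ , n₂ , e)) ⊛ (one p₁ ⊛ one p₂ ⊛ one p ⊛ ≤-refl) ⊛ (one p₃ ⊛ one p₄ ⊛ ≤-refl))

    no-b : ∀ {y y′ x x′} → Good y y′ x x′ → ∀ u → x ≢ u → x′ ≢ u → Edge G x u → X u ≡ true → ⊥
    no-b {y} {y′} {x} {x′} g@(P , (p₁ , p₂ , p₃ , p₄) , _) u n₁ n₂ e p = component g (≤-trans (≤-∑^ 1 (λ vs → term E-b X Z (y ∷ y′ ∷ x ∷ x′ ∷ vs)) (u ∷ [])) (proj₁ (proj₂ (parts y y′ x x′))))
      (one (⌊⌋-intro (end? x y y′ x x′ u) (P , n₁ , n₂ , e)) ⊛ (one p₁ ⊛ one p₂ ⊛ one p ⊛ ≤-refl) ⊛ (one p₃ ⊛ one p₄ ⊛ ≤-refl))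

    no-c : ∀ {y y′ x x′} → Good y y′ x x′ → ∀ z u → x ≢ u → x′ ≢ u → y ≢ z → y′ ≢ z → Edge G y z → Edge G z u → Z z ≡ true → X u ≡ true → ⊥
    no-c {y} {y′} {x} {x′} g@(P , (p₁ , p₂ , p₃ , p₄) , _) z u n₁ n₂ n₃ n₄ e e′ p p′ = component g (≤-trans (≤-∑^ 2 (λ vs → term E-c X Z (y ∷ y′ ∷ x ∷ x′ ∷ vs)) (z ∷ u ∷ [])) (proj₁ (proj₂ (proj₂ (parts y y′ x x′)))))
      (one (⌊⌋-intro (c? y y′ x x′ z u) (P , n₁ , n₂ , n₃ , n₄ , e , e′)) ⊛ (one p₁ ⊛ one p₂ ⊛ one p′ ⊛ ≤-refl) ⊛ (one p₃ ⊛ one p₄ ⊛ one p ⊛ ≤-refl))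

    no-d : ∀ {y y′ x x′} → Good y y′ x x′ → ∀ z → y ≢ z → y′ ≢ z → Edge G y z → Edge G z x → Z z ≡ true → ⊥
    no-d {y} {y′} {x} {x′} g@(P , (p₁ , p₂ , p₃ , p₄) , _) z n₃ n₄ e e′ p = component g (≤-trans (≤-∑^ 1 (λ vs → term E-d X Z (y ∷ y′ ∷ x ∷ x′ ∷ vs)) (z ∷ [])) (proj₁ (proj₂ (proj₂ (proj₂ (parts y y′ x x′))))))
      (one (⌊⌋-intro (inner? x y y′ x x′ z) (P , n₃ , n₄ , e , e′)) ⊛ (one p₁ ⊛ one p₂ ⊛ ≤-refl) ⊛ (one p₃ ⊛ one p₄ ⊛ one p ⊛ ≤-refl))

    no-e : ∀ {y y′ x x′} → Good y y′ x x′ → ∀ z → y ≢ z → y′ ≢ z → Edge G y z → Edge G z x′ → Z z ≡ true → ⊥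
    no-e {y} {y′} {x} {x′} g@(P , (p₁ , p₂ , p₃ , p₄) , _) z n₃ n₄ e e′ p = component g (≤-trans (≤-∑^ 1 (λ vs → term E-e X Z (y ∷ y′ ∷ x ∷ x′ ∷ vs)) (z ∷ [])) (proj₁ (proj₂ (proj₂ (proj₂ (proj₂ (parts y y′ x x′)))))))
      (one (⌊⌋-intro (inner? x′ y y′ x x′ z) (P , n₃ , n₄ , e , e′)) ⊛ (one p₁ ⊛ one p₂ ⊛ ≤-refl) ⊛ (one p₃ ⊛ one p₄ ⊛ one p ⊛ ≤-refl))

    no-g : ∀ {y y′ x x′} → Good y y′ x x′ → ∀ z z′ → y ≢ z → y′ ≢ z → y ≢ z′ → y′ ≢ z′ → Edge G x z → Edge G x′ z′ → Edge G z z′ → Z z ≡ true → Z z′ ≡ true → ⊥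
    no-g {y} {y′} {x} {x′} g@(P , (p₁ , p₂ , p₃ , p₄) , _) z z′ n₁ n₂ n₃ n₄ e e′ e″ p p′ = component g (≤-trans (≤-∑^ 2 (λ vs → term E-g X Z (y ∷ y′ ∷ x ∷ x′ ∷ vs)) (z ∷ z′ ∷ [])) (proj₂ (proj₂ (proj₂ (proj₂ (proj₂ (parts y y′ x x′)))))))
      (one (⌊⌋-intro (g? y y′ x x′ z z′) (P , n₁ , n₂ , n₃ , n₄ , e , e′ , e″)) ⊛ (one p₁ ⊛ one p₂ ⊛ ≤-refl) ⊛ (one p₃ ⊛ one p₄ ⊛ one p ⊛ one p′ ⊛ ≤-refl))

    count-good : ∑^ 4 (term E-path X Z) ≤ ∑^ 4 (f₄ λ y y′ x x′ → ⟦ ⌊ good? y y′ x x′ ⌋ ⟧) + 2 * all-conflicts X Z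
    count-good = begin
      ∑^ 4 (term E-path X Z) ≤⟨ ∑^-mono 4 pt ⟩
      ∑^ 4 (λ vs → good vs + (conflicts X Z vs + rev vs)) ≡⟨ trans (∑^-+ 4 good (λ vs → conflicts X Z vs + rev vs)) (cong (∑^ 4 good +_) (∑^-+ 4 (conflicts X Z) rev)) ⟩
      ∑^ 4 good + (∑^ 4 (conflicts X Z) + ∑^ 4 rev) ≡⟨ cong (∑^ 4 good +_) (cong₂ _+_ (∑-conflicts X Z)
        (trans (∑^-f₄-flip (λ y y′ x x′ → conflicts X Z (y ∷ y′ ∷ x ∷ x′ ∷ []))) (∑-conflicts X Z))) ⟩
      ∑^ 4 good + (all-conflicts X Z + all-conflicts X Z) ≡⟨ cong (∑^ 4 good +_) (cong (all-conflicts X Z +_) (≡-sym (+-identityʳ _))) ⟩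
      ∑^ 4 good + 2 * all-conflicts X Z ∎
      where
      open ≤-Reasoning
      good rev : Vec V 4 → ℕ
      good = f₄ λ y y′ x x′ → ⟦ ⌊ good? y y′ x x′ ⌋ ⟧
      rev = f₄ λ y y′ x x′ → conflicts X Z (y′ ∷ y ∷ x′ ∷ x ∷ [])
      pt : ∀ vs → term E-path X Z vs ≤ good vs + (conflicts X Z vs + rev vs)
      pt (y ∷ y′ ∷ x ∷ x′ ∷ []) = ≤-from-pos (small (⟦⟧≤1 ⌊ path? y y′ x x′ ⌋) (small (small (⟦⟧≤1 (X x)) (small (⟦⟧≤1 (X x′)) ≤-refl)) (small (⟦⟧≤1 (Z y)) (small (⟦⟧≤1 (Z y′)) ≤-refl)))) λ h →
        let P , h₁ = ⟦⟧-pos {⌊ path? y y′ x x′ ⌋} _ h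
            hX , hZ = *-pos _ _ h₁
            p₁ , h₂ = ⟦⟧-pos {X x} _ hX
            p₂ , _ = ⟦⟧-pos {X x′} 1 h₂
            p₃ , h₃ = ⟦⟧-pos {Z y} _ hZ
            p₄ , _ = ⟦⟧-pos {Z y′} 1 h₃
        in zero-or-pos (conflicts X Z (y ∷ y′ ∷ x ∷ x′ ∷ [])) (conflicts X Z (y′ ∷ y ∷ x′ ∷ x ∷ [])) λ e e′ →
          one (⌊⌋-intro (good? y y′ x x′) (⌊⌋-elim (path? y y′ x x′) P , (p₁ , p₂ , p₃ , p₄) , e , e′))
        where
        small : ∀ {a b} → a ≤ 1 → b ≤ 1 → a * b ≤ 1
        small = *-mono-≤

    joined? : ∀ x x′ → Dec (∃ λ y → ∃ λ y′ → Good y y′ x x′)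
    joined? x x′ = FP.any? λ y → FP.any? λ y′ → good? y y′ x x′

    F : Graph n
    F = record
      { adj = λ x x′ → ⌊ joined? x x′ ⌋
      ; sym = λ x x′ → iff (flip-joined x x′) (flip-joined x′ x)
      ; irrefl = λ x → ⌊⌋-false (joined? x x) λ { (_ , _ , (_ , _ , _ , ne , _) , _) → ne refl } }
      where
      flip-joined : ∀ x x′ → ⌊ joined? x x′ ⌋ ≡ true → ⌊ joined? x′ x ⌋ ≡ true
      flip-joined x x′ e with y , y′ , g ← ⌊⌋-elim (joined? x x′) e = ⌊⌋-intro (joined? x′ x) (y′ , y , good-flip g)

    F-good : ∀ {x x′} → Edge F x x′ → ∃ λ y → ∃ λ y′ → Good y y′ x x′
    F-good {x} {x′} e = ⌊⌋-elim (joined? x x′) e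

    F⊆X : ∀ {x x′} → Edge F x x′ → X x ≡ true
    F⊆X e = good-end (proj₂ (proj₂ (F-good e)))

    -- A second path with the same ends is itself a conflict: of type `e`, possibly for the reversed
    -- path, if one inner vertex is shared in place, and of type `g` otherwise. Hence each edge of
    -- `F` is counted once per direction.
    good-unique : ∀ {x x′ y y′ z z′} → Good y y′ x x′ → Good z z′ x x′ → y ≡ z × y′ ≡ z′
    good-unique {x} {x′} {y} {y′} {z} {z′} g@((_ , yx , y′x′ , _ , _ , _ , _ , xy′ , yx′) , _) h@((zz′ , zx , z′x′ , _) , _)
      with y FP.≟ z | y′ FP.≟ z′
    ... | yes e | yes e′ = e , e′
    ... | yes refl | no ne = ⊥-elim (no-e g z′ (edge⇒≢ G zz′) ne zz′ z′x′ (good-inner (good-flip h)))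
    ... | no ne | yes refl = ⊥-elim (no-e (good-flip g) z (λ e → edge⇒≢ G zz′ (≡-sym e)) ne (flipE zz′) zx (good-inner h))
    ... | no ne | no ne′ = ⊥-elim (no-g g z z′ ne (λ { refl → xy′ (flipE zx) }) (λ { refl → yx′ z′x′ }) ne′
      (flipE zx) (flipE z′x′) zz′ (good-inner h) (good-inner (good-flip h)))

    count-F : ∑^ 4 (f₄ λ y y′ x x′ → ⟦ ⌊ good? y y′ x x′ ⌋ ⟧) ≤ (∑[ x ] ∣ nb F x ∣)
    count-F = begin
      (∑[ y ] ∑[ y′ ] ∑[ x ] ∑[ x′ ] ⟦ ⌊ good? y y′ x x′ ⌋ ⟧) ≡⟨ sum-cong-≗ (λ y → ∑-swap λ y′ x → ∑[ x′ ] ⟦ ⌊ good? y y′ x x′ ⌋ ⟧) ⟩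
      (∑[ y ] ∑[ x ] ∑[ y′ ] ∑[ x′ ] ⟦ ⌊ good? y y′ x x′ ⌋ ⟧) ≡⟨ ∑-swap (λ y x → ∑[ y′ ] ∑[ x′ ] ⟦ ⌊ good? y y′ x x′ ⌋ ⟧) ⟩
      (∑[ x ] ∑[ y ] ∑[ y′ ] ∑[ x′ ] ⟦ ⌊ good? y y′ x x′ ⌋ ⟧) ≡⟨ sum-cong-≗ (λ x → sum-cong-≗ λ y → ∑-swap λ y′ x′ → ⟦ ⌊ good? y y′ x x′ ⌋ ⟧) ⟩
      (∑[ x ] ∑[ y ] ∑[ x′ ] ∑[ y′ ] ⟦ ⌊ good? y y′ x x′ ⌋ ⟧) ≡⟨ sum-cong-≗ (λ x → ∑-swap λ y x′ → ∑[ y′ ] ⟦ ⌊ good? y y′ x x′ ⌋ ⟧) ⟩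
      (∑[ x ] ∑[ x′ ] ∑[ y ] ∑[ y′ ] ⟦ ⌊ good? y y′ x x′ ⌋ ⟧)
        ≤⟨ ∑-mono (λ x → ∑-mono λ x′ → at-most-one (λ y y′ → ⌊ good? y y′ x x′ ⌋)
             (λ y y′ z z′ e e′ → good-unique (⌊⌋-elim (good? y y′ x x′) e) (⌊⌋-elim (good? z z′ x x′) e′)) ⌊ joined? x x′ ⌋
             λ y y′ e → ⌊⌋-intro (joined? x x′) (y , y′ , ⌊⌋-elim (good? y y′ x x′) e)) ⟩
      (∑[ x ] ∣ nb F x ∣) ∎
      where open ≤-Reasoning

    data Connector (x x′ v : V) : Set where
      near : ∀ {v′} → Good v v′ x x′ → Connector x x′ v
      far : ∀ {v′} → Good v′ v x x′ → Connector x x′ v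

    connector-flip : ∀ {x x′ v} → Connector x x′ v → Connector x′ x v
    connector-flip (near g) = far (good-flip g)
    connector-flip (far g) = near (good-flip g)

    indep : ∀ {x x′ u u′} → Edge F x x′ → Edge F u u′ → adj G x u ≡ false
    indep {x} {x′} {u} e e′ with y , y′ , g@((_ , _ , _ , _ , _ , _ , xx′ , _) , _) ← F-good e = ¬true⇒false λ q →
      no-b g u (edge⇒≢ G q) (λ { refl → xx′ q }) q (F⊆X e′)

    near-avoids : ∀ {x x′ y y′ u} → Good y y′ x x′ → X u ≡ true → u ≢ y
    near-avoids {x} {x′} {y} g@((_ , yx , _ , _ , yx′ , _) , _) u∈ refl = no-b g y (λ e → edge⇒≢ G yx (≡-sym e)) (λ e → yx′ (≡-sym e)) (flipE yx) u∈

    touches : ∀ {x x′ y y′ u} → Good y y′ x x′ → X u ≡ true → Edge G u y → u ≡ x ⊎ u ≡ x′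
    touches {x} {x′} {y} {y′} {u} g u∈ e with u FP.≟ x | u FP.≟ x′
    ... | yes p | _ = inj₁ p
    ... | no _ | yes p = inj₂ p
    ... | no n₁ | no n₂ = ⊥-elim (no-a g u (λ q → n₁ (≡-sym q)) (λ q → n₂ (≡-sym q)) (flipE e) u∈)

    touches-far : ∀ {x x′ y y′ u} → Good y′ y x x′ → X u ≡ true → Edge G u y → u ≡ x ⊎ u ≡ x′
    touches-far g u∈ e = Sum.swap (touches (good-flip g) u∈ e)

    -- Every connector vertex has a sampled end next to it. Conflicts `d`, `e` and `c` cover the
    -- cases that this end is `x`, `x′` or foreign, so `y` sees no connector vertex but `y′`.
    sees : ∀ {x x′ y y′ s u} → Good y y′ x x′ → Edge G y s → Z s ≡ true → Edge G s u → X u ≡ true → s ≡ y′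
    sees {x} {x′} {y} {y′} {s} {u} g e s∈ e′ u∈ with s FP.≟ y′ | u FP.≟ x | u FP.≟ x′
    ... | yes p | _ | _ = p
    ... | no ne | yes refl | _ = ⊥-elim (no-d g s (edge⇒≢ G e) (λ q → ne (≡-sym q)) e e′ s∈)
    ... | no ne | no _ | yes refl = ⊥-elim (no-e g s (edge⇒≢ G e) (λ q → ne (≡-sym q)) e e′ s∈)
    ... | no ne | no n₁ | no n₂ = ⊥-elim (no-c g s u (λ q → n₁ (≡-sym q)) (λ q → n₂ (≡-sym q)) (edge⇒≢ G e) (λ q → ne (≡-sym q)) e e′ s∈ u∈)

    separate : ∀ {x x′ y y′ u u′ v} → Good y y′ x x′ → Connector u u′ v → y ≡ v ⊎ Edge G y v → u ≡ x ⊎ u ≡ x′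
    separate g (near h@((_ , vu , _) , _)) (inj₁ refl) = touches g (good-end h) (flipE vu)
    separate g (far h@((sv , su , _) , _)) (inj₁ refl) with refl ← sees g (flipE sv) (good-inner h) su (good-end h) =
      touches-far g (good-end h) (flipE su)
    separate g (near h@((_ , vu , _) , _)) (inj₂ e) with refl ← sees g e (good-inner h) vu (good-end h) =
      touches-far g (good-end h) (flipE vu)
    separate g (far h@((sv , su , vu′ , _) , _)) (inj₂ e) with refl ← sees g e (good-inner (good-flip h)) vu′ (good-end (good-flip h))
      with refl ← sees (good-flip g) (flipE sv) (good-inner h) su (good-end h) = touches g (good-end h) (flipE su)

    frame : Frame G F
    frame = record
      { conn = Connector ; indep = indep ; conn-sym = connector-flip
      ; conn-avoids = λ { (near g) e → near-avoids g (F⊆X e) ; (far g) e → near-avoids (good-flip g) (F⊆X e) }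
      ; conn-touches = λ { (near g) e q → touches g (F⊆X e) q ; (far g) e q → touches-far g (F⊆X e) q }
      ; conn-separate = λ { (near g) c q → separate g c q ; (far g) c q → Sum.swap (separate (good-flip g) c q) }
      ; linked = λ e → let y , y′ , g = F-good e ; (yy′ , yx , y′x′ , _) , _ = g in
          y , y′ , flipE yx , step (near g) yy′ (here (far g)) , y′x′ }

  private
    from-sample : ∀ X Z → Λ * ∑^ 1 (term E-vertex X Z) + 2 * all-conflicts X Z < ∑^ 4 (term E-path X Z) → DenseFrame G Λ
    from-sample X Z h = F , X , frame , F⊆X , (begin-strict
      Λ * ∣ X ∣ ≡⟨ cong (Λ *_) (sum-cong-≗ λ v → pt ⟦ X v ⟧) ⟩
      Λ * ∑^ 1 (term E-vertex X Z) <⟨ +-cancelʳ-< (2 * all-conflicts X Z) _ _ (<-≤-trans h count-good) ⟩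
      ∑^ 4 (f₄ λ y y′ x x′ → ⟦ ⌊ good? y y′ x x′ ⌋ ⟧) ≤⟨ count-F ⟩
      (∑[ u ] ∣ nb F u ∣) ∎)
      where
      open ≤-Reasoning
      open Sample X Z
      pt : ∀ x → x ≡ 1 * (x * 1 * 1)
      pt = solve-∀

  dense-frame : DenseFrame G Λ
  dense-frame = from-sample (proj₁ s) (proj₁ (proj₂ s)) (proj₂ (proj₂ s))
    where
    s = 𝔼₂-<⇒∃ p q n (λ X Z → Λ * ∑^ 1 (term E-vertex X Z) + 2 * all-conflicts X Z) (λ X Z → ∑^ 4 (term E-path X Z)) mean-gap

-- The unbalanced case

module Prune {n : ℕ} (G : Graph n) (A : Sub n) (s Λ : ℕ) where
  -- Only the excess of a degree over `s` counts, so deleting `b` is felt only at its neighbours of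
  -- degree above `s`, the vertices of `rich B b`.
  surplus : Sub n → ℕ
  surplus B = ∑[ a ] ⟦ A a ⟧ * (deg G B a ∸ s)

  rich : Sub n → Fin n → Sub n
  rich B b a = A a ∧ (adj G b a ∧ ⌊ s <? deg G B a ⌋)

  surplus-∖ : ∀ B {b} → B b ≡ true → surplus B ≤ surplus (B ∖ b) + ∣ rich B b ∣
  surplus-∖ B {b} b∈ = ≤-trans (∑-mono pt) (≤-reflexive (∑-distrib-+ _ _))
    where
    step-∸ : ∀ m s → suc m ∸ s ≤ (m ∸ s) + ⟦ ⌊ s <? suc m ⌋ ⟧
    step-∸ m s with s <? suc m
    ... | yes s≤m = ≤-reflexive (trans (+-∸-assoc 1 (s≤s⁻¹ s≤m)) (+-comm 1 (m ∸ s)))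
    ... | no s≰m = ≤-trans (≤-reflexive (m≤n⇒m∸n≡0 (≮⇒≥ s≰m))) z≤n
    pt : ∀ a → ⟦ A a ⟧ * (deg G B a ∸ s) ≤ ⟦ A a ⟧ * (deg G (B ∖ b) a ∸ s) + ⟦ rich B b a ⟧
    pt a with A a
    ... | false = z≤n
    ... | true rewrite deg-split G B b∈ a | Graph.sym G b a with adj G a b
    ... | false = ≤-reflexive (≡-sym (+-identityʳ _))
    ... | true = ≤-trans (≤-reflexive (+-identityʳ _)) (≤-trans (step-∸ (deg G (B ∖ b) a) s)
      (≤-reflexive (cong (_+ ⟦ ⌊ s <? suc (deg G (B ∖ b) a) ⌋ ⟧) (≡-sym (+-identityʳ _)))))

  -- Deleting a vertex with at most `Λ` rich neighbours lowers the left side of the hypothesis by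
  -- `Λ` and the surplus by no more. The empty set has no surplus, so the deletions stop before it.
  prune : ∀ B → Λ * ∣ B ∣ < surplus B →
    Σ (Sub n) λ B₁ → (∀ {v} → B₁ v ≡ true → B v ≡ true) × 1 ≤ ∣ B₁ ∣ × (∀ b → B₁ b ≡ true → Λ < ∣ rich B₁ b ∣)
  prune B = go n B (card-≤n B)
    where
    open ≤-Reasoning
    go : ∀ f B → ∣ B ∣ ≤ f → Λ * ∣ B ∣ < surplus B →
      Σ (Sub n) λ B₁ → (∀ {v} → B₁ v ≡ true → B v ≡ true) × 1 ≤ ∣ B₁ ∣ × (∀ b → B₁ b ≡ true → Λ < ∣ rich B₁ b ∣)
    go f B B≤ h with FP.any? (λ b → (B b B.≟ true) ×-dec (∣ rich B b ∣ ≤? Λ))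
    go zero B B≤ h | yes (b , b∈ , _) = ⊥-elim (<⇒≱ (∃⇒card-pos B b∈) B≤)
    go (suc f) B B≤ h | yes (b , b∈ , poor)
      with B₁ , B₁⊆ , rest ← go f (B ∖ b) (s≤s⁻¹ (≤-trans (≤-reflexive (≡-sym (card-∖ B b∈))) B≤))
        (+-cancelʳ-< Λ _ _ (begin-strict
          Λ * ∣ B ∖ b ∣ + Λ ≡⟨ trans (+-comm _ Λ) (≡-sym (*-suc Λ ∣ B ∖ b ∣)) ⟩
          Λ * suc ∣ B ∖ b ∣ ≡⟨ cong (Λ *_) (card-∖ B b∈) ⟨
          Λ * ∣ B ∣ <⟨ h ⟩
          surplus B ≤⟨ surplus-∖ B b∈ ⟩
          surplus (B ∖ b) + ∣ rich B b ∣ ≤⟨ +-monoʳ-≤ (surplus (B ∖ b)) poor ⟩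
          surplus (B ∖ b) + Λ ∎))
      = B₁ , (λ p → ∖-⊆ B (B₁⊆ p)) , rest
    ... | no ¬poor = B , (λ p → p) , n≢0⇒n>0 nonempty , λ b b∈ → ≰⇒> λ q → ¬poor (b , b∈ , q)
      where
      nonempty : ∣ B ∣ ≢ 0
      nonempty e = n≮0 (<-≤-trans h (≤-reflexive (∑-zero λ a → trans (cong (λ z → ⟦ A a ⟧ * (z ∸ s)) (n≤0⇒n≡0 (≤-trans (deg≤card G B a) (≤-reflexive e)))) (trans (cong (⟦ A a ⟧ *_) (0∸n≡0 s)) (*-zeroʳ ⟦ A a ⟧)))))

module Unbalanced {n : ℕ} (G : Graph n) (Λ κ Δ ρ p : ℕ) (A B : Sub n)
  (A-indep : ∀ {u v} → A u ≡ true → A v ≡ true → adj G u v ≡ false) (AB-disjoint : ∀ {v} → A v ≡ true → B v ≡ true → ⊥)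
  (A-deg : ∀ a → A a ≡ true → deg G B a ≤ Δ) (B-out : Orientation G ρ B) (B-sparse : degSum G B ≤ ρ * ∣ B ∣) (B≥1 : 1 ≤ ∣ B ∣)
  (rich : ∀ b → B b ≡ true → κ < (∑[ b′ ] ⟦ B b′ ∧ ⌊ FP.any? (λ a → (A a B.≟ true) ×-dec (adj G b a B.≟ true) ×-dec (adj G a b′ B.≟ true)) ⌋ ⟧))
  (p-large : 2 * (Δ + (ρ + ρ)) ≤ suc p) (κ-large : 2 * (Λ * suc p) + ρ < κ) where
  open Orientation B-out
  open Event

  private
    V = Fin n

    μ : ∀ {k a b} → Event n k a b → ℕ
    -- At the rate `1 / (1 + 0)` the second sample is the whole vertex set, so the same machinery
    -- samples a single set.
    μ E = mean E p 0

  Common : V → V → Set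
  Common b b′ = ∃ λ a → A a ≡ true × Edge G b a × Edge G a b′

  common? : ∀ b b′ → Dec (Common b b′)
  common? b b′ = FP.any? (λ a → (A a B.≟ true) ×-dec (adj G b a B.≟ true) ×-dec (adj G a b′ B.≟ true))

  Pair : V → V → Set
  Pair b b′ = B b ≡ true × B b′ ≡ true × b ≢ b′ × ¬ Edge G b b′ × Common b b′

  opaque
    pair? : ∀ b b′ → Dec (Pair b b′)
    pair? b b′ = (B b B.≟ true) ×-dec (B b′ B.≟ true) ×-dec ¬? (b FP.≟ b′) ×-dec ¬? (adj G b b′ B.≟ true) ×-dec common? b b′

    -- The vertex of A representing a pair; an arbitrary vertex when there is no common neighbour.
    rep : V → V → V
    rep b b′ with common? b b′
    ... | yes (a , _) = a
    ... | no _ = b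

    rep-common : ∀ {b b′} → Common b b′ → A (rep b b′) ≡ true × Edge G b (rep b b′) × Edge G (rep b b′) b′
    rep-common {b} {b′} c with common? b b′
    ... | yes (a , h) = h
    ... | no ¬c = ⊥-elim (¬c c)

  pairs : ℕ
  pairs = ∑[ b ] ∑[ b′ ] ⟦ ⌊ pair? b b′ ⌋ ⟧

  -- The strict bound `rich` makes up for counting `b` itself. Neighbours of `b` may be counted too,
  -- but they cost at most `ρ` per vertex on average because `B` is sparse.
  many-pairs : κ * ∣ B ∣ ≤ pairs + ρ * ∣ B ∣
  many-pairs = +-cancelˡ-≤ ∣ B ∣ _ _ (begin
    ∣ B ∣ + κ * ∣ B ∣ ≡⟨ *-comm (suc κ) ∣ B ∣ ⟩
    ∣ B ∣ * suc κ ≤⟨ ∑-sub-≥ B (suc κ) rich ⟩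
    (∑[ b ] ⟦ B b ⟧ * (∑[ b′ ] ⟦ B b′ ∧ ⌊ common? b b′ ⌋ ⟧)) ≤⟨ ∑-mono pt ⟩
    (∑[ b ] (⟦ B b ⟧ * 1 + (∑[ b′ ] ⟦ ⌊ pair? b b′ ⌋ ⟧)) + ⟦ B b ⟧ * deg G B b) ≡⟨ ∑-distrib-+ _ _ ⟩
    (∑[ b ] ⟦ B b ⟧ * 1 + (∑[ b′ ] ⟦ ⌊ pair? b b′ ⌋ ⟧)) + degSum G B ≡⟨ cong (_+ degSum G B) (trans (∑-distrib-+ _ _) (cong (_+ pairs) (∑-card B))) ⟩
    ∣ B ∣ + pairs + degSum G B ≤⟨ +-monoʳ-≤ (∣ B ∣ + pairs) B-sparse ⟩
    ∣ B ∣ + pairs + ρ * ∣ B ∣ ≡⟨ +-assoc ∣ B ∣ pairs _ ⟩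
    ∣ B ∣ + (pairs + ρ * ∣ B ∣) ∎)
    where
    open ≤-Reasoning
    pt′ : ∀ b b′ → B b ≡ true → ⟦ B b′ ∧ ⌊ common? b b′ ⌋ ⟧ ≤ (⟦ eq b b′ ⟧ * 1 + ⟦ ⌊ pair? b b′ ⌋ ⟧) + ⟦ (B ∩ nb G b) b′ ⟧
    pt′ b b′ b∈ = ⟦⟧-le _ λ h → go h (true-or-false (eq b b′)) (true-or-false (adj G b b′))
      where
      go : B b′ ∧ ⌊ common? b b′ ⌋ ≡ true → eq b b′ ≡ true ⊎ eq b b′ ≡ false → adj G b b′ ≡ true ⊎ adj G b b′ ≡ false →
        1 ≤ (⟦ eq b b′ ⟧ * 1 + ⟦ ⌊ pair? b b′ ⌋ ⟧) + ⟦ (B ∩ nb G b) b′ ⟧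
      go h (inj₁ e) _ = ≤-trans (one e ⊛ ≤-refl) (≤-trans (m≤m+n _ _) (m≤m+n _ _))
      go h (inj₂ _) (inj₁ e) = ≤-trans (one (∧-intro {B b′} (∧-elimˡ h) e)) (m≤n+m ⟦ (B ∩ nb G b) b′ ⟧ _)
      go h (inj₂ ne) (inj₂ ne′) = ≤-trans (one (⌊⌋-intro (pair? b b′) (b∈ , ∧-elimˡ h , eq-false⇒≢ ne , (λ q → true≢false q ne′) ,
        ⌊⌋-elim (common? b b′) (∧-elimʳ {B b′} h)))) (≤-trans (m≤n+m _ (⟦ eq b b′ ⟧ * 1)) (m≤m+n _ _))
    pt : ∀ b → ⟦ B b ⟧ * (∑[ b′ ] ⟦ B b′ ∧ ⌊ common? b b′ ⌋ ⟧) ≤ (⟦ B b ⟧ * 1 + (∑[ b′ ] ⟦ ⌊ pair? b b′ ⌋ ⟧)) + ⟦ B b ⟧ * deg G B b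
    pt b with true-or-false (B b)
    ... | inj₂ e = ≤-trans (≤-reflexive (cong (λ z → ⟦ z ⟧ * (∑[ b′ ] ⟦ B b′ ∧ ⌊ common? b b′ ⌋ ⟧)) e)) z≤n
    ... | inj₁ e = subst (λ z → ⟦ z ⟧ * (∑[ b′ ] ⟦ B b′ ∧ ⌊ common? b b′ ⌋ ⟧) ≤ (⟦ z ⟧ * 1 + (∑[ b′ ] ⟦ ⌊ pair? b b′ ⌋ ⟧)) + ⟦ z ⟧ * deg G B b) (≡-sym e) (begin
      1 * (∑[ b′ ] ⟦ B b′ ∧ ⌊ common? b b′ ⌋ ⟧) ≡⟨ *-identityˡ _ ⟩
      (∑[ b′ ] ⟦ B b′ ∧ ⌊ common? b b′ ⌋ ⟧) ≤⟨ ∑-mono (λ b′ → pt′ b b′ e) ⟩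
      (∑[ b′ ] (⟦ eq b b′ ⟧ * 1 + ⟦ ⌊ pair? b b′ ⌋ ⟧) + ⟦ (B ∩ nb G b) b′ ⟧) ≡⟨ trans (∑-distrib-+ _ _) (cong (_+ deg G B b) (trans (∑-distrib-+ _ _) (cong (_+ (∑[ b′ ] ⟦ ⌊ pair? b b′ ⌋ ⟧)) (∑-eq b (λ _ → 1))))) ⟩
      (1 + (∑[ b′ ] ⟦ ⌊ pair? b b′ ⌋ ⟧)) + deg G B b ≡⟨ cong ((1 + (∑[ b′ ] ⟦ ⌊ pair? b b′ ⌋ ⟧)) +_) (*-identityˡ (deg G B b)) ⟨
      (1 * 1 + (∑[ b′ ] ⟦ ⌊ pair? b b′ ⌋ ⟧)) + 1 * deg G B b ∎)

  private
    E-vertex : Event n 1 1 0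
    E-vertex = record { stat = λ { (b ∷ []) → B b } ; xs = λ vs → vs ; zs = λ _ → [] ; distinct = λ { (b ∷ []) _ → ([] ∷ []) , [] } }

    E-pair : Event n 2 2 0
    E-pair = record
      { stat = λ { (b ∷ b′ ∷ []) → ⌊ pair? b b′ ⌋ } ; xs = λ vs → vs ; zs = λ _ → []
      ; distinct = λ { (b ∷ b′ ∷ []) e → ((proj₁ (proj₂ (proj₂ (⌊⌋-elim (pair? b b′) e))) ∷ []) ∷ [] ∷ []) , [] } }

    -- Only out-neighbours count, so a pair has at most `Δ + (ρ + ρ)` conflicts. An edge between two
    -- sampled vertices is still noticed by any pair that contains its tail.
    Conflict : V → V → V → Set
    Conflict b b′ c = B c ≡ true × b ≢ c × b′ ≢ c × (Edge G (rep b b′) c ⊎ out b c ≡ true ⊎ out b′ c ≡ true)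

    opaque
      conflict? : ∀ b b′ c → Dec (Pair b b′ × Conflict b b′ c)
      conflict? b b′ c = pair? b b′ ×-dec (B c B.≟ true) ×-dec ¬? (b FP.≟ c) ×-dec ¬? (b′ FP.≟ c) ×-dec
        ((adj G (rep b b′) c B.≟ true) ⊎-dec (out b c B.≟ true) ⊎-dec (out b′ c B.≟ true))

    E-conflict : Event n 3 3 0
    E-conflict = record
      { stat = λ { (b ∷ b′ ∷ c ∷ []) → ⌊ conflict? b b′ c ⌋ } ; xs = λ vs → vs ; zs = λ _ → []
      ; distinct = λ { (b ∷ b′ ∷ c ∷ []) e → let (_ , _ , n₁ , _) , _ , n₂ , n₃ , _ = ⌊⌋-elim (conflict? b b′ c) e in
          ((n₁ ∷ n₂ ∷ []) ∷ (n₃ ∷ []) ∷ [] ∷ []) , [] } }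

    count-conflict : count E-conflict ≤ pairs * (Δ + (ρ + ρ))
    count-conflict = ≤-trans (∑-mono λ b → ∑-mono λ b′ → per b b′)
      (≤-reflexive (≡-sym (trans (∑-*ʳ (Δ + (ρ + ρ)) _) (sum-cong-≗ λ b → ∑-*ʳ (Δ + (ρ + ρ)) _))))
      where
      open ≤-Reasoning
      per : ∀ b b′ → (∑[ c ] ⟦ ⌊ conflict? b b′ c ⌋ ⟧) ≤ ⟦ ⌊ pair? b b′ ⌋ ⟧ * (Δ + (ρ + ρ))
      per b b′ = ≤-trans (∑-mono pt) (≤-trans (≤-reflexive (≡-sym (∑-*ˡ ⟦ ⌊ pair? b b′ ⌋ ⟧ _))) (⟦⟧*-le ⌊ pair? b b′ ⌋ bound))
        where
        pt : ∀ c → ⟦ ⌊ conflict? b b′ c ⌋ ⟧ ≤ ⟦ ⌊ pair? b b′ ⌋ ⟧ * (⟦ (B ∩ nb G (rep b b′)) c ⟧ + (⟦ out b c ⟧ + ⟦ out b′ c ⟧))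
        pt c = ⟦⟧-le _ λ e → let P , c∈ , _ , _ , h = ⌊⌋-elim (conflict? b b′ c) e in one (⌊⌋-intro (pair? b b′) P) ⊛ cases c∈ h
          where
          cases : B c ≡ true → Edge G (rep b b′) c ⊎ out b c ≡ true ⊎ out b′ c ≡ true →
            1 ≤ ⟦ (B ∩ nb G (rep b b′)) c ⟧ + (⟦ out b c ⟧ + ⟦ out b′ c ⟧)
          cases c∈ (inj₁ q) = ≤-trans (one (∧-intro c∈ q)) (m≤m+n _ _)
          cases c∈ (inj₂ (inj₁ q)) = ≤-trans (≤-trans (one q) (m≤m+n _ ⟦ out b′ c ⟧)) (m≤n+m _ ⟦ (B ∩ nb G (rep b b′)) c ⟧)
          cases c∈ (inj₂ (inj₂ q)) = ≤-trans (≤-trans (one q) (m≤n+m _ ⟦ out b c ⟧)) (m≤n+m _ ⟦ (B ∩ nb G (rep b b′)) c ⟧)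
        bound : ⌊ pair? b b′ ⌋ ≡ true → (∑[ c ] ⟦ (B ∩ nb G (rep b b′)) c ⟧ + (⟦ out b c ⟧ + ⟦ out b′ c ⟧)) ≤ Δ + (ρ + ρ)
        bound e = ≤-trans (≤-reflexive (trans (∑-distrib-+ _ _) (cong (deg G B (rep b b′) +_) (∑-distrib-+ _ _))))
          (+-mono-≤ (A-deg _ (proj₁ (rep-common (proj₂ (proj₂ (proj₂ (proj₂ (⌊⌋-elim (pair? b b′) e)))))))) (+-mono-≤ (out-small b) (out-small b′)))

    -- By `p-large` the conflicts spoil at most half of the sampled pairs on average, and by
    -- `κ-large` the term with `Λ` takes less than the other half.
    mean-gap : 𝔼₂ p 0 n (λ X Z → Λ * ∑^ 1 (term E-vertex X Z) + ∑^ 3 (term E-conflict X Z)) < 𝔼₂ p 0 n (λ X Z → ∑^ 2 (term E-pair X Z))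
    mean-gap = subst (_< μ E-pair) (≡-sym expand) (*-cancelˡ-< (P * P * P) _ _ (begin-strict
      P * P * P * (Λ * μ E-vertex + μ E-conflict) ≡⟨ lem₁ P Λ (μ E-vertex) (μ E-conflict) ⟩
      Λ * (P * P) * (P * 1 * 1 * μ E-vertex) + P * (P * (P * 1)) * 1 * μ E-conflict ≡⟨ cong₂ (λ a b → Λ * (P * P) * a + b) (mean-count E-vertex p 0) (mean-count E-conflict p 0) ⟩
      Λ * (P * P) * (Ω * ∣ B ∣) + Ω * count E-conflict ≡⟨ lem₂ (Λ * (P * P)) Ω ∣ B ∣ (count E-conflict) ⟩
      Ω * (Λ * (P * P) * ∣ B ∣ + count E-conflict) <⟨ *-monoʳ-< Ω ⦃ >-nonZero (*-mono-≤ (m^n>0 P n) (m^n>0 1 n)) ⦄ main ⟩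
      Ω * (P * pairs) ≡⟨ lem₃ Ω P pairs ⟩
      P * (Ω * pairs) ≡⟨ cong (P *_) (mean-count E-pair p 0) ⟨
      P * (P * (P * 1) * 1 * μ E-pair) ≡⟨ lem₄ P (μ E-pair) ⟩
      P * P * P * μ E-pair ∎))
      where
      open ≤-Reasoning
      P = suc p
      Ω = P ^ n * 1 ^ n
      expand : 𝔼₂ p 0 n (λ X Z → Λ * ∑^ 1 (term E-vertex X Z) + ∑^ 3 (term E-conflict X Z)) ≡ Λ * μ E-vertex + μ E-conflict
      expand = trans (𝔼₂-+ p 0 n (λ X Z → Λ * ∑^ 1 (term E-vertex X Z)) (λ X Z → ∑^ 3 (term E-conflict X Z)))
        (cong (_+ μ E-conflict) (𝔼₂-* p 0 n Λ λ X Z → ∑^ 1 (term E-vertex X Z)))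
      lem₁ : ∀ P Λ a b → P * P * P * (Λ * a + b) ≡ Λ * (P * P) * (P * 1 * 1 * a) + P * (P * (P * 1)) * 1 * b
      lem₁ = solve-∀
      lem₂ : ∀ a Ω b c → a * (Ω * b) + Ω * c ≡ Ω * (a * b + c)
      lem₂ = solve-∀
      lem₃ : ∀ Ω P c → Ω * (P * c) ≡ P * (Ω * c)
      lem₃ = solve-∀
      lem₄ : ∀ P a → P * (P * (P * 1) * 1 * a) ≡ P * P * P * a
      lem₄ = solve-∀
      lem₅ : ∀ Λ P b → 2 * (Λ * (P * P) * b) ≡ P * (2 * (Λ * P) * b)
      lem₅ = solve-∀
      lem₆ : ∀ x c → 2 * (x * c) ≡ 2 * c * x
      lem₆ = solve-∀
      lem₇ : ∀ P x → P * x + P * x ≡ 2 * (P * x)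
      lem₇ = solve-∀
      few : 2 * (Λ * P) * ∣ B ∣ < pairs
      few = +-cancelʳ-< (ρ * ∣ B ∣) _ _ (begin-strict
        2 * (Λ * P) * ∣ B ∣ + ρ * ∣ B ∣ ≡⟨ *-distribʳ-+ ∣ B ∣ (2 * (Λ * P)) ρ ⟨
        (2 * (Λ * P) + ρ) * ∣ B ∣ <⟨ *-monoˡ-< ∣ B ∣ ⦃ >-nonZero B≥1 ⦄ κ-large ⟩
        κ * ∣ B ∣ ≤⟨ many-pairs ⟩
        pairs + ρ * ∣ B ∣ ∎)
      main : Λ * (P * P) * ∣ B ∣ + count E-conflict < P * pairs
      main = *-cancelˡ-< 2 _ _ (begin-strict
        2 * (Λ * (P * P) * ∣ B ∣ + count E-conflict) ≡⟨ *-distribˡ-+ 2 (Λ * (P * P) * ∣ B ∣) _ ⟩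
        2 * (Λ * (P * P) * ∣ B ∣) + 2 * count E-conflict ≤⟨ +-mono-≤ (≤-reflexive (lem₅ Λ P ∣ B ∣)) (*-monoʳ-≤ 2 count-conflict) ⟩
        P * (2 * (Λ * P) * ∣ B ∣) + 2 * (pairs * (Δ + (ρ + ρ))) <⟨ +-mono-<-≤ (*-monoʳ-< P few) (≤-trans (≤-reflexive (lem₆ pairs (Δ + (ρ + ρ)))) (*-monoˡ-≤ pairs p-large)) ⟩
        P * pairs + P * pairs ≡⟨ lem₇ P pairs ⟩
        2 * (P * pairs) ∎)

    module Sample (X Z : Sub n) where
      opaque
        conflicts : V → V → ℕ
        conflicts b b′ = ∑^ 1 λ vs → term E-conflict X Z (b ∷ b′ ∷ vs)

        ∑-conflicts : (∑[ b ] ∑[ b′ ] conflicts b b′) ≡ ∑^ 3 (term E-conflict X Z)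
        ∑-conflicts = refl

        conflict-pos : ∀ {b b′} c → Pair b b′ → X b ≡ true → X b′ ≡ true → X c ≡ true → Conflict b b′ c → 1 ≤ conflicts b b′
        conflict-pos {b} {b′} c P p₁ p₂ p₃ q = ≤-trans (one (⌊⌋-intro (conflict? b b′ c) (P , q)) ⊛ (one p₁ ⊛ one p₂ ⊛ one p₃ ⊛ ≤-refl {1}) ⊛ ≤-refl {1})
          (≤-∑^ 1 (λ vs → term E-conflict X Z (b ∷ b′ ∷ vs)) (c ∷ []))

      Good : V → V → Set
      Good b b′ = Pair b b′ × X b ≡ true × X b′ ≡ true × conflicts b b′ ≡ 0

      opaque
        good? : ∀ b b′ → Dec (Good b b′)
        good? b b′ = pair? b b′ ×-dec (X b B.≟ true) ×-dec (X b′ B.≟ true) ×-dec (conflicts b b′ ≟ 0)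

      no-conflict : ∀ {b b′} c → Good b b′ → X c ≡ true → Conflict b b′ c → ⊥
      no-conflict c (P , p₁ , p₂ , e) p₃ q = n≮0 (subst (1 ≤_) e (conflict-pos c P p₁ p₂ p₃ q))

      joined? : ∀ b b′ → Dec (Good b b′ ⊎ Good b′ b)
      joined? b b′ = good? b b′ ⊎-dec good? b′ b

      F : Graph n
      F = record
        { adj = λ b b′ → ⌊ joined? b b′ ⌋
        ; sym = λ b b′ → iff (flip b b′) (flip b′ b)
        ; irrefl = λ b → ⌊⌋-false (joined? b b) Sum.[ loop b , loop b ] }
        where
        loop : ∀ b → Good b b → ⊥
        loop b ((_ , _ , ne , _) , _) = ne refl
        flip : ∀ b b′ → ⌊ joined? b b′ ⌋ ≡ true → ⌊ joined? b′ b ⌋ ≡ true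
        flip b b′ e = ⌊⌋-intro (joined? b′ b) (Sum.swap (⌊⌋-elim (joined? b b′) e))

      F-good : ∀ {b b′} → Edge F b b′ → Good b b′ ⊎ Good b′ b
      F-good {b} {b′} e = ⌊⌋-elim (joined? b b′) e

      X′ : Sub n
      X′ b = B b ∧ X b

      F⊆X′ : ∀ {b b′} → Edge F b b′ → X′ b ≡ true
      F⊆X′ e with F-good e
      ... | inj₁ ((b∈ , _) , p , _) = ∧-intro b∈ p
      ... | inj₂ ((_ , b∈ , _) , _ , p , _) = ∧-intro b∈ p

      in-B : ∀ {b} → X′ b ≡ true → B b ≡ true
      in-B = ∧-elimˡ

      in-X : ∀ {b} → X′ b ≡ true → X b ≡ true
      in-X {b} p = ∧-elimʳ {B b} p

      flipE : ∀ {u v} → Edge G u v → Edge G v u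
      flipE {u} {v} e = trans (Graph.sym G v u) e

      no-out : ∀ {b b′ c} → Edge F b b′ → X′ c ≡ true → out b c ≡ true → ⊥
      no-out {b} {b′} {c} e c∈ q with F-good e
      ... | inj₁ g@((_ , _ , _ , ne , _) , _) = no-conflict c g (in-X c∈) (in-B c∈ , edge⇒≢ G (out⊆adj q) , (λ { refl → ne (out⊆adj q) }) , inj₂ (inj₁ q))
      ... | inj₂ g@((_ , _ , _ , ne , _) , _) = no-conflict c g (in-X c∈) (in-B c∈ , (λ { refl → ne (flipE (out⊆adj q)) }) , edge⇒≢ G (out⊆adj q) , inj₂ (inj₂ q))

      indep : ∀ {x x′ u u′} → Edge F x x′ → Edge F u u′ → adj G x u ≡ false
      indep e e′ = ¬true⇒false λ q → Sum.[ no-out e (F⊆X′ e′) , no-out e′ (F⊆X′ e) ] (oriented (in-B (F⊆X′ e)) (in-B (F⊆X′ e′)) q)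

      data Connector (x x′ v : V) : Set where
        fwd : Good x x′ → rep x x′ ≡ v → Connector x x′ v
        bwd : Good x′ x → rep x′ x ≡ v → Connector x x′ v

      connector-flip : ∀ {x x′ v} → Connector x x′ v → Connector x′ x v
      connector-flip (fwd g e) = bwd g e
      connector-flip (bwd g e) = fwd g e

      common : ∀ {x x′} → Good x x′ → Common x x′
      common ((_ , _ , _ , _ , c) , _) = c

      connector-A : ∀ {x x′ v} → Connector x x′ v → A v ≡ true × Edge G x v × Edge G v x′
      connector-A (fwd g refl) = rep-common (common g)
      connector-A (bwd g refl) = let a , p , q = rep-common (common g) in a , flipE q , flipE p

      touches : ∀ {x x′ v u} → Connector x x′ v → X′ u ≡ true → Edge G u v → u ≡ x ⊎ u ≡ x′
      touches {x} {x′} {v} {u} c u∈ e with u FP.≟ x | u FP.≟ x′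
      ... | yes p | _ = inj₁ p
      ... | no _ | yes p = inj₂ p
      touches {x} {x′} {v} {u} (fwd g refl) u∈ e | no n₁ | no n₂ =
        ⊥-elim (no-conflict u g (in-X u∈) (in-B u∈ , (λ q → n₁ (≡-sym q)) , (λ q → n₂ (≡-sym q)) , inj₁ (flipE e)))
      touches {x} {x′} {v} {u} (bwd g refl) u∈ e | no n₁ | no n₂ =
        ⊥-elim (no-conflict u g (in-X u∈) (in-B u∈ , (λ q → n₂ (≡-sym q)) , (λ q → n₁ (≡-sym q)) , inj₁ (flipE e)))

      connector-end : ∀ {x x′ v} → Connector x x′ v → X′ x ≡ true
      connector-end (fwd ((b∈ , _) , p , _) _) = ∧-intro b∈ p
      connector-end (bwd ((_ , b∈ , _) , _ , p , _) _) = ∧-intro b∈ p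

      separate : ∀ {x x′ y u u′ v} → Connector x x′ y → Connector u u′ v → y ≡ v ⊎ Edge G y v → u ≡ x ⊎ u ≡ x′
      separate c d (inj₁ refl) = touches c (connector-end d) (proj₁ (proj₂ (connector-A d)))
      separate c d (inj₂ e) = ⊥-elim (true≢false e (A-indep (proj₁ (connector-A c)) (proj₁ (connector-A d))))

      frame : Frame G F
      frame = record
        { conn = Connector ; indep = indep ; conn-sym = connector-flip
        ; conn-avoids = λ { c e refl → AB-disjoint (proj₁ (connector-A c)) (in-B (F⊆X′ e)) }
        ; conn-touches = λ c e q → touches c (F⊆X′ e) q
        ; conn-separate = separate
        ; linked = λ {x} {x′} e → link′ (connector e) }
        where
        connector : ∀ {x x′} → Edge F x x′ → ∃ λ v → Connector x x′ v
        connector e with F-good e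
        ... | inj₁ g = _ , fwd g refl
        ... | inj₂ g = _ , bwd g refl
        link′ : ∀ {x x′} → (∃ λ v → Connector x x′ v) → Σ V λ y → Σ V λ y′ → Edge G x y × Reach G (Connector x x′) y y′ × Edge G y′ x′
        link′ (v , c) = let _ , p , q = connector-A c in v , v , p , here c , q

      count-good : ∑^ 2 (term E-pair X Z) ≤ (∑[ b ] ∣ nb F b ∣) + ∑^ 3 (term E-conflict X Z)
      count-good = ≤-trans (∑-mono λ b → ∑-mono λ b′ → pt b b′) (≤-reflexive (trans (sum-cong-≗ λ b → ∑-distrib-+ _ _)
        (trans (∑-distrib-+ _ _) (cong ((∑[ b ] ∣ nb F b ∣) +_) ∑-conflicts))))
        where
        small : ∀ {a b} → a ≤ 1 → b ≤ 1 → a * b ≤ 1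
        small = *-mono-≤
        pt : ∀ b b′ → term E-pair X Z (b ∷ b′ ∷ []) ≤ ⟦ ⌊ joined? b b′ ⌋ ⟧ + conflicts b b′
        pt b b′ = ≤-from-pos (small (⟦⟧≤1 ⌊ pair? b b′ ⌋) (small (small (⟦⟧≤1 (X b)) (small (⟦⟧≤1 (X b′)) ≤-refl)) ≤-refl)) λ h →
          let P , h₁ = ⟦⟧-pos {⌊ pair? b b′ ⌋} _ h
              hX , _ = *-pos _ _ h₁
              p₁ , h₂ = ⟦⟧-pos {X b} _ hX
              p₂ , _ = ⟦⟧-pos {X b′} 1 h₂
          in ≤-trans (zero-or-pos (conflicts b b′) 0 λ e _ → one (⌊⌋-intro (joined? b b′) (inj₁ (⌊⌋-elim (pair? b b′) P , p₁ , p₂ , e))))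
            (≤-reflexive (cong (⟦ ⌊ joined? b b′ ⌋ ⟧ +_) (+-identityʳ _)))

    from-sample : ∀ X Z → Λ * ∑^ 1 (term E-vertex X Z) + ∑^ 3 (term E-conflict X Z) < ∑^ 2 (term E-pair X Z) → DenseFrame G Λ
    from-sample X Z h = F , X′ , frame , F⊆X′ , (begin-strict
      Λ * ∣ X′ ∣ ≡⟨ cong (Λ *_) (sum-cong-≗ λ v → trans (⟦∧⟧ (B v) (X v)) (pt ⟦ B v ⟧ ⟦ X v ⟧)) ⟩
      Λ * ∑^ 1 (term E-vertex X Z) <⟨ +-cancelʳ-< (∑^ 3 (term E-conflict X Z)) _ _ (<-≤-trans h count-good) ⟩
      (∑[ b ] ∣ nb F b ∣) ∎)
      where
      open ≤-Reasoning
      open Sample X Z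
      pt : ∀ b x → b * x ≡ b * (x * 1 * 1)
      pt = solve-∀

  dense-frame : DenseFrame G Λ
  dense-frame = from-sample (proj₁ s) (proj₁ (proj₂ s)) (proj₂ (proj₂ s))
    where
    s = 𝔼₂-<⇒∃ p 0 n (λ X Z → Λ * ∑^ 1 (term E-vertex X Z) + ∑^ 3 (term E-conflict X Z)) (λ X Z → ∑^ 2 (term E-pair X Z)) mean-gap

-- Induced subgraphs

induced : ∀ {n} → Graph n → (S : Sub n) → Graph ∣ S ∣
induced G S = record
  { adj = λ i j → adj G (enum S i) (enum S j)
  ; sym = λ i j → Graph.sym G (enum S i) (enum S j)
  ; irrefl = λ i → irrefl G (enum S i) }

induced-deg : ∀ {n} (G : Graph n) S i → ∣ nb (induced G S) i ∣ ≡ deg G S (enum S i)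
induced-deg G S i = trans (∑-enum S λ v → ⟦ adj G (enum S i) v ⟧) (≡-sym (deg-∑ G S (enum S i)))

induced-degSum : ∀ {n} (G : Graph n) S → (∑[ i ] ∣ nb (induced G S) i ∣) ≡ degSum G S
induced-degSum G S = trans (sum-cong-≗ (induced-deg G S)) (∑-enum S (deg G S))

induced-clique : ∀ {n} (G : Graph n) S {k} → HasClique (induced G S) k → HasClique G k
induced-clique G S (f , inj , e) = enum S ∘ f , (λ p → inj (enum-injective S p)) , e

induced-subdivision : ∀ {n} (G : Graph n) S {r t} → ContainsInducedSubdivK r t (induced G S) → ContainsInducedSubdivK r t G
induced-subdivision G S (ℓ , φ , inj , pres , refl′) = ℓ , enum S ∘ φ , (λ p → inj (enum-injective S p)) , pres , refl′

degSum-full : ∀ {n} (G : Graph n) → degSum G full ≡ (∑[ v ] ∣ nb G v ∣)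
degSum-full G = sum-cong-≗ λ v → *-identityˡ ∣ nb G v ∣

-- Parameters and local sparsity in the balanced case

module BalancedCase {n : ℕ} (G : Graph n) (w r t : ℕ) (r≥1 : 1 ≤ r) (t≥1 : 1 ≤ t)
  (noClique : ¬ HasClique G (suc w)) (noSub : ¬ ContainsInducedSubdivK r t G) (N η : ℕ) (N≥20 : 20 ≤ N) (η≥1 : 1 ≤ η)
  (N≥a^r : (4 * suc w) ^ r ≤ N) (N≥a^e : (4 * suc w) ^ tupleExp r * (4 * suc w) ^ t ≤ N) (n≥1 : 1 ≤ n) where
  Λ τ σ g q d D : ℕ
  Λ = maderBound r t
  -- With `P` and `Q` as in `numeric`, `τ` is `D / Q`, and the lower bound
  -- `d³ / (P Q²) = τ / (N η⁶)` for the walks per sampled end becomes `N * Λ`.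
  τ = Λ * (η * (η * (η * (η * (η * η))))) * (N * N)
  -- The conflicts with two further inner vertices number at most `D⁵ / (σ d³ Q²) = η³ τ² / σ` per
  -- walk on average; this makes it `1 / N`.
  σ = N * (η * (η * η)) * (τ * τ)
  -- `induced-kst` is applied with `κ = D` and `s = g`, where `D / g = 2 * σ`.
  g = N * (2 * σ) ^ r
  -- Solves `D = 2 * σ * g`, where `D = η * τ * q`.
  q = 2 * (N * (η * η) * τ * g)
  d = τ * q
  D = η * d

  private
    a = 4 * suc w

    Λ≥1 : 1 ≤ Λ
    Λ≥1 = *-mono-≤ {1} {2} (s≤s z≤n) (*-mono-≤ (m^n>0 2 (r * t)) (≤-trans r≥1 (m≤m+n r t)))
    N≥1 : 1 ≤ N
    N≥1 = ≤-trans (s≤s z≤n) N≥20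
    τ≥1 : 1 ≤ τ
    τ≥1 = *-mono-≤ (*-mono-≤ Λ≥1 (η≥1 ⊛ η≥1 ⊛ η≥1 ⊛ η≥1 ⊛ η≥1 ⊛ η≥1)) (N≥1 ⊛ N≥1)
    σ≥1 : 1 ≤ σ
    σ≥1 = *-mono-≤ (*-mono-≤ N≥1 (η≥1 ⊛ η≥1 ⊛ η≥1)) (τ≥1 ⊛ τ≥1)
    2σ^r≥1 : 1 ≤ (2 * σ) ^ r
    2σ^r≥1 = m^n>0 (2 * σ) ⦃ >-nonZero (*-mono-≤ {1} {2} (s≤s z≤n) σ≥1) ⦄ r
    g≥1 : 1 ≤ g
    g≥1 = *-mono-≤ N≥1 2σ^r≥1
    q≥1 : 1 ≤ q
    q≥1 = *-mono-≤ {1} {2} (s≤s z≤n) (*-mono-≤ (*-mono-≤ (*-mono-≤ N≥1 (η≥1 ⊛ η≥1)) τ≥1) g≥1)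
  d≥1 : 1 ≤ d
  d≥1 = *-mono-≤ τ≥1 q≥1

  private
    D≡2σg : D ≡ 2 * σ * g
    D≡2σg = lem η τ N g
      where
      lem : ∀ η τ N g → η * (τ * (2 * (N * (η * η) * τ * g))) ≡ 2 * (N * (η * (η * η)) * (τ * τ)) * g
      lem = solve-∀

    σ≤D : σ ≤ D
    σ≤D = ≤-trans (≤-trans (m≤m+n σ _) (≤-trans (≤-reflexive (≡-sym (*-identityʳ (2 * σ)))) (*-monoʳ-≤ (2 * σ) g≥1))) (≤-reflexive (≡-sym D≡2σg))

    D≥1 : 1 ≤ D
    D≥1 = *-mono-≤ η≥1 d≥1

  -- Every term on the left, multiplied by N, is at most the right-hand side.
  numeric : ∀ {P Q} → P ≡ D * τ * (η * (η * η)) * N → Q ≡ η * q →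
    Balance d D σ Λ P Q
  numeric {P} {Q} P≡ Q≡ = *-cancelˡ-< N _ _ (begin-strict
    N * (Λ * (P * P * (Q * Q * (Q * Q))) * σ + 2 * (2 * (σ * (Q * Q)) * D₄ + σ * Q * D₅ + 2 * (P * Q) * D₄ + P * D₅) + 6 * (P * (Q * Q)) * D₃)
      ≡⟨ distribute N Λ P Q σ D₃ D₄ D₅ ⟩
    N * (Λ * (P * P * (Q * Q * (Q * Q))) * σ) + 4 * (N * (σ * (Q * Q) * D₄)) + 2 * (N * (σ * Q * D₅)) + 4 * (N * (P * Q * D₄)) + 2 * (N * (P * D₅)) + 6 * (N * (P * (Q * Q) * D₃))
      ≤⟨ +-mono-≤ (+-mono-≤ (+-mono-≤ (+-mono-≤ (+-mono-≤ (≤-reflexive e₁) (*-monoʳ-≤ 4 (le (N * (σ * (Q * Q) * D₄)) τ e₂ τ≥1))) (*-monoʳ-≤ 2 (≤-reflexive e₃)))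
           (*-monoʳ-≤ 4 (le (N * (P * Q * D₄)) τ e₄ τ≥1))) (*-monoʳ-≤ 2 (≤-reflexive e₅))) (*-monoʳ-≤ 6 (le (N * (P * (Q * Q) * D₃)) (τ * τ) e₆ (τ≥1 ⊛ τ≥1))) ⟩
    -- The coefficients add up to 19, which is the origin of `20 ≤ N`.
    T + 4 * T + 2 * T + 4 * T + 2 * T + 6 * T ≡⟨ total T ⟩
    19 * T <⟨ *-monoˡ-< T ⦃ >-nonZero T≥1 ⦄ N≥20 ⟩
    N * T ∎)
    where
    open ≤-Reasoning
    D₃ = D * (D * D)
    D₄ = D * D₃
    D₅ = D * D₄
    T = σ * (P * (Q * Q)) * (d * (d * d))
    P≥1 : 1 ≤ P
    P≥1 = ≤-trans (*-mono-≤ (*-mono-≤ (*-mono-≤ D≥1 τ≥1) (η≥1 ⊛ η≥1 ⊛ η≥1)) N≥1) (≤-reflexive (≡-sym P≡))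
    Q≥1 : 1 ≤ Q
    Q≥1 = ≤-trans (*-mono-≤ η≥1 q≥1) (≤-reflexive (≡-sym Q≡))
    T≥1 : 1 ≤ T
    T≥1 = *-mono-≤ (σ≥1 ⊛ P≥1 ⊛ Q≥1 ⊛ Q≥1) (d≥1 ⊛ d≥1 ⊛ d≥1)
    distribute : ∀ N Λ P Q σ D₃ D₄ D₅ → N * (Λ * (P * P * (Q * Q * (Q * Q))) * σ + 2 * (2 * (σ * (Q * Q)) * D₄ + σ * Q * D₅ + 2 * (P * Q) * D₄ + P * D₅) + 6 * (P * (Q * Q)) * D₃) ≡
      N * (Λ * (P * P * (Q * Q * (Q * Q))) * σ) + 4 * (N * (σ * (Q * Q) * D₄)) + 2 * (N * (σ * Q * D₅)) + 4 * (N * (P * Q * D₄)) + 2 * (N * (P * D₅)) + 6 * (N * (P * (Q * Q) * D₃))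
    distribute = solve-∀
    total : ∀ T → T + 4 * T + 2 * T + 4 * T + 2 * T + 6 * T ≡ 19 * T
    total = solve-∀
    le : ∀ x c → x * c ≡ T → 1 ≤ c → x ≤ T
    le x c e c≥1 = ≤-trans (≤-trans (≤-reflexive (≡-sym (*-identityʳ x))) (*-monoʳ-≤ x c≥1)) (≤-reflexive e)
    e₁ : N * (Λ * (P * P * (Q * Q * (Q * Q))) * σ) ≡ T
    e₁ = trans (cong (λ z → N * (Λ * (P * z * (Q * Q * (Q * Q))) * σ)) P≡) (trans (cong (λ z → N * (Λ * (P * (D * τ * (η * (η * η)) * N) * (Q * Q * (z * z))) * σ)) Q≡) (lem N Λ P Q σ τ η q))
      where
      lem : ∀ N Λ P Q σ τ η q → N * (Λ * (P * (η * (τ * q) * τ * (η * (η * η)) * N) * (Q * Q * (η * q * (η * q)))) * σ) ≡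
        σ * (P * (Q * Q)) * (τ * q * (Λ * (η * (η * (η * (η * (η * η))))) * (N * N) * q * (τ * q)))
      lem = solve-∀
    e₂ : N * (σ * (Q * Q) * D₄) * τ ≡ T
    e₂ = trans (lem N σ Q τ η d) (cong (λ z → σ * (z * (Q * Q)) * (d * (d * d))) (≡-sym P≡))
      where
      lem : ∀ N σ Q τ η d → N * (σ * (Q * Q) * (η * d * (η * d * (η * d * (η * d))))) * τ ≡ σ * (η * d * τ * (η * (η * η)) * N * (Q * Q)) * (d * (d * d))
      lem = solve-∀
    e₃ : N * (σ * Q * D₅) ≡ T
    e₃ = trans (lem N σ Q τ η q) (cong₂ (λ y z → σ * (z * (Q * y)) * (d * (d * d))) (≡-sym Q≡) (≡-sym P≡))
      where
      lem : ∀ N σ Q τ η q → N * (σ * Q * (η * (τ * q) * (η * (τ * q) * (η * (τ * q) * (η * (τ * q) * (η * (τ * q))))))) ≡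
        σ * (η * (τ * q) * τ * (η * (η * η)) * N * (Q * (η * q))) * (τ * q * (τ * q * (τ * q)))
      lem = solve-∀
    e₄ : N * (P * Q * D₄) * τ ≡ T
    e₄ = trans (lem N P Q τ η q) (cong (λ y → σ * (P * (Q * y)) * (d * (d * d))) (≡-sym Q≡))
      where
      lem : ∀ N P Q τ η q → N * (P * Q * (η * (τ * q) * (η * (τ * q) * (η * (τ * q) * (η * (τ * q)))))) * τ ≡
        N * (η * (η * η)) * (τ * τ) * (P * (Q * (η * q))) * (τ * q * (τ * q * (τ * q)))
      lem = solve-∀
    e₅ : N * (P * D₅) ≡ T
    e₅ = trans (lem N P τ η q) (cong (λ y → σ * (P * (y * y)) * (d * (d * d))) (≡-sym Q≡))
      where
      lem : ∀ N P τ η q → N * (P * (η * (τ * q) * (η * (τ * q) * (η * (τ * q) * (η * (τ * q) * (η * (τ * q))))))) ≡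
        N * (η * (η * η)) * (τ * τ) * (P * (η * q * (η * q))) * (τ * q * (τ * q * (τ * q)))
      lem = solve-∀
    e₆ : N * (P * (Q * Q) * D₃) * (τ * τ) ≡ T
    e₆ = lem N P Q τ η d
      where
      lem : ∀ N P Q τ η d → N * (P * (Q * Q) * (η * d * (η * d * (η * d)))) * (τ * τ) ≡ N * (η * (η * η)) * (τ * τ) * (P * (Q * Q)) * (d * (d * d))
      lem = solve-∀

  module _ (low : ∀ v → d ≤ ∣ nb G v ∣) (high : ∀ v → ∣ nb G v ∣ ≤ D) where
    -- By `induced-kst` fewer than `g` neighbours of `u` have `g` or more neighbours in `nb G v`.
    -- They contribute at most `g * D`, the others at most `D * g`, and `2 * g * D` is `D * D / σ`.
    sparse : ∀ u v → σ * cross G u v ≤ D * D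
    sparse u v with g ≤? ∣ nb G u ∩ (λ x → ⌊ g ≤? deg G (nb G v) x ⌋) ∣
    ... | yes many = ⊥-elim (induced-kst G w r t noClique noSub (nb G v) Y g D (≤-trans N≥a^r (≤-trans (≤-reflexive (≡-sym (*-identityʳ N))) (*-monoʳ-≤ N 2σ^r≥1)))
      D≥1 (high v) (λ y y∈ → ⌊⌋-elim (g ≤? deg G (nb G v) y) (∧-elimʳ {adj G u y} y∈)) (begin
        a ^ tupleExp r * (D ^ r * a ^ t) ≡⟨ cong (λ z → a ^ tupleExp r * (z * a ^ t)) (trans (cong (_^ r) D≡2σg) (^-*-distrib (2 * σ) g r)) ⟩
        a ^ tupleExp r * ((2 * σ) ^ r * g ^ r * a ^ t) ≡⟨ lem (a ^ tupleExp r) ((2 * σ) ^ r) (g ^ r) (a ^ t) ⟩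
        a ^ tupleExp r * a ^ t * (2 * σ) ^ r * g ^ r ≤⟨ *-monoˡ-≤ (g ^ r) (*-monoˡ-≤ ((2 * σ) ^ r) N≥a^e) ⟩
        g * g ^ r ≤⟨ *-monoˡ-≤ (g ^ r) many ⟩
        ∣ Y ∣ * g ^ r ∎))
      where
      open ≤-Reasoning
      Y : Sub n
      Y = nb G u ∩ (λ x → ⌊ g ≤? deg G (nb G v) x ⌋)
      lem : ∀ x y z s → x * (y * z * s) ≡ x * s * y * z
      lem = solve-∀
    ... | no few = begin
      σ * cross G u v ≤⟨ *-monoʳ-≤ σ (∑-mono pt) ⟩
      σ * (∑[ x ] ⟦ Y x ⟧ * D + ⟦ adj G u x ⟧ * g) ≡⟨ cong (σ *_) (trans (∑-distrib-+ _ _) (cong₂ _+_ (≡-sym (∑-*ʳ D _)) (≡-sym (∑-*ʳ g _)))) ⟩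
      σ * (∣ Y ∣ * D + ∣ nb G u ∣ * g) ≤⟨ *-monoʳ-≤ σ (+-mono-≤ (*-monoˡ-≤ D (<⇒≤ (≰⇒> few))) (*-monoˡ-≤ g (high u))) ⟩
      σ * (g * D + D * g) ≡⟨ lem σ g D ⟩
      2 * σ * g * D ≡⟨ cong (_* D) D≡2σg ⟨
      D * D ∎
      where
      open ≤-Reasoning
      Y : Sub n
      Y = nb G u ∩ (λ x → ⌊ g ≤? deg G (nb G v) x ⌋)
      lem : ∀ σ g D → σ * (g * D + D * g) ≡ 2 * σ * g * D
      lem = solve-∀
      inner : ∀ x → (∑[ x′ ] ⟦ adj G v x′ ⟧ * ⟦ adj G x x′ ⟧) ≡ deg G (nb G v) x
      inner x = ≡-sym (deg-∑ G (nb G v) x)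
      pt : ∀ x → ⟦ adj G u x ⟧ * (∑[ x′ ] ⟦ adj G v x′ ⟧ * ⟦ adj G x x′ ⟧) ≤ ⟦ Y x ⟧ * D + ⟦ adj G u x ⟧ * g
      pt x = ≤-trans (≤-reflexive (cong (⟦ adj G u x ⟧ *_) (inner x))) (cases (adj G u x) (g ≤? deg G (nb G v) x))
        where
        cases : ∀ b (dc : Dec (g ≤ deg G (nb G v) x)) → ⟦ b ⟧ * deg G (nb G v) x ≤ ⟦ b ∧ ⌊ dc ⌋ ⟧ * D + ⟦ b ⟧ * g
        cases false _ = z≤n
        cases true (yes _) = ≤-trans (*-monoʳ-≤ 1 (≤-trans (deg≤card G (nb G v) x) (high v))) (m≤m+n _ _)
        cases true (no small) = *-monoʳ-≤ 1 (<⇒≤ (≰⇒> small))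

    contradiction : ⊥
    contradiction = noSub (denseFrame⇒subdivision G r≥1 t≥1
      (Balanced.dense-frame G d D σ (P ∸ 1) (Q ∸ 1) Λ n≥1 low high sparse σ≤D
        (numeric (m+[n∸m]≡n P≥1) (m+[n∸m]≡n Q≥1))))
      where
      -- Chosen so that the foreign ends reached through a further inner vertex number at most
      -- `D⁵ / (d³ P Q) = η³ D τ / P = 1 / N` per walk on average, since `Q = D / τ`.
      P = D * τ * (η * (η * η)) * N
      Q = η * q
      P≥1 : 1 ≤ P
      P≥1 = *-mono-≤ (*-mono-≤ (*-mono-≤ D≥1 τ≥1) (η≥1 ⊛ η≥1 ⊛ η≥1)) N≥1
      Q≥1 : 1 ≤ Q
      Q≥1 = *-mono-≤ η≥1 q≥1

-- Minimal dense graphs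

module Minimal {n : ℕ} (G : Graph n) (w r t : ℕ) (r≥1 : 1 ≤ r) (t≥1 : 1 ≤ t)
  (noClique : ¬ HasClique G (suc w)) (noSub : ¬ ContainsInducedSubdivK r t G) (N d : ℕ) (d≥1 : 1 ≤ d)
  (N≥300 : 300 ≤ N) (N≥Λ : 74 * maderBound r t ≤ N) (N≥a^r : (4 * suc w) ^ r ≤ N) (N≥a^e : (4 * suc w) ^ tupleExp r * (4 * suc w) ^ t ≤ N)
  (balanced : ∀ (S : Sub n) → 1 ≤ ∣ S ∣ → (∀ i → d ≤ ∣ nb (induced G S) i ∣) → (∀ i → ∣ nb (induced G S) i ∣ ≤ N * (N * (N * N ^ (2 * r + 1))) * (N * (N * d))) → ⊥)
  (n≥1 : 1 ≤ n) (dense : N * (N * d) * n ≤ degSum G full) (minimal : ∀ S → ∣ S ∣ < n → degSum G S ≤ N * (N * d) * ∣ S ∣) where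

  s ρ Λ′ K κ : ℕ
  s = N * d
  ρ = N * s
  -- This is `(κ / s) ^ r * N`, as `κ = N * N * s`: the size of `Y` for which `induced-kst` applies
  -- in `many-common`.
  Λ′ = N ^ (2 * r + 1)
  -- Two factors `N` match `A-size`, the third absorbs the 2 in `B-few`; see `surplus-large`.
  K = N * (N * (N * Λ′))
  -- Must exceed the `(72 * Λ + 1) * ρ` of the unbalanced case, whence `74 * maderBound r t ≤ N`.
  κ = N * ρ

  Λ E : ℕ
  Λ = maderBound r t
  E = degSum G full

  private
    a = 4 * suc w

    Λ≥1 : 1 ≤ Λ
    Λ≥1 = *-mono-≤ {1} {2} (s≤s z≤n) (*-mono-≤ (m^n>0 2 (r * t)) (≤-trans r≥1 (m≤m+n r t)))

    N≥ : ∀ k {_ : k ≤ 300} → k ≤ N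
    N≥ k {h} = ≤-trans h N≥300

    N≥1 : 1 ≤ N
    N≥1 = N≥ 1 {s≤s z≤n}

    s≥1 : 1 ≤ s
    s≥1 = *-mono-≤ N≥1 d≥1

    ρ≥1 : 1 ≤ ρ
    ρ≥1 = *-mono-≤ N≥1 s≥1

    Λ′≥1 : 1 ≤ Λ′
    Λ′≥1 = m^n>0 N ⦃ >-nonZero N≥1 ⦄ (2 * r + 1)

    N≤K : N ≤ K
    N≤K = ≤-trans (≤-reflexive (≡-sym (*-identityʳ N))) (*-monoʳ-≤ N (N≥1 ⊛ N≥1 ⊛ Λ′≥1))

    degree : Fin n → ℕ
    degree v = ∣ nb G v ∣

  degree-split : ∀ (S : Sub n) v → degree v ≡ deg G S v + deg G (λ u → not (S u)) v
  degree-split S v = trans (sum-cong-≗ λ u → pt (S u) (adj G v u)) (∑-distrib-+ _ _)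
    where
    pt : ∀ x y → ⟦ y ⟧ ≡ ⟦ x ∧ y ⟧ + ⟦ not x ∧ y ⟧
    pt true y = ≡-sym (+-identityʳ ⟦ y ⟧)
    pt false y = refl

  E≤n*n : E ≤ n * n
  E≤n*n = ≤-trans (≤-reflexive (degSum-full G)) (∑-const-≤ n λ v → card-≤n (nb G v))

  n≥4 : 4 ≤ n
  n≥4 = ≤-trans (≤-trans (N≥ 4 {≤ᵇ⇒≤ 4 300 _}) (≤-trans (≤-reflexive (≡-sym (*-identityʳ N))) (*-monoʳ-≤ N s≥1)))
    (*-cancelʳ-≤ ρ n n ⦃ >-nonZero n≥1 ⦄ (≤-trans dense E≤n*n))

  E-near : ∀ v → E ≤ ρ * n + 2 * degree v
  E-near v = ≤-trans (≤-reflexive (degSum-∖ G full {v} refl)) (+-monoˡ-≤ (2 * degree v)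
    (≤-trans (minimal (full ∖ v) smaller) (*-monoʳ-≤ ρ (card-≤n (full ∖ v)))))
    where
    smaller : ∣ full ∖ v ∣ < n
    smaller = ≤-reflexive (trans (≡-sym (card-∖ full {v} refl)) card-full)

  -- Averaging `E-near` over `v` gives `E ≤ ρ * n + 2 * E / n`, and `n ≥ 4` bounds the last term by
  -- `E / 2`.
  E≤ : E ≤ 2 * ρ * n
  E≤ = *-cancelˡ-≤ n ⦃ >-nonZero n≥1 ⦄ (+-cancelʳ-≤ (n * E) _ _ (begin
    n * E + n * E ≡⟨ lem₁ n E ⟩
    2 * (n * E) ≤⟨ *-monoʳ-≤ 2 (≤-trans (∑-const-≥ E E-near) (≤-reflexive sums)) ⟩
    2 * (n * (ρ * n) + 2 * E) ≡⟨ lem₂ n ρ E ⟩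
    n * (2 * ρ * n) + 4 * E ≤⟨ +-monoʳ-≤ (n * (2 * ρ * n)) (*-monoˡ-≤ E n≥4) ⟩
    n * (2 * ρ * n) + n * E ∎))
    where
    open ≤-Reasoning
    lem₁ : ∀ n E → n * E + n * E ≡ 2 * (n * E)
    lem₁ = solve-∀
    lem₂ : ∀ n ρ E → 2 * (n * (ρ * n) + 2 * E) ≡ n * (2 * ρ * n) + 4 * E
    lem₂ = solve-∀
    const : ∀ c → sum {n} (λ _ → c) ≡ n * c
    const c = ≤-antisym (∑-const-≤ {n} c λ _ → ≤-refl) (∑-const-≥ {n} c λ _ → ≤-refl)
    sums : (∑[ v ] ρ * n + 2 * degree v) ≡ n * (ρ * n) + 2 * E
    sums = trans (∑-distrib-+ {n} (λ _ → ρ * n) (λ v → 2 * degree v)) (cong₂ _+_ (const (ρ * n)) (trans (≡-sym (∑-*ˡ 2 degree)) (cong (2 *_) (≡-sym (degSum-full G)))))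

  above : ℕ → Sub n
  above m v = ⌊ m <? degree v ⌋

  above-few : ∀ m → m * ∣ above m ∣ ≤ 2 * ρ * n
  above-few m = ≤-trans (≤-reflexive (*-comm m ∣ above m ∣)) (≤-trans (∑-sub-≥ (above m) {degree} m (λ v p → <⇒≤ (⌊⌋-elim (m <? degree v) p)))
    (≤-trans (∑-mono λ v → ≤-trans (*-monoˡ-≤ (degree v) (⟦⟧≤1 (above m v))) (≤-reflexive (*-identityˡ _))) (≤-trans (≤-reflexive (≡-sym (degSum-full G))) E≤)))

  above-scaled : ∀ c → c * ∣ above (c * ρ) ∣ ≤ 2 * n
  above-scaled c = *-cancelˡ-≤ ρ ⦃ >-nonZero ρ≥1 ⦄ (≤-trans (≤-reflexive (lem ρ c _)) (≤-trans (above-few (c * ρ)) (≤-reflexive (lem′ ρ n))))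
    where
    lem : ∀ ρ c x → ρ * (c * x) ≡ c * ρ * x
    lem = solve-∀
    lem′ : ∀ ρ n → 2 * ρ * n ≡ ρ * (2 * n)
    lem′ = solve-∀

  proper : ∀ (S : Sub n) c → 3 ≤ c → c * ∣ S ∣ ≤ 2 * n → ∣ S ∣ < n
  proper S c c≥3 h = ≰⇒> λ q → <⇒≱ (*-monoˡ-< n ⦃ >-nonZero n≥1 ⦄ (n<1+n 2)) (≤-trans (*-mono-≤ c≥3 q) h)

  -- The lower cutoff `16 * ρ` serves the set `A`: as `A` avoids `C`, its vertices have degree at
  -- most `16 * ρ` into `B`, which becomes `Δ` in the unbalanced case.
  B L C : Sub n
  B = above (K * ρ)
  L v = not (B v)
  C = above (16 * ρ)

  B-few : K * ∣ B ∣ ≤ 2 * n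
  B-few = above-scaled K

  B-proper : ∣ B ∣ < n
  B-proper = proper B K (≤-trans (N≥ 3 {≤ᵇ⇒≤ 3 300 _}) N≤K) B-few

  C-few : 16 * ∣ C ∣ ≤ 2 * n
  C-few = above-scaled 16

  L-degree : ∀ v → L v ≡ true → degree v ≤ K * ρ
  L-degree v p = ≮⇒≥ λ q → true≢false (⌊⌋-intro (K * ρ <? degree v) q) (not-elim p)

  core-degrees : ∀ T → (∀ v → T v ≡ true → d < deg G T v) → (∀ {v} → T v ≡ true → L v ≡ true) → 1 ≤ ∣ T ∣ → ⊥
  core-degrees T core T⊆ T≥1 = balanced T T≥1
    (λ i → ≤-trans (<⇒≤ (core _ (enum-∈ T i))) (≤-reflexive (≡-sym (induced-deg G T i))))
    (λ i → ≤-trans (≤-reflexive (induced-deg G T i)) (≤-trans (card-mono {S = T ∩ nb G (enum T i)} {T = nb G (enum T i)} λ {u} p → ∧-elimʳ {T u} p)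
      (L-degree _ (T⊆ (enum-∈ T i)))))

  -- If `L` peels at `d`, its degree sum is at most `2 * d * n`, which is small enough. Otherwise a
  -- core of `L` has all degrees between `d` and `K * ρ`, against `balanced`.
  inside-few : N * degSum G L < ρ * n
  inside-few with N * degSum G L <? ρ * n
  ... | yes p = p
  ... | no ¬p with peel-or-core G d L
  ... | inj₂ (T , T⊆ , T≥1 , core) = ⊥-elim (core-degrees T core T⊆ T≥1)
  ... | inj₁ peel = ⊥-elim (<⇒≱ (*-monoˡ-< (N * d * n) ⦃ >-nonZero (*-mono-≤ s≥1 n≥1) ⦄ (N≥ 3 {≤ᵇ⇒≤ 3 300 _})) (begin
    N * (N * d * n) ≡⟨ lem N d n ⟩
    ρ * n ≤⟨ ≮⇒≥ ¬p ⟩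
    N * degSum G L ≤⟨ *-monoʳ-≤ N (≤-trans (peel-degSum G peel) (*-monoʳ-≤ (2 * d) (card-≤n L))) ⟩
    N * (2 * d * n) ≡⟨ lem′ N d n ⟩
    2 * (N * d * n) ∎))
    where
    open ≤-Reasoning
    lem : ∀ N d n → N * (N * d * n) ≡ N * (N * d) * n
    lem = solve-∀
    lem′ : ∀ N d n → N * (2 * d * n) ≡ 2 * (N * d * n)
    lem′ = solve-∀

  between : ℕ
  between = ∑[ v ] ⟦ L v ⟧ * deg G B v

  between-sym : (∑[ v ] ⟦ B v ⟧ * deg G L v) ≡ between
  between-sym = trans (sum-cong-≗ λ v → trans (cong (⟦ B v ⟧ *_) (deg-∑ G L v)) (∑-*ˡ ⟦ B v ⟧ _)) (trans (∑-swap _)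
    (sum-cong-≗ λ u → trans (sum-cong-≗ λ v → trans (x∙yz≈y∙xz ⟦ B v ⟧ ⟦ L u ⟧ _) (cong (λ b → ⟦ L u ⟧ * (⟦ B v ⟧ * ⟦ b ⟧)) (Graph.sym G v u)))
      (trans (≡-sym (∑-*ˡ ⟦ L u ⟧ _)) (cong (⟦ L u ⟧ *_) (≡-sym (deg-∑ G B u))))))

  E-split : E ≡ degSum G L + between + (between + degSum G B)
  E-split = begin
    E ≡⟨ degSum-full G ⟩
    (∑[ v ] degree v) ≡⟨ sum-cong-≗ pt ⟩
    (∑[ v ] (⟦ L v ⟧ * deg G L v + ⟦ L v ⟧ * deg G B v) + (⟦ B v ⟧ * deg G L v + ⟦ B v ⟧ * deg G B v))
      ≡⟨ trans (∑-distrib-+ _ _) (cong₂ _+_ (∑-distrib-+ _ _) (∑-distrib-+ _ _)) ⟩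
    degSum G L + between + ((∑[ v ] ⟦ B v ⟧ * deg G L v) + degSum G B) ≡⟨ cong (λ z → degSum G L + between + (z + degSum G B)) between-sym ⟩
    degSum G L + between + (between + degSum G B) ∎
    where
    open ≡-Reasoning
    pt : ∀ v → degree v ≡ (⟦ L v ⟧ * deg G L v + ⟦ L v ⟧ * deg G B v) + (⟦ B v ⟧ * deg G L v + ⟦ B v ⟧ * deg G B v)
    pt v = trans (degree-split B v) (cases (B v) (deg G L v) (deg G B v))
      where
      cases : ∀ b x y → y + x ≡ (⟦ not b ⟧ * x + ⟦ not b ⟧ * y) + (⟦ b ⟧ * x + ⟦ b ⟧ * y)
      cases true = lem
        where
        lem : ∀ x y → y + x ≡ (0 * x + 0 * y) + (1 * x + 1 * y)
        lem = solve-∀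
      cases false = lem
        where
        lem : ∀ x y → y + x ≡ (1 * x + 1 * y) + (0 * x + 0 * y)
        lem = solve-∀

  -- Few edges leave C, so the edges between L and B are mostly seen from the set A₀.
  A₀ : Sub n
  A₀ v = (L v ∧ not (C v)) ∧ (⌊ N * deg G L v ≤? 16 * (16 * ρ) ⌋ ∧ ⌊ ρ ≤? 16 * deg G B v ⌋)

  private
    -- Here `X` is `ρ * n` and `Y` is `ρ * ∣ A₀ ∣`. In `64 * E` everything not charged to `A₀`
    -- amounts to at most `38 * X`, so `Y` must pay for the rest.
    bookkeeping : ∀ X Y E dL dB bt S₁ S₂ → X ≤ E → E ≡ dL + bt + (bt + dB) → 16 * dL ≤ X → 32 * dB ≤ X → bt ≡ S₁ + S₂ →
      8 * S₁ ≤ X → 16 * S₂ ≤ X + 16 * (16 * Y) + X → X ≤ 128 * Y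
    bookkeeping X Y E dL dB bt S₁ S₂ h refl hL hB refl h₁ h₂ = *-cancelˡ-≤ 16 (+-cancelʳ-≤ (48 * X) _ _ (begin
      16 * X + 48 * X ≡⟨ lem₀ X ⟩
      64 * X ≤⟨ *-monoʳ-≤ 64 h ⟩
      64 * (dL + (S₁ + S₂) + ((S₁ + S₂) + dB)) ≡⟨ lem₁ dL dB S₁ S₂ ⟩
      4 * (16 * dL) + 2 * (32 * dB) + 16 * (8 * S₁) + 8 * (16 * S₂) ≤⟨ +-mono-≤ (+-mono-≤ (+-mono-≤ (*-monoʳ-≤ 4 hL) (*-monoʳ-≤ 2 hB)) (*-monoʳ-≤ 16 h₁)) (*-monoʳ-≤ 8 h₂) ⟩
      -- The `38 * X` is rounded up to `48 * X` so that 16 can be cancelled.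
      4 * X + 2 * X + 16 * X + 8 * (X + 16 * (16 * Y) + X) ≤⟨ m≤m+n _ (10 * X) ⟩
      4 * X + 2 * X + 16 * X + 8 * (X + 16 * (16 * Y) + X) + 10 * X ≡⟨ lem₂ X Y ⟩
      16 * (128 * Y) + 48 * X ∎))
      where
      open ≤-Reasoning
      lem₀ : ∀ X → 16 * X + 48 * X ≡ 64 * X
      lem₀ = solve-∀
      lem₁ : ∀ a b c d → 64 * (a + (c + d) + ((c + d) + b)) ≡ 4 * (16 * a) + 2 * (32 * b) + 16 * (8 * c) + 8 * (16 * d)
      lem₁ = solve-∀
      lem₂ : ∀ X Y → 4 * X + 2 * X + 16 * X + 8 * (X + 16 * (16 * Y) + X) + 10 * X ≡ 16 * (128 * Y) + 48 * X
      lem₂ = solve-∀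

    S₁ S₂ : ℕ
    S₁ = ∑[ v ] ⟦ L v ∧ C v ⟧ * deg G B v
    S₂ = ∑[ v ] ⟦ L v ∧ not (C v) ⟧ * deg G B v

    between-split : between ≡ S₁ + S₂
    between-split = trans (sum-cong-≗ λ v → trans (cong (_* deg G B v) (∩-split (L v) (C v))) (*-distribʳ-+ (deg G B v) ⟦ L v ∧ C v ⟧ ⟦ L v ∧ not (C v) ⟧)) (∑-distrib-+ _ _)

    B⊆C : ∀ {v} → B v ≡ true → C v ≡ true
    B⊆C {v} p = ⌊⌋-intro (16 * ρ <? degree v) (≤-<-trans (*-monoˡ-≤ ρ (≤-trans (N≥ 16 {≤ᵇ⇒≤ 16 300 _}) N≤K)) (⌊⌋-elim (K * ρ <? degree v) p))

    deg≤degree : ∀ S v → deg G S v ≤ degree v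
    deg≤degree S v = card-mono {S = S ∩ nb G v} {T = nb G v} λ {u} p → ∧-elimʳ {S u} p

    S₁-small : 8 * S₁ ≤ ρ * n
    S₁-small = begin
      8 * S₁ ≤⟨ *-monoʳ-≤ 8 (∑-mono pt) ⟩
      8 * degSum G C ≤⟨ *-monoʳ-≤ 8 (minimal C (proper C 16 (≤ᵇ⇒≤ 3 16 _) C-few)) ⟩
      8 * (ρ * ∣ C ∣) ≡⟨ lem ρ ∣ C ∣ ⟩
      ρ * (8 * ∣ C ∣) ≤⟨ *-monoʳ-≤ ρ (*-cancelˡ-≤ 2 (≤-trans (≤-reflexive (lem′ ∣ C ∣)) C-few)) ⟩
      ρ * n ∎
      where
      open ≤-Reasoning
      lem : ∀ ρ c → 8 * (ρ * c) ≡ ρ * (8 * c)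
      lem = solve-∀
      lem′ : ∀ c → 2 * (8 * c) ≡ 16 * c
      lem′ = solve-∀
      pt : ∀ v → ⟦ L v ∧ C v ⟧ * deg G B v ≤ ⟦ C v ⟧ * deg G C v
      pt v = *-mono-≤ (⟦⟧-le (L v ∧ C v) λ p → one (∧-elimʳ {L v} p)) (deg-mono G B⊆C v)

    -- A vertex outside `C` has degree at most `16 * ρ`. Outside `A₀`, either its degree into `B` is
    -- below `ρ / 16`, or `N` times its degree into `L` exceeds `16 * (16 * ρ)`; the three summands
    -- pay for these cases and for `A₀`.
    S₂-small : 16 * S₂ ≤ ρ * n + 16 * (16 * (ρ * ∣ A₀ ∣)) + ρ * n
    S₂-small = begin
      16 * S₂ ≡⟨ ∑-*ˡ 16 _ ⟩
      (∑[ v ] 16 * (⟦ L v ∧ not (C v) ⟧ * deg G B v)) ≤⟨ ∑-mono pt ⟩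
      (∑[ v ] (1 * ρ + ⟦ A₀ v ⟧ * (16 * (16 * ρ))) + N * (⟦ L v ⟧ * deg G L v))
        ≡⟨ trans (∑-distrib-+ _ _) (cong₂ _+_ (trans (∑-distrib-+ _ _) (cong₂ _+_ (≡-sym (∑-*ʳ ρ _)) (≡-sym (∑-*ʳ _ _)))) (≡-sym (∑-*ˡ N _))) ⟩
      sum {n} (λ _ → 1) * ρ + ∣ A₀ ∣ * (16 * (16 * ρ)) + N * degSum G L ≤⟨ +-mono-≤ (≤-reflexive (cong₂ _+_ (trans (cong (_* ρ) (card-full {n})) (*-comm n ρ)) (lem ∣ A₀ ∣ ρ))) (<⇒≤ inside-few) ⟩
      ρ * n + 16 * (16 * (ρ * ∣ A₀ ∣)) + ρ * n ∎
      where
      open ≤-Reasoning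
      lem : ∀ a ρ → a * (16 * (16 * ρ)) ≡ 16 * (16 * (ρ * a))
      lem = solve-∀
      pt : ∀ v → 16 * (⟦ L v ∧ not (C v) ⟧ * deg G B v) ≤ (1 * ρ + ⟦ A₀ v ⟧ * (16 * (16 * ρ))) + N * (⟦ L v ⟧ * deg G L v)
      pt v = cases (L v) (16 * ρ <? degree v) (N * deg G L v ≤? 16 * (16 * ρ)) (ρ ≤? 16 * deg G B v)
        where
        cases : ∀ l (c : Dec (16 * ρ < degree v)) (x : Dec (N * deg G L v ≤ 16 * (16 * ρ))) (y : Dec (ρ ≤ 16 * deg G B v)) →
          16 * (⟦ l ∧ not ⌊ c ⌋ ⟧ * deg G B v) ≤ (1 * ρ + ⟦ (l ∧ not ⌊ c ⌋) ∧ (⌊ x ⌋ ∧ ⌊ y ⌋) ⟧ * (16 * (16 * ρ))) + N * (⟦ l ⟧ * deg G L v)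
        cases false c x y = ≤-trans (≤-reflexive (*-zeroʳ 16)) z≤n
        cases true (yes _) x y = ≤-trans (≤-reflexive (*-zeroʳ 16)) z≤n
        cases true (no c) x (no y) = ≤-trans (≤-trans (≤-reflexive (cong (16 *_) (*-identityˡ (deg G B v)))) (<⇒≤ (≰⇒> y))) (≤-trans (≤-reflexive (≡-sym (*-identityˡ ρ))) (≤-trans (m≤m+n (1 * ρ) _) (m≤m+n _ _)))
        cases true (no c) (yes x) (yes y) = ≤-trans (≤-trans (≤-reflexive (cong (16 *_) (*-identityˡ (deg G B v)))) (*-monoʳ-≤ 16 (≤-trans (deg≤degree B v) (≮⇒≥ c))))
          (≤-trans (≤-reflexive (≡-sym (*-identityˡ (16 * (16 * ρ))))) (≤-trans (m≤n+m _ (1 * ρ)) (m≤m+n _ _)))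
        cases true (no c) (no x) (yes y) = ≤-trans (≤-trans (≤-reflexive (cong (16 *_) (*-identityˡ (deg G B v)))) (*-monoʳ-≤ 16 (≤-trans (deg≤degree B v) (≮⇒≥ c))))
          (≤-trans (<⇒≤ (≰⇒> x)) (≤-trans (≤-reflexive (cong (N *_) (≡-sym (*-identityˡ (deg G L v))))) (m≤n+m _ _)))

  A₀-many : n ≤ 128 * ∣ A₀ ∣
  A₀-many = *-cancelˡ-≤ ρ ⦃ >-nonZero ρ≥1 ⦄ (≤-trans (bookkeeping (ρ * n) (ρ * ∣ A₀ ∣) E (degSum G L) (degSum G B) between S₁ S₂ dense E-split
    (≤-trans (*-monoˡ-≤ (degSum G L) (N≥ 16 {≤ᵇ⇒≤ 16 300 _})) (<⇒≤ inside-few)) B-small between-split S₁-small S₂-small) (≤-reflexive (lem ρ ∣ A₀ ∣)))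
    where
    open ≤-Reasoning
    lem : ∀ ρ a → 128 * (ρ * a) ≡ ρ * (128 * a)
    lem = solve-∀
    lem′ : ∀ ρ b → 32 * (ρ * b) ≡ ρ * (32 * b)
    lem′ = solve-∀
    lem″ : ∀ b → 2 * (32 * b) ≡ 64 * b
    lem″ = solve-∀
    B-small : 32 * degSum G B ≤ ρ * n
    B-small = begin
      32 * degSum G B ≤⟨ *-monoʳ-≤ 32 (minimal B B-proper) ⟩
      32 * (ρ * ∣ B ∣) ≡⟨ lem′ ρ ∣ B ∣ ⟩
      ρ * (32 * ∣ B ∣) ≤⟨ *-monoʳ-≤ ρ (*-cancelˡ-≤ 2 (≤-trans (≤-reflexive (lem″ ∣ B ∣)) (≤-trans (*-monoˡ-≤ ∣ B ∣ (≤-trans (N≥ 64 {≤ᵇ⇒≤ 64 300 _}) N≤K)) B-few))) ⟩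
      ρ * n ∎

  A₀-inside : ∀ v → A₀ v ≡ true → deg G A₀ v ≤ 16 * (16 * s)
  A₀-inside v p = *-cancelˡ-≤ N ⦃ >-nonZero N≥1 ⦄ (begin
    N * deg G A₀ v ≤⟨ *-monoʳ-≤ N (deg-mono G (λ {u} q → ∧-elimˡ {L u} (∧-elimˡ {L u ∧ not (C u)} q)) v) ⟩
    N * deg G L v ≤⟨ ⌊⌋-elim (N * deg G L v ≤? 16 * (16 * ρ)) (∧-elimˡ (∧-elimʳ {L v ∧ not (C v)} p)) ⟩
    16 * (16 * (N * s)) ≡⟨ lem N s ⟩
    N * (16 * (16 * s)) ∎)
    where
    open ≤-Reasoning
    lem : ∀ N s → 16 * (16 * (N * s)) ≡ N * (16 * (16 * s))
    lem = solve-∀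

  module _ (A : Sub n) (A⊆ : ∀ {v} → A v ≡ true → A₀ v ≡ true) (A-indep : ∀ {u v} → A u ≡ true → A v ≡ true → adj G u v ≡ false)
    (A-large : ∣ A₀ ∣ ≤ suc (16 * (16 * s)) * ∣ A ∣) where
    private
      open ≤-Reasoning
      lem₁ : ∀ ρ → 2 * (16 * ρ + (ρ + ρ)) ≡ 36 * ρ
      lem₁ = solve-∀
      lem₂ : ∀ Λ ρ → 2 * (Λ * (36 * ρ)) + ρ ≡ (72 * Λ + 1) * ρ
      lem₂ = solve-∀
      P≡ : suc (36 * ρ ∸ 1) ≡ 36 * ρ
      P≡ = m+[n∸m]≡n (*-mono-≤ {1} {36} (s≤s z≤n) ρ≥1)
      κ-large : 2 * (Λ * (36 * ρ)) + ρ < κ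
      κ-large = begin-strict
        2 * (Λ * (36 * ρ)) + ρ ≡⟨ lem₂ Λ ρ ⟩
        (72 * Λ + 1) * ρ <⟨ *-monoˡ-< ρ ⦃ >-nonZero ρ≥1 ⦄ (≤-trans (s≤s (+-monoʳ-≤ (72 * Λ) Λ≥1)) (≤-trans (+-monoˡ-≤ (72 * Λ + Λ) Λ≥1) (≤-trans (≤-reflexive (lem Λ)) N≥Λ))) ⟩
        N * ρ ∎
        where
        lem : ∀ Λ → Λ + (72 * Λ + Λ) ≡ 74 * Λ
        lem = solve-∀

      A-in-A₀ : ∀ {v} → A v ≡ true → (L v ∧ not (C v)) ≡ true × ρ ≤ 16 * deg G B v
      A-in-A₀ {v} p = ∧-elimˡ (A⊆ p) , ⌊⌋-elim (ρ ≤? 16 * deg G B v) (∧-elimʳ {⌊ N * deg G L v ≤? 16 * (16 * ρ) ⌋} (∧-elimʳ {L v ∧ not (C v)} (A⊆ p)))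

      A-in-L : ∀ {v} → A v ≡ true → L v ≡ true
      A-in-L p = ∧-elimˡ (proj₁ (A-in-A₀ p))

      A-size : n ≤ N * (N * (s * ∣ A ∣))
      A-size = begin
        n ≤⟨ A₀-many ⟩
        -- Both 128 and the 257 that bounds `suc (16 * (16 * s))` in units of `s` are covered by
        -- `300 ≤ N`.
        128 * ∣ A₀ ∣ ≤⟨ *-mono-≤ (N≥ 128 {≤ᵇ⇒≤ 128 300 _}) A-large ⟩
        N * (suc (16 * (16 * s)) * ∣ A ∣) ≤⟨ *-monoʳ-≤ N (*-monoˡ-≤ ∣ A ∣ (≤-trans (+-monoˡ-≤ (16 * (16 * s)) s≥1) (≤-trans (≤-reflexive (lem s)) (*-monoˡ-≤ s (N≥ 257 {≤ᵇ⇒≤ 257 300 _}))))) ⟩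
        N * (N * s * ∣ A ∣) ≡⟨ cong (N *_) (*-assoc N s ∣ A ∣) ⟩
        N * (N * (s * ∣ A ∣)) ∎
        where
        lem : ∀ s → s + 16 * (16 * s) ≡ 257 * s
        lem = solve-∀

      sA≥1 : 1 ≤ s * ∣ A ∣
      sA≥1 = n≢0⇒n>0 λ e → <⇒≱ n≥1 (≤-trans A-size (≤-reflexive (trans (cong (λ z → N * (N * z)) e) (trans (cong (N *_) (*-zeroʳ N)) (*-zeroʳ N)))))

      -- A vertex of `A` has degree at least `ρ / 16`, hence at least `2 * s`, into `B` and
      -- contributes `s` to the surplus. By `A-size` there are at least `n / (N² s)` of them, while
      -- `∣ B ∣` is at most `2 * n / K`.
      surplus-large : Λ′ * ∣ B ∣ < Prune.surplus G A s Λ′ B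
      surplus-large = *-cancelˡ-< N _ _ (*-cancelˡ-< N _ _ (*-cancelˡ-< N _ _ (begin-strict
        N * (N * (N * (Λ′ * ∣ B ∣))) ≡⟨ lem N Λ′ ∣ B ∣ ⟩
        K * ∣ B ∣ ≤⟨ B-few ⟩
        2 * n ≤⟨ *-monoʳ-≤ 2 A-size ⟩
        2 * (N * (N * (s * ∣ A ∣))) ≡⟨ lem′ N (s * ∣ A ∣) ⟩
        N * (N * (2 * (s * ∣ A ∣))) <⟨ *-monoʳ-< N ⦃ >-nonZero N≥1 ⦄ (*-monoʳ-< N ⦃ >-nonZero N≥1 ⦄ (*-monoˡ-< (s * ∣ A ∣) ⦃ >-nonZero sA≥1 ⦄ (N≥ 3 {≤ᵇ⇒≤ 3 300 _}))) ⟩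
        N * (N * (N * (s * ∣ A ∣))) ≤⟨ *-monoʳ-≤ N (*-monoʳ-≤ N (*-monoʳ-≤ N (≤-trans (≤-reflexive (*-comm s ∣ A ∣)) (∑-sub-≥ A s enough)))) ⟩
        N * (N * (N * Prune.surplus G A s Λ′ B)) ∎)))
        where
        lem : ∀ N l b → N * (N * (N * (l * b))) ≡ N * (N * (N * l)) * b
        lem = solve-∀
        lem′ : ∀ N x → 2 * (N * (N * x)) ≡ N * (N * (2 * x))
        lem′ = solve-∀
        lem″ : ∀ s → 16 * (s + s) ≡ 32 * s
        lem″ = solve-∀
        enough : ∀ v → A v ≡ true → s ≤ deg G B v ∸ s
        enough v p = m+n≤o⇒m≤o∸n s (*-cancelˡ-≤ 16 (≤-trans (≤-reflexive (lem″ s)) (≤-trans (*-monoˡ-≤ s (N≥ 32 {≤ᵇ⇒≤ 32 300 _})) (proj₂ (A-in-A₀ p)))))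

    module _ (B₁ : Sub n) (B₁⊆ : ∀ {v} → B₁ v ≡ true → B v ≡ true) (B₁≥1 : 1 ≤ ∣ B₁ ∣) (B₁-rich : ∀ b → B₁ b ≡ true → Λ′ < ∣ Prune.rich G A s Λ′ B₁ b ∣) where
      private
        B₁-proper : ∣ B₁ ∣ < n
        B₁-proper = ≤-<-trans (card-mono B₁⊆) B-proper

        A-low : ∀ a → A a ≡ true → deg G B₁ a ≤ 16 * ρ
        A-low a p = ≤-trans (deg≤degree B₁ a) (≮⇒≥ λ q → true≢false (⌊⌋-intro (16 * ρ <? degree a) q) (not-elim (∧-elimʳ {L a} (proj₁ (A-in-A₀ p)))))

        -- A `Core` inside `B₁` would be a smaller induced subgraph, denser than minimality allows.
        orientation : Orientation G ρ B₁
        orientation with peel-or-core G ρ B₁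
        ... | inj₁ peel = peel-orientation G peel
        ... | inj₂ (T , T⊆ , T≥1 , core) = ⊥-elim (<⇒≱ (*-monoʳ-< ∣ T ∣ ⦃ >-nonZero T≥1 ⦄ (n<1+n ρ))
          (≤-trans (∑-sub-≥ T (suc ρ) core) (≤-trans (minimal T (≤-<-trans (card-mono T⊆) B₁-proper)) (≤-reflexive (*-comm ρ ∣ T ∣)))))

        -- Each of the more than `Λ′` rich neighbours of `b` has over `s` neighbours in `B₁`, all of
        -- which share it with `b`. If only `κ` vertices shared a neighbour with `b`, `induced-kst`
        -- would apply.
        many-common : ∀ b → B₁ b ≡ true → κ < (∑[ b′ ] ⟦ B₁ b′ ∧ ⌊ FP.any? (λ a → (A a B.≟ true) ×-dec (adj G b a B.≟ true) ×-dec (adj G a b′ B.≟ true)) ⌋ ⟧)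
        many-common b b∈ = ≰⇒> λ few → induced-kst G w r t noClique noSub X Y s κ
          (≤-trans N≥a^r (≤-trans (≤-reflexive (≡-sym (*-identityʳ N))) (*-monoʳ-≤ N d≥1))) (*-mono-≤ N≥1 ρ≥1) few see (begin
            a ^ tupleExp r * (κ ^ r * a ^ t) ≡⟨ cong (λ z → a ^ tupleExp r * (z * a ^ t)) (trans (^-*-distrib N (N * s) r) (cong (N ^ r *_) (^-*-distrib N s r))) ⟩
            a ^ tupleExp r * (N ^ r * (N ^ r * s ^ r) * a ^ t) ≡⟨ lem (a ^ tupleExp r) (N ^ r) (s ^ r) (a ^ t) ⟩
            N ^ r * N ^ r * (a ^ tupleExp r * a ^ t) * s ^ r ≤⟨ *-monoˡ-≤ (s ^ r) (*-monoʳ-≤ (N ^ r * N ^ r) N≥a^e) ⟩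
            N ^ r * N ^ r * N * s ^ r ≡⟨ cong (_* s ^ r) power ⟨
            Λ′ * s ^ r ≤⟨ *-monoˡ-≤ (s ^ r) (<⇒≤ (B₁-rich b b∈)) ⟩
            ∣ Y ∣ * s ^ r ∎)
          where
          lem : ∀ x y z t → x * (y * (y * z) * t) ≡ y * y * (x * t) * z
          lem = solve-∀
          power : Λ′ ≡ N ^ r * N ^ r * N
          power = trans (^-distribˡ-+-* N (2 * r) 1) (cong₂ _*_ (trans (cong (N ^_) (cong (r +_) (+-identityʳ r))) (^-distribˡ-+-* N r r)) (*-identityʳ N))
          X Y : Sub n
          X b′ = B₁ b′ ∧ ⌊ FP.any? (λ a → (A a B.≟ true) ×-dec (adj G b a B.≟ true) ×-dec (adj G a b′ B.≟ true)) ⌋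
          Y = Prune.rich G A s Λ′ B₁ b
          see : ∀ y → Y y ≡ true → s ≤ ∣ X ∩ nb G y ∣
          see y p = ≤-trans (<⇒≤ (⌊⌋-elim (s <? deg G B₁ y) (∧-elimʳ {adj G b y} (∧-elimʳ {A y} p)))) (card-mono {S = B₁ ∩ nb G y} {T = X ∩ nb G y} λ {u} q →
            ∧-intro (∧-intro (∧-elimˡ q) (⌊⌋-intro (FP.any? (λ a → (A a B.≟ true) ×-dec (adj G b a B.≟ true) ×-dec (adj G a u B.≟ true)))
              (y , ∧-elimˡ p , ∧-elimˡ (∧-elimʳ {A y} p) , ∧-elimʳ {B₁ u} q))) (∧-elimʳ {B₁ u} q))

      pruned-contradiction : ⊥
      pruned-contradiction = noSub (denseFrame⇒subdivision G r≥1 t≥1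
        (Unbalanced.dense-frame G Λ κ (16 * ρ) ρ (36 * ρ ∸ 1) A B₁ A-indep (λ a b → true≢false (B₁⊆ b) (not-elim (A-in-L a)))
          A-low orientation (minimal B₁ B₁-proper) B₁≥1 many-common
          (≤-reflexive (trans (lem₁ ρ) (≡-sym P≡))) (subst (λ P → 2 * (Λ * P) + ρ < κ) (≡-sym P≡) κ-large)))

    independent-contradiction : ⊥
    independent-contradiction = let B₁ , B₁⊆ , B₁≥1 , B₁-rich = Prune.prune G A s Λ′ B surplus-large in pruned-contradiction B₁ B₁⊆ B₁≥1 B₁-rich

  contradiction : ⊥
  contradiction = let A , A⊆ , A-indep , A-large = large-independent G (16 * (16 * s)) A₀ A₀-inside in independent-contradiction A A⊆ A-indep A-large

-- Polynomials

IsPolynomial : (ℕ → ℕ) → Set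
IsPolynomial f = Σ (List ℕ) λ p → ∀ x → evalPoly p x ≡ f x

addPoly : List ℕ → List ℕ → List ℕ
addPoly [] q = q
addPoly (a ∷ p) [] = a ∷ p
addPoly (a ∷ p) (b ∷ q) = a + b ∷ addPoly p q

evalPoly-add : ∀ p q x → evalPoly (addPoly p q) x ≡ evalPoly p x + evalPoly q x
evalPoly-add [] q x = refl
evalPoly-add (a ∷ p) [] x = ≡-sym (+-identityʳ _)
evalPoly-add (a ∷ p) (b ∷ q) x = trans (cong (λ z → a + b + x * z) (evalPoly-add p q x)) (lem a b x (evalPoly p x) (evalPoly q x))
  where
  lem : ∀ a b x u v → a + b + x * (u + v) ≡ a + x * u + (b + x * v)
  lem = solve-∀

scalePoly : ℕ → List ℕ → List ℕ
scalePoly a [] = []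
scalePoly a (b ∷ q) = a * b ∷ scalePoly a q

evalPoly-scale : ∀ a q x → evalPoly (scalePoly a q) x ≡ a * evalPoly q x
evalPoly-scale a [] x = ≡-sym (*-zeroʳ a)
evalPoly-scale a (b ∷ q) x = trans (cong (λ z → a * b + x * z) (evalPoly-scale a q x)) (lem a b x (evalPoly q x))
  where
  lem : ∀ a b x v → a * b + x * (a * v) ≡ a * (b + x * v)
  lem = solve-∀

mulPoly : List ℕ → List ℕ → List ℕ
mulPoly [] q = []
mulPoly (a ∷ p) q = addPoly (scalePoly a q) (0 ∷ mulPoly p q)

evalPoly-mul : ∀ p q x → evalPoly (mulPoly p q) x ≡ evalPoly p x * evalPoly q x
evalPoly-mul [] q x = refl
evalPoly-mul (a ∷ p) q x = trans (evalPoly-add (scalePoly a q) (0 ∷ mulPoly p q) x)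
  (trans (cong₂ (λ u v → u + (0 + x * v)) (evalPoly-scale a q x) (evalPoly-mul p q x)) (lem a x (evalPoly p x) (evalPoly q x)))
  where
  lem : ∀ a x u v → a * v + (0 + x * (u * v)) ≡ (a + x * u) * v
  lem = solve-∀

constᵖ : ∀ c → IsPolynomial (λ _ → c)
constᵖ c = c ∷ [] , λ x → trans (cong (c +_) (*-zeroʳ x)) (+-identityʳ c)

idᵖ : IsPolynomial (λ x → x)
idᵖ = 0 ∷ 1 ∷ [] , λ x → lem x
  where
  lem : ∀ x → 0 + x * (1 + x * 0) ≡ x
  lem = solve-∀

_+ᵖ_ : ∀ {f g} → IsPolynomial f → IsPolynomial g → IsPolynomial (λ x → f x + g x)
(p , hp) +ᵖ (q , hq) = addPoly p q , λ x → trans (evalPoly-add p q x) (cong₂ _+_ (hp x) (hq x))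

_*ᵖ_ : ∀ {f g} → IsPolynomial f → IsPolynomial g → IsPolynomial (λ x → f x * g x)
(p , hp) *ᵖ (q , hq) = mulPoly p q , λ x → trans (evalPoly-mul p q x) (cong₂ _*_ (hp x) (hq x))

_^ᵖ_ : ∀ {f} → IsPolynomial f → ∀ k → IsPolynomial (λ x → f x ^ k)
_^ᵖ_ p zero = constᵖ 1
_^ᵖ_ p (suc k) = p *ᵖ (p ^ᵖ k)

infixr 6 _+ᵖ_
infixr 7 _*ᵖ_
infixr 8 _^ᵖ_

-- The degree bound

-- The parameters of `Minimal` and `BalancedCase` as functions of `N` alone, so that polynomiality
-- is proved apart from any graph.
module Threshold (r t : ℕ) (N : ℕ) where
  Λ η τ σ g q d ρ : ℕ
  Λ = maderBound r t
  -- The vertices of `L` have degree at most `K * ρ = K * (N * N) * d`, so this is the ratio `D / d`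
  -- that the balanced case has to bear.
  η = N * (N * (N * N ^ (2 * r + 1))) * (N * N)
  τ = Λ * (η * (η * (η * (η * (η * η))))) * (N * N)
  σ = N * (η * (η * η)) * (τ * τ)
  g = N * (2 * σ) ^ r
  q = 2 * (N * (η * η) * τ * g)
  d = τ * q
  ρ = N * (N * d)

threshold-polynomial : ∀ r t {N : ℕ → ℕ} → IsPolynomial N → IsPolynomial (λ w → Threshold.ρ r t (N w))
threshold-polynomial r t {N} Nᵖ = Nᵖ *ᵖ Nᵖ *ᵖ τᵖ *ᵖ qᵖ
  where
  ηᵖ : IsPolynomial (λ w → Threshold.η r t (N w))
  ηᵖ = (Nᵖ *ᵖ Nᵖ *ᵖ Nᵖ *ᵖ Nᵖ ^ᵖ (2 * r + 1)) *ᵖ Nᵖ *ᵖ Nᵖ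
  τᵖ : IsPolynomial (λ w → Threshold.τ r t (N w))
  τᵖ = (constᵖ (maderBound r t) *ᵖ ηᵖ *ᵖ ηᵖ *ᵖ ηᵖ *ᵖ ηᵖ *ᵖ ηᵖ *ᵖ ηᵖ) *ᵖ Nᵖ *ᵖ Nᵖ
  σᵖ : IsPolynomial (λ w → Threshold.σ r t (N w))
  σᵖ = (Nᵖ *ᵖ ηᵖ *ᵖ ηᵖ *ᵖ ηᵖ) *ᵖ τᵖ *ᵖ τᵖ
  gᵖ : IsPolynomial (λ w → Threshold.g r t (N w))
  gᵖ = Nᵖ *ᵖ (constᵖ 2 *ᵖ σᵖ) ^ᵖ r
  qᵖ : IsPolynomial (λ w → Threshold.q r t (N w))
  qᵖ = constᵖ 2 *ᵖ ((Nᵖ *ᵖ ηᵖ *ᵖ ηᵖ) *ᵖ τᵖ) *ᵖ gᵖ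

module Bound (r t w N : ℕ) (r≥1 : 1 ≤ r) (t≥1 : 1 ≤ t) (N≥300 : 300 ≤ N) (N≥Λ : 74 * maderBound r t ≤ N)
  (N≥a^r : (4 * suc w) ^ r ≤ N) (N≥a^e : (4 * suc w) ^ tupleExp r * (4 * suc w) ^ t ≤ N) where
  open Threshold r t N

  private
    N≥1 : 1 ≤ N
    N≥1 = ≤-trans (s≤s z≤n) N≥300

    η≥1 : 1 ≤ η
    η≥1 = (N≥1 ⊛ N≥1 ⊛ N≥1 ⊛ m^n>0 N ⦃ >-nonZero N≥1 ⦄ (2 * r + 1)) ⊛ N≥1 ⊛ N≥1

    N≥20 : 20 ≤ N
    N≥20 = ≤-trans (≤ᵇ⇒≤ 20 300 _) N≥300

  -- Induction on a bound for the number of vertices supplies minimality: a proper subset of larger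
  -- density induces a smaller graph of the same kind.
  not-dense : ∀ f {n} (G : Graph n) → n ≤ f → ¬ HasClique G (suc w) → ¬ ContainsInducedSubdivK r t G → 1 ≤ n → ¬ ρ * n ≤ degSum G full
  not-dense zero G n≤f _ _ n≥1 _ = <⇒≱ n≥1 n≤f
  not-dense (suc f) {n} G n≤f noClique noSub n≥1 dense =
    Minimal.contradiction G w r t r≥1 t≥1 noClique noSub N d d≥1 N≥300 N≥Λ N≥a^r N≥a^e balanced n≥1 dense minimal
    where
    d≥1 : 1 ≤ d
    d≥1 = BalancedCase.d≥1 G w r t r≥1 t≥1 noClique noSub N η N≥20 η≥1 N≥a^r N≥a^e n≥1
    balanced : ∀ (S : Sub n) → 1 ≤ ∣ S ∣ → (∀ i → d ≤ ∣ nb (induced G S) i ∣) →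
      (∀ i → ∣ nb (induced G S) i ∣ ≤ N * (N * (N * N ^ (2 * r + 1))) * (N * (N * d))) → ⊥
    balanced S S≥1 low high = BalancedCase.contradiction (induced G S) w r t r≥1 t≥1 (λ c → noClique (induced-clique G S c))
      (λ c → noSub (induced-subdivision G S c)) N η N≥20 η≥1 N≥a^r N≥a^e S≥1 low (λ i → ≤-trans (high i) (≤-reflexive (lem (N * (N * (N * N ^ (2 * r + 1)))) N d)))
      where
      lem : ∀ K N d → K * (N * (N * d)) ≡ K * (N * N) * d
      lem = solve-∀
    minimal : ∀ S → ∣ S ∣ < n → degSum G S ≤ ρ * ∣ S ∣
    minimal S S<n = ≮⇒≥ λ bad → not-dense f (induced G S) (s≤s⁻¹ (≤-trans S<n n≤f)) (λ c → noClique (induced-clique G S c))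
      (λ c → noSub (induced-subdivision G S c)) (n≢0⇒n>0 λ e → n≮0 (<-≤-trans bad (≤-trans (∑-sub-≤ S n λ v _ → card-≤n _) (≤-reflexive (cong (_* n) e)))))
      (≤-trans (<⇒≤ bad) (≤-reflexive (≡-sym (trans (degSum-full (induced G S)) (induced-degSum G S)))))

  colouring : ∀ {n} (G : Graph n) → ¬ HasClique G (suc w) → ¬ ContainsInducedSubdivK r t G → Colorable G (suc ρ)
  colouring {n} G noClique noSub with peel-or-core G ρ full
  ... | inj₁ peel with c , proper ← peel-colour G peel = c , λ u v → proper u v refl refl
  ... | inj₂ (T , _ , T≥1 , core) = ⊥-elim (not-dense ∣ T ∣ (induced G T) ≤-refl (λ c → noClique (induced-clique G T c))
    (λ c → noSub (induced-subdivision G T c)) T≥1 (≤-trans (≤-reflexive (*-comm ρ ∣ T ∣)) (≤-trans (∑-sub-≥ T ρ λ v v∈ → <⇒≤ (core v v∈))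
      (≤-reflexive (≡-sym (trans (degSum-full (induced G T)) (induced-degSum G T)))))))

opaque
  -- The sum of the four quantities that `N` has to dominate; only the last two depend on `w`.
  base : ℕ → ℕ → ℕ → ℕ
  base r t w = (300 + 74 * maderBound r t) + ((4 * suc w) ^ r + (4 * suc w) ^ tupleExp r * (4 * suc w) ^ t)

  base≥300 : ∀ r t w → 300 ≤ base r t w
  base≥300 r t w = ≤-trans (m≤m+n 300 (74 * maderBound r t)) (m≤m+n (300 + 74 * maderBound r t) _)

  base≥Λ : ∀ r t w → 74 * maderBound r t ≤ base r t w
  base≥Λ r t w = ≤-trans (m≤n+m (74 * maderBound r t) 300) (m≤m+n (300 + 74 * maderBound r t) _)

  base≥a^r : ∀ r t w → (4 * suc w) ^ r ≤ base r t w
  base≥a^r r t w = ≤-trans (m≤m+n ((4 * suc w) ^ r) _) (m≤n+m _ (300 + 74 * maderBound r t))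

  base≥a^e : ∀ r t w → (4 * suc w) ^ tupleExp r * (4 * suc w) ^ t ≤ base r t w
  base≥a^e r t w = ≤-trans (m≤n+m _ ((4 * suc w) ^ r)) (m≤n+m _ (300 + 74 * maderBound r t))

  base-polynomial : ∀ r t → IsPolynomial (base r t)
  base-polynomial r t = (constᵖ 300 +ᵖ constᵖ (74 * maderBound r t)) +ᵖ (aᵖ ^ᵖ r +ᵖ (aᵖ ^ᵖ tupleExp r *ᵖ aᵖ ^ᵖ t))
    where
    aᵖ : IsPolynomial (λ w → 4 * suc w)
    aᵖ = constᵖ 4 *ᵖ (constᵖ 1 +ᵖ idᵖ)

theorem1p2 : (r t : ℕ) → 1 ≤ r → 1 ≤ t →
    Σ (List ℕ) λ p →
    ∀ n (G : Graph n) → ¬ ContainsInducedSubdivK r t G →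
    ∀ w → CliqueNumber G w → Colorable G (evalPoly p w)
theorem1p2 r t r≥1 t≥1 = proj₁ bound , λ n G noSub w (_ , noClique) → subst (Colorable G) (≡-sym (proj₂ bound w))
  (Bound.colouring r t w (base r t w) r≥1 t≥1 (base≥300 r t w) (base≥Λ r t w) (base≥a^r r t w) (base≥a^e r t w) G noClique noSub)
  where
  bound : IsPolynomial (λ w → suc (Threshold.ρ r t (base r t w)))
  bound = constᵖ 1 +ᵖ threshold-polynomial r t (base-polynomial r t)
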